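{- Domino shuffling on the half-hexagon preserves the uniform distribution: for every $n\ge1$, $\psi\mu_{n-1}=\mu_n$, where $\psi:\mathbb C\,\mathrm{HH}(n-1)\to\mathbb C\,\mathrm{HH}(n)$ is the linear map induced by the half-hexagon domino shuffle and $\mu_m=\frac{1}{|\mathrm{HH}(m)|}\sum_{\pi\in\mathrm{HH}(m)}\pi$ is the vector of the uniform probability distribution on $\mathrm{HH}(m)$.
   Context: Staircase tableaux. For $n\ge0$, $\mathrm{ST}(n)$ is the set of integer arrays $(g_{ij})_{0\le j\le i\le n}$ with bottom row $g_{n,j}=2j+1$ ($0\le j\le n$) satisfying the interlacing conditions $g_{i,j}\le g_{i-1,j}<g_{i,j+1}$ for all $1\le i\le n$, $0\le j\le i-1$. Half-hexagon matchings. Let $v=(1,0)$, $w=\frac12(1,\sqrt3)$, and let $\mathcal L$ be the triangular lattice with vertex set $\mathbb Zv+\mathbb Zw$ and edges between vertices at unit distance. Let $R_n$ be the union of the trapezoid with corners $nv,nw,n(w-v),-nv$ and the $n$ trapezoids with corners $(2i-n+1)v+v$, $(2i-n+1)v-v$, $(2i-n+1)v-w$, $(2i-n+1)v+v-w$, $0\le i\le n-1$. The half-hexagon graph $R_n^\vee$ is the subgraph of the planar dual of $\mathcal L$ induced by the dual vertices lying in $R_n$, and $\mathrm{HH}(n)$ is its set of perfect matchings ($\mathrm{HH}(0)$ has a single element, the empty matching). $\mathrm{HH}(n)$ is identified with $\mathrm{ST}(n)$ via a bijection: the vertical edges of $R_n^\vee$ are centred at $(-n-\frac12+j)v+(n-i)w$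 with row index $1\le i\le n$ and position $1\le j\le n+i$; a perfect matching is determined by its vertical edges, row $i$ contains exactly $i$ of them, and $g_{i-1,0}<\dots<g_{i-1,i-1}$ are their positions (row $n$ of the tableau being the fixed row $1,3,\dots,2n+1$). All maps below are defined on tableaux through this identification. Half-hexagon domino shuffle. Input: $(g_{ij})\in\mathrm{ST}(n)$ and independent random variables $\xi_{ij}$ taking values $0,1$ with probability $\frac12$ each. Output: $(h_{ij})\in\mathrm{ST}(n+1)$, computed as follows. For $i$ from $0$ to $n$, and for $j$ from $0$ to $i$: - if $j<i$ and $g_{i,j}=h_{i-1,j}$, set $h_{i,j}=g_{i,j}$; - else if $j>0$ and $g_{i,j}=h_{i-1,j-1}$, set $h_{i,j}=g_{i,j}+1$; - else set $h_{i,j}=g_{i,j}+\xi_{i,j}$. Finally set $h_{n+1,j}=2j+1$ for $0\le j\le n+1$. For $\pi\in\mathrm{HH}(n)$ and $\pi'\in\mathrm{HH}(n+1)$ let $P(\pi\to\pi')$ be the probability that the shuffle outputs $\pi'$ on input $\pi$. $\mathbb C\,\mathrm{HH}(n)$ is the complex vector space with orthonormal basis $\mathrm{HH}(n)$ and inner product $\langle\cdot,\cdot\rangle$, and $\psi:\mathbb C\,\mathrm{HH}(n)\to\mathbb C\,\mathrm{HH}(n+1)$ is the linear map with $\langle\psi(\pi),\pi'\rangle=P(\pi\to\pi')$, i.e. $\psi(\pi)=\sum_{\pi'}P(\pi\to\pi')\,\pi'$. -}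

module Defs where

open import Algebra.Bundles using (CommutativeRing)
import Algebra.Properties.CommutativeMonoid.Sum as Sum
open import Data.Bool.Base using (if_then_else_; _∧_)
open import Data.Fin.Base using (Fin)
open import Data.Integer.Base as ℤ using (ℤ; +_)
import Data.Integer.Properties as ℤ
open import Data.List.Base
  using (List; []; _∷_; _++_; map; concatMap; cartesianProduct; filter; length; upTo; lookup)
import Data.List.Membership.DecPropositional as DecMembership
open import Data.List.Relation.Unary.All using (All; all?)
open import Data.List.Relation.Unary.Any using (Any; any?)
open import Data.Nat.Base using (ℕ; zero; suc; pred; _+_; _*_; _<ᵇ_; _≤ᵇ_; _≡ᵇ_)
import Data.Nat.Properties as ℕ
open import Data.Product.Base using (_×_; _,_)
open import Data.Product.Properties using (≡-dec)
open import Data.Rational.Base as ℚ using (ℚ; 0ℚ)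
open import Data.Sum.Base using (_⊎_)
open import Data.Vec.Functional using (Vector)
open import Relation.Binary.Definitions using (DecidableEquality)
open import Relation.Binary.PropositionalEquality.Core using (_≡_; refl)
open import Relation.Nullary.Decidable using (Dec; yes; no; does; _×-dec_; _⊎-dec_)
open import Relation.Unary using (Decidable)

sublists : ∀ {A : Set} → List A → List (List A)
sublists []       = [] ∷ []
sublists (x ∷ xs) = sublists xs ++ map (x ∷_) (sublists xs)

-- Only used with a nonzero denominator.
ratio : ℕ → ℕ → ℚ
ratio m zero    = 0ℚ
ratio m (suc k) = + m ℚ./ suc k

------------------------------------------------------------------------
-- The triangular lattice and its planar dual

-- (a , b) stands for the point a v + b w.
Point : Set
Point = ℤ × ℤ

-- △ p has corners p, p + v, p + w;  ▽ p has corners p + v, p + w, p + v + w.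
-- The triangles are the vertices of the planar dual.
data Triangle : Set where
  △ ▽ : Point → Triangle

data Direction : Set where
  V W W−V : Direction

-- (p , d) is the lattice edge from p to p + d.  An edge of the planar dual is
-- named by the lattice edge it crosses; the vertical ones cross edges (p , V).
Edge : Set
Edge = Point × Direction

_≟ᵈ_ : DecidableEquality Direction
V   ≟ᵈ V   = yes refl
V   ≟ᵈ W   = no λ ()
V   ≟ᵈ W−V = no λ ()
W   ≟ᵈ V   = no λ ()
W   ≟ᵈ W   = yes refl
W   ≟ᵈ W−V = no λ ()
W−V ≟ᵈ V   = no λ ()
W−V ≟ᵈ W   = no λ ()
W−V ≟ᵈ W−V = yes refl

_≟ᵉ_ : DecidableEquality Edge
_≟ᵉ_ = ≡-dec (≡-dec ℤ._≟_ ℤ._≟_) _≟ᵈ_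

open DecMembership _≟ᵉ_ using (_∈?_)

sides : Triangle → List Edge
sides (△ (a , b)) = ((a , b) , V) ∷ ((a , b) , W) ∷ ((ℤ.suc a , b) , W−V) ∷ []
sides (▽ (a , b)) = ((a , ℤ.suc b) , V) ∷ ((ℤ.suc a , b) , W) ∷ ((ℤ.suc a , b) , W−V) ∷ []

-- The two triangles having the given edge as a side.
faces : Edge → List Triangle
faces ((a , b) , V)   = △ (a , b) ∷ ▽ (a , ℤ.pred b) ∷ []
faces ((a , b) , W)   = △ (a , b) ∷ ▽ (ℤ.pred a , b) ∷ []
faces ((a , b) , W−V) = △ (ℤ.pred a , b) ∷ ▽ (ℤ.pred a , b) ∷ []

------------------------------------------------------------------------
-- The half-hexagon graph

-- Three times the centre of a triangle, in the basis v, w.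
centre₃ : Triangle → Point
centre₃ (△ (a , b)) = (+ 3 ℤ.* a ℤ.+ + 1 , + 3 ℤ.* b ℤ.+ + 1)
centre₃ (▽ (a , b)) = (+ 3 ℤ.* a ℤ.+ + 2 , + 3 ℤ.* b ℤ.+ + 2)

-- The next two predicates say that (x v + y w) / 3 lies in a trapezoid, given
-- by the half-planes of its four sides.

-- Corners n v, n w, n (w - v), - n v.
InUpper : ℕ → Point → Set
InUpper n (x , y) =
  + 0 ℤ.≤ y × y ℤ.≤ + 3 ℤ.* + n ×
  ℤ.- (+ 3 ℤ.* + n) ℤ.≤ x × x ℤ.+ y ℤ.≤ + 3 ℤ.* + n

-- Corners c v + v, c v - v, c v - w, c v + v - w.
InLower : ℤ → Point → Set
InLower c (x , y) =
  ℤ.- (+ 3) ℤ.≤ y × y ℤ.≤ + 0 ×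
  + 3 ℤ.* ℤ.pred c ℤ.≤ x ℤ.+ y × x ℤ.≤ + 3 ℤ.* ℤ.suc c

-- 2 i - n + 1
lowerCentre : ℕ → ℕ → ℤ
lowerCentre n i = ℤ.suc (+ (2 * i) ℤ.- + n)

InR : ℕ → Triangle → Set
InR n t = InUpper n (centre₃ t)
        ⊎ Any (λ i → InLower (lowerCentre n i) (centre₃ t)) (upTo n)

inUpper? : ∀ n → Decidable (InUpper n)
inUpper? n (x , y) = (_ ℤ.≤? _) ×-dec (_ ℤ.≤? _) ×-dec (_ ℤ.≤? _) ×-dec (_ ℤ.≤? _)

inLower? : ∀ c → Decidable (InLower c)
inLower? c (x , y) = (_ ℤ.≤? _) ×-dec (_ ℤ.≤? _) ×-dec (_ ℤ.≤? _) ×-dec (_ ℤ.≤? _)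

inR? : ∀ n → Decidable (InR n)
inR? n t = inUpper? n (centre₃ t) ⊎-dec any? (λ i → inLower? (lowerCentre n i) (centre₃ t)) (upTo n)

-- All points with both coordinates in [ - n - 1 , n + 1 ].  For n ≥ 1 the region
-- R_n lies in | x | ≤ n, - 1 ≤ y ≤ n, so every triangle in R_n, and every side
-- of such a triangle, is based at one of these points.
box : ℕ → List Point
box n = cartesianProduct range range
  where
  range : List ℤ
  range = map (λ k → + k ℤ.- + suc n) (upTo (2 * suc n + 1))

vertices : ℕ → List Triangle
vertices n = filter (inR? n) (concatMap (λ p → △ p ∷ ▽ p ∷ []) (box n))

edges : ℕ → List Edge
edges n = filter (λ e → all? (inR? n) (faces e))
                 (cartesianProduct (box n) (V ∷ W ∷ W−V ∷ []))

degree : List Edge → Triangle → ℕ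
degree M t = length (filter (_∈? M) (sides t))

IsPerfect : ℕ → List Edge → Set
IsPerfect n M = All (λ t → degree M t ≡ 1) (vertices n)

-- Sublists of the repetition-free list edges n represent the sets of edges.
perfectMatchings : ℕ → List (List Edge)
perfectMatchings n =
  filter (λ M → all? (λ t → degree M t ℕ.≟ 1) (vertices n)) (sublists (edges n))

∣HH∣ : ℕ → ℕ
∣HH∣ n = length (perfectMatchings n)

HH : ℕ → Set
HH n = Fin (∣HH∣ n)

matching : ∀ n → HH n → List Edge
matching n = lookup (perfectMatchings n)

------------------------------------------------------------------------
-- Staircase tableaux

-- Only the entries (i , j) with 0 ≤ j ≤ i ≤ n of an array are meaningful.
Array : Set → Set
Array A = ℕ → ℕ → A

cells : ℕ → List (ℕ × ℕ)
cells n = concatMap (λ i → map (i ,_) (upTo (suc i))) (upTo (suc n))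

-- Its centre is (- n - 1/2 + j) v + (n - i) w.
verticalEdge : ℕ → ℕ → ℕ → Edge
verticalEdge n i j = ((+ j ℤ.- + suc n , + n ℤ.- + i) , V)

-- In increasing order.
positions : ℕ → List Edge → ℕ → List ℕ
positions n M i = filter (λ j → verticalEdge n i j ∈? M) (map suc (upTo (n + i)))

nth : List ℕ → ℕ → ℕ
nth []       _       = 0
nth (x ∷ xs) zero    = x
nth (x ∷ xs) (suc j) = nth xs j

-- The identification of HH(n) with ST(n).  Row i of a perfect matching has
-- exactly i vertical edges, so the default value of nth is not reached at any
-- meaningful entry.
tableau : ∀ n → HH n → Array ℕ
tableau n π i j =
  if i <ᵇ n then nth (positions n (matching n π) (suc i)) j else 2 * j + 1

------------------------------------------------------------------------
-- The domino shuffle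

-- Row i of the output, from row i - 1 of the output, row i of the input, and
-- the random bits of row i.
shuffleRow : ℕ → (ℕ → ℕ) → (ℕ → ℕ) → (ℕ → ℕ) → ℕ → ℕ
shuffleRow i above g ξ j =
  if (j <ᵇ i) ∧ (g j ≡ᵇ above j) then g j
  else if (0 <ᵇ j) ∧ (g j ≡ᵇ above (pred j)) then g j + 1
  else g j + ξ j

-- Row 0 has no row above it, and at its only entry j = 0 none is consulted.
shuffleRows : Array ℕ → Array ℕ → Array ℕ
shuffleRows g ξ zero    = shuffleRow 0 (λ _ → 0) (g 0) (ξ 0)
shuffleRows g ξ (suc i) = shuffleRow (suc i) (shuffleRows g ξ i) (g (suc i)) (ξ (suc i))

shuffle : ℕ → Array ℕ → Array ℕ → Array ℕ
shuffle n g ξ i j = if i ≤ᵇ n then shuffleRows g ξ i j else 2 * j + 1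

open DecMembership (≡-dec ℕ._≟_ ℕ._≟_) using () renaming (_∈?_ to _∈ᶜ?_)

-- An outcome of the independent fair bits is given by the set of cells whose
-- bit is 1; all such sets are equally likely.
outcomes : ℕ → List (List (ℕ × ℕ))
outcomes n = sublists (cells n)

bits : List (ℕ × ℕ) → Array ℕ
bits S i j = if does ((i , j) ∈ᶜ? S) then 1 else 0

Agree : ℕ → Array ℕ → Array ℕ → Set
Agree n g h = All (λ (i , j) → g i j ≡ h i j) (cells n)

agree? : ∀ n g h → Dec (Agree n g h)
agree? n g h = all? (λ (i , j) → g i j ℕ.≟ h i j) (cells n)

-- P(π → π′)
P : ∀ n → HH n → HH (suc n) → ℚ
P n π π′ =
  ratio (length (filter (λ S → agree? (suc n) (shuffle n (tableau n π) (bits S))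
                                              (tableau (suc n) π′))
                        (outcomes n)))
        (length (outcomes n))

------------------------------------------------------------------------
-- The shuffle as a linear map

-- The coefficients lie in a commutative ring K, with ι : ℚ → K to be a ring
-- homomorphism; K = ℂ is the intended instance.
module Linear {c ℓ} (K : CommutativeRing c ℓ) (ι : ℚ → CommutativeRing.Carrier K) where

  private module K = CommutativeRing K
  open Sum K.+-commutativeMonoid using (sum)

  -- K HH(n), a vector being given by its coefficients in the basis HH(n).
  KHH : ℕ → Set c
  KHH n = Vector K.Carrier (∣HH∣ n)

  ψ : ∀ n → KHH n → KHH (suc n)
  ψ n x π′ = sum {∣HH∣ n} (λ π → x π K.* ι (P n π π′))

  μ : ∀ n → KHH n
  μ n _ = ι (ratio 1 (∣HH∣ n))

{-# OPTIONS --safe #-}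

-- Fix an output h and build the inputs g that can lead to it row by row, from the
-- top.  The entries of g satisfy x ∈ { h , h - 1 }.  Given the row x of g, an entry H
-- of the row of h above leaves the two candidates H - 1 and H for the entry of g
-- above; a candidate is lost exactly when H equals one of its two neighbours in x,
-- and then the bit of that neighbour is irrelevant, which restores the factor 2.  So
-- the number of pairs (input, bits) leading to h is a product of powers of 2 that does
-- not depend on h.  As all outcomes of the bits are equally likely and every pair has
-- exactly one output in ST(n + 1), the uniform distribution is preserved.
--
-- Matchings become tableaux because a row of triangles is a path △ ▽ △ … ▽ △ whose
-- vertices matched upwards or downwards can be removed exactly if they interlace, and
-- then the rest of the path has a unique perfect matching.

module Submission where

open import Defs
open import Algebra.Bundles using (AbelianGroup; CommutativeRing)
open import Algebra.Morphism.Structures using (IsRingHomomorphism)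
import Algebra.Properties.CommutativeMonoid.Sum as Sum
import Algebra.Properties.Group as Group
open import Data.Bool.Base using (Bool; true; false; not; _∧_; _∨_; if_then_else_; T)
import Data.Bool.Properties as Bool
open import Data.Fin.Base using (Fin)
open import Data.Integer.Base as ℤ using (ℤ; +_)
import Data.Integer.Properties as ℤ
import Data.Integer.Tactic.RingSolver as ℤRing
open import Data.List.Base using (List; []; _∷_; upTo; map; cartesianProduct; _++_; length; filter; applyUpTo; concatMap; cartesianProductWith; lookup)
import Data.List.Membership.DecPropositional as DecMembership
open import Data.List.Membership.Propositional using (_∈_; find; lose)
open import Data.List.Membership.Propositional.Properties as ∈ using (∈-lookup)
open import Data.List.Membership.Propositional.Properties.WithK using (unique∧set⇒bag)
open import Data.List.Properties using (∷-injective; ∷-injectiveˡ; ∷-injectiveʳ; map-++; map-upTo)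
open import Data.List.Relation.Binary.BagAndSetEquality using (∼bag⇒↭)
open import Data.List.Relation.Binary.Permutation.Propositional using (_↭_)
import Data.List.Relation.Binary.Permutation.Propositional.Properties as ↭
open import Data.List.Relation.Unary.All as All using (All; []; _∷_; all?)
open import Data.List.Relation.Unary.AllPairs using (AllPairs; []; _∷_)
open import Data.List.Relation.Unary.Any as Any using (Any; here; there)
open import Data.List.Relation.Unary.Unique.Propositional using (Unique)
import Data.List.Relation.Unary.Unique.Propositional.Properties as Unique
open import Data.Nat.Base using (ℕ; zero; suc; pred; _+_; _*_; _≤_; _<_; z≤n; s≤s; _∸_; _^_; _≡ᵇ_; _<ᵇ_; _≤ᵇ_)
open import Data.Nat.ListAction using (sum; product)
open import Data.Nat.ListAction.Properties using (sum-++; sum-↭; product-++)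
import Data.Nat.Properties as ℕ
import Data.Nat.Tactic.RingSolver as ℕRing
open import Data.Product.Base using (_×_; _,_; ∃; ∃₂; proj₁; proj₂)
open import Data.Product.Properties using (≡-dec)
open import Data.Rational.Base as ℚ using (ℚ; +-*-rawRing)
import Data.Rational.Properties as ℚ
open import Data.Rational.Unnormalised.Base as ℚᵘ using (mkℚᵘ; *≡*)
import Data.Rational.Unnormalised.Properties as ℚᵘ
open import Data.Sum.Base using (_⊎_; inj₁; inj₂)
open import Function.Bundles using (_⇔_; mk⇔; Equivalence)
open import Level using (Level)
open import Relation.Binary.Definitions using (DecidableEquality)
open import Relation.Binary.PropositionalEquality
import Relation.Binary.Reasoning.Setoid as ≈-Reasoning
open import Relation.Nullary using (¬_; contradiction; does; yes; no)
open import Relation.Nullary.Decidable using (dec-true; dec-false; does-⇔)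
open import Relation.Unary using (Decidable)

open Equivalence using (to; from)

-- The factor 2 of an irrelevant bit arises in row `i`, while the candidate is lost in row `i - 1`,
-- so neither row has a constant count by itself. What is controlled is the number of bit choices in
-- row `i` times the sum over the row above it, up to the indicator that row `i` is compatible with
-- `h`; the induction carries this indicator along. At the bottom it is 1: row `n` of the input is
-- `2 j + 1`, and the fixed row `n + 1` of `h` forces its row `n` into `2 j + 1` or `2 j + 2`. The
-- shuffle reads its own output in the row above, so the bits of different rows interact;
-- prescribing the whole output `h` decouples them and turns the number of outcomes into a product
-- over cells. The normalising constants are compared by double counting: the constant `total n` per
-- output and the number of outcomes per input are linked through the number of all transitions. In
-- the geometry, the ragged bottom row is made regular by treating each missing △ as already matched
-- downwards. This produces the row 1, 3, ..., 2 n + 1 and lets every row follow the same path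
-- argument.

-- The region in row coordinates

-- All coordinates of centres are compared in units of 1/3, so that a remainder r < 3
-- does not matter.
≤⇔≤ : ∀ {x y} r s t → r ≤ 2 → x ℤ.- y ≡ + 3 ℤ.* + s ℤ.- + 3 ℤ.* + t ℤ.- + r → x ℤ.≤ y ⇔ s ≤ t
≤⇔≤ {x} {y} r s t r≤2 eq = mk⇔
  (λ x≤y → ℕ.≤-pred (ℕ.*-cancelˡ-< 3 s (suc t) (ℤ.drop‿+<+ (ℤ.≤-<-trans (le x≤y) lt))))
  (λ s≤t → ℤ.i-j≤0⇒i≤j (subst (ℤ._≤ + 0) (sym eq′)
     (ℤ.i≤j⇒i-j≤0 (ℤ.+≤+ (ℕ.≤-trans (ℕ.*-monoʳ-≤ 3 s≤t) (ℕ.m≤m+n _ r))))))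
  where
  reassoc : ∀ a b c → a ℤ.- b ℤ.- c ≡ a ℤ.- (b ℤ.+ c)
  reassoc = ℤRing.solve-∀
  eq′ : x ℤ.- y ≡ + (3 * s) ℤ.- + (3 * t + r)
  eq′ = trans eq (trans (reassoc (+ 3 ℤ.* + s) _ _)
          (cong₂ (λ a b → a ℤ.- (b ℤ.+ + r)) (sym (ℤ.pos-* 3 s)) (sym (ℤ.pos-* 3 t))))
  le : x ℤ.≤ y → + (3 * s) ℤ.≤ + (3 * t + r)
  le x≤y = ℤ.i-j≤0⇒i≤j (subst (ℤ._≤ + 0) eq′ (ℤ.i≤j⇒i-j≤0 x≤y))
  lt : + (3 * t + r) ℤ.< + (3 * suc t)
  lt = ℤ.+<+ (subst (3 * t + r <_) (trans (ℕ.+-comm (3 * t) 3) (sym (ℕ.*-suc 3 t)))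
                (ℕ.+-monoʳ-< (3 * t) (s≤s r≤2)))

-- Rows and positions are those of verticalEdge.
pt : ℕ → ℕ → ℕ → Point
pt n i j = (+ j ℤ.- + suc n , + n ℤ.- + i)

odd : ℕ → Bool
odd zero    = false
odd (suc j) = not (odd j)

-- The triangles of R_n in row i, at position j.  In the bottom row n + 1 the odd △ lie
-- outside R_n.
△In ▽In : ℕ → ℕ → ℕ → Set
△In n i j = 1 ≤ i × i ≤ suc n × 1 ≤ j × j ≤ n + i × (i ≡ suc n → odd j ≡ false)
▽In n i j = 1 ≤ i × i ≤ suc n × 1 ≤ j × j < n + i

-- The differences of the two sides of the inequalities in InUpper (u) and InLower (l);
-- K + (K + 0) is how + (2 * k) unfolds.
private
 u△1 : ∀ N I → + 0 ℤ.- (+ 3 ℤ.* (N ℤ.- I) ℤ.+ + 1) ≡ + 3 ℤ.* I ℤ.- + 3 ℤ.* N ℤ.- + 1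
 u△1 = ℤRing.solve-∀
 u△2 : ∀ N I → (+ 3 ℤ.* (N ℤ.- I) ℤ.+ + 1) ℤ.- (+ 3 ℤ.* N) ≡ + 3 ℤ.* + 1 ℤ.- + 3 ℤ.* I ℤ.- + 2
 u△2 = ℤRing.solve-∀
 u△3 : ∀ N J → (ℤ.- (+ 3 ℤ.* N)) ℤ.- (+ 3 ℤ.* (J ℤ.- (+ 1 ℤ.+ N)) ℤ.+ + 1) ≡ + 3 ℤ.* + 1 ℤ.- + 3 ℤ.* J ℤ.- + 1
 u△3 = ℤRing.solve-∀
 u△4 : ∀ N I J → ((+ 3 ℤ.* (J ℤ.- (+ 1 ℤ.+ N)) ℤ.+ + 1) ℤ.+ (+ 3 ℤ.* (N ℤ.- I) ℤ.+ + 1)) ℤ.- (+ 3 ℤ.* N) ≡ + 3 ℤ.* J ℤ.- + 3 ℤ.* (N ℤ.+ I) ℤ.- + 1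
 u△4 = ℤRing.solve-∀
 l△1 : ∀ N I → (ℤ.- + 3) ℤ.- (+ 3 ℤ.* (N ℤ.- I) ℤ.+ + 1) ≡ + 3 ℤ.* I ℤ.- + 3 ℤ.* (+ 1 ℤ.+ N) ℤ.- + 1
 l△1 = ℤRing.solve-∀
 l△2 : ∀ N I → (+ 3 ℤ.* (N ℤ.- I) ℤ.+ + 1) ℤ.- + 0 ≡ + 3 ℤ.* (+ 1 ℤ.+ N) ℤ.- + 3 ℤ.* I ℤ.- + 2
 l△2 = ℤRing.solve-∀
 l△3 : ∀ N I J K → (+ 3 ℤ.* (ℤ.- + 1 ℤ.+ (+ 1 ℤ.+ ((K ℤ.+ (K ℤ.+ + 0)) ℤ.- N)))) ℤ.- ((+ 3 ℤ.* (J ℤ.- (+ 1 ℤ.+ N)) ℤ.+ + 1) ℤ.+ (+ 3 ℤ.* (N ℤ.- I) ℤ.+ + 1)) ≡ + 3 ℤ.* (+ 1 ℤ.+ ((K ℤ.+ (K ℤ.+ + 0)) ℤ.+ I)) ℤ.- + 3 ℤ.* (N ℤ.+ J) ℤ.- + 2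
 l△3 = ℤRing.solve-∀
 l△4 : ∀ N J K → (+ 3 ℤ.* (J ℤ.- (+ 1 ℤ.+ N)) ℤ.+ + 1) ℤ.- (+ 3 ℤ.* (+ 1 ℤ.+ (+ 1 ℤ.+ ((K ℤ.+ (K ℤ.+ + 0)) ℤ.- N)))) ≡ + 3 ℤ.* J ℤ.- + 3 ℤ.* (+ 2 ℤ.+ (K ℤ.+ (K ℤ.+ + 0))) ℤ.- + 2
 l△4 = ℤRing.solve-∀
 u▽1 : ∀ N I → + 0 ℤ.- (+ 3 ℤ.* (N ℤ.- I) ℤ.+ + 2) ≡ + 3 ℤ.* I ℤ.- + 3 ℤ.* N ℤ.- + 2
 u▽1 = ℤRing.solve-∀
 u▽2 : ∀ N I → (+ 3 ℤ.* (N ℤ.- I) ℤ.+ + 2) ℤ.- (+ 3 ℤ.* N) ≡ + 3 ℤ.* + 1 ℤ.- + 3 ℤ.* I ℤ.- + 1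
 u▽2 = ℤRing.solve-∀
 u▽3 : ∀ N J → (ℤ.- (+ 3 ℤ.* N)) ℤ.- (+ 3 ℤ.* (J ℤ.- (+ 1 ℤ.+ N)) ℤ.+ + 2) ≡ + 3 ℤ.* + 1 ℤ.- + 3 ℤ.* J ℤ.- + 2
 u▽3 = ℤRing.solve-∀
 u▽4 : ∀ N I J → ((+ 3 ℤ.* (J ℤ.- (+ 1 ℤ.+ N)) ℤ.+ + 2) ℤ.+ (+ 3 ℤ.* (N ℤ.- I) ℤ.+ + 2)) ℤ.- (+ 3 ℤ.* N) ≡ + 3 ℤ.* (+ 1 ℤ.+ J) ℤ.- + 3 ℤ.* (N ℤ.+ I) ℤ.- + 2
 u▽4 = ℤRing.solve-∀
 l▽1 : ∀ N I → (ℤ.- + 3) ℤ.- (+ 3 ℤ.* (N ℤ.- I) ℤ.+ + 2) ≡ + 3 ℤ.* I ℤ.- + 3 ℤ.* (+ 1 ℤ.+ N) ℤ.- + 2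
 l▽1 = ℤRing.solve-∀
 l▽2 : ∀ N I → (+ 3 ℤ.* (N ℤ.- I) ℤ.+ + 2) ℤ.- + 0 ≡ + 3 ℤ.* (+ 1 ℤ.+ N) ℤ.- + 3 ℤ.* I ℤ.- + 1
 l▽2 = ℤRing.solve-∀
 l▽3 : ∀ N I J K → (+ 3 ℤ.* (ℤ.- + 1 ℤ.+ (+ 1 ℤ.+ ((K ℤ.+ (K ℤ.+ + 0)) ℤ.- N)))) ℤ.- ((+ 3 ℤ.* (J ℤ.- (+ 1 ℤ.+ N)) ℤ.+ + 2) ℤ.+ (+ 3 ℤ.* (N ℤ.- I) ℤ.+ + 2)) ≡ + 3 ℤ.* ((K ℤ.+ (K ℤ.+ + 0)) ℤ.+ I) ℤ.- + 3 ℤ.* (N ℤ.+ J) ℤ.- + 1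
 l▽3 = ℤRing.solve-∀
 l▽4 : ∀ N J K → (+ 3 ℤ.* (J ℤ.- (+ 1 ℤ.+ N)) ℤ.+ + 2) ℤ.- (+ 3 ℤ.* (+ 1 ℤ.+ (+ 1 ℤ.+ ((K ℤ.+ (K ℤ.+ + 0)) ℤ.- N)))) ≡ + 3 ℤ.* J ℤ.- + 3 ℤ.* (+ 2 ℤ.+ (K ℤ.+ (K ℤ.+ + 0))) ℤ.- + 1
 l▽4 = ℤRing.solve-∀

 upper-△ : ∀ n i j → InUpper n (centre₃ (△ (pt n i j))) ⇔ (i ≤ n × 1 ≤ i × 1 ≤ j × j ≤ n + i)
 upper-△ n i j = mk⇔ (λ (a , b , c , d) → to e₁ a , to e₂ b , to e₃ c , to e₄ d)
                        (λ (a , b , c , d) → from e₁ a , from e₂ b , from e₃ c , from e₄ d)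
   where
   e₁ = ≤⇔≤ 1 i n (s≤s z≤n) (u△1 (+ n) (+ i))
   e₂ = ≤⇔≤ 2 1 i ℕ.≤-refl (u△2 (+ n) (+ i))
   e₃ = ≤⇔≤ 1 1 j (s≤s z≤n) (u△3 (+ n) (+ j))
   e₄ = ≤⇔≤ 1 j (n + i) (s≤s z≤n) (u△4 (+ n) (+ i) (+ j))

 lower-△ : ∀ n i j k → InLower (lowerCentre n k) (centre₃ (△ (pt n i j)))
              ⇔ (i ≤ suc n × suc n ≤ i × (suc (2 * k + i)) ≤ n + j × j ≤ 2 + 2 * k)
 lower-△ n i j k = mk⇔ (λ (a , b , c , d) → to e₁ a , to e₂ b , to e₃ c , to e₄ d)
                          (λ (a , b , c , d) → from e₁ a , from e₂ b , from e₃ c , from e₄ d)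
   where
   e₁ = ≤⇔≤ 1 i (suc n) (s≤s z≤n) (l△1 (+ n) (+ i))
   e₂ = ≤⇔≤ 2 (suc n) i ℕ.≤-refl (l△2 (+ n) (+ i))
   e₃ = ≤⇔≤ 2 (suc (2 * k + i)) (n + j) ℕ.≤-refl (l△3 (+ n) (+ i) (+ j) (+ k))
   e₄ = ≤⇔≤ 2 j (2 + 2 * k) ℕ.≤-refl (l△4 (+ n) (+ j) (+ k))

 upper-▽ : ∀ n i j → InUpper n (centre₃ (▽ (pt n i j))) ⇔ (i ≤ n × 1 ≤ i × 1 ≤ j × (suc j) ≤ n + i)
 upper-▽ n i j = mk⇔ (λ (a , b , c , d) → to e₁ a , to e₂ b , to e₃ c , to e₄ d)
                        (λ (a , b , c , d) → from e₁ a , from e₂ b , from e₃ c , from e₄ d)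
   where
   e₁ = ≤⇔≤ 2 i n ℕ.≤-refl (u▽1 (+ n) (+ i))
   e₂ = ≤⇔≤ 1 1 i (s≤s z≤n) (u▽2 (+ n) (+ i))
   e₃ = ≤⇔≤ 2 1 j ℕ.≤-refl (u▽3 (+ n) (+ j))
   e₄ = ≤⇔≤ 2 (suc j) (n + i) ℕ.≤-refl (u▽4 (+ n) (+ i) (+ j))

 lower-▽ : ∀ n i j k → InLower (lowerCentre n k) (centre₃ (▽ (pt n i j)))
              ⇔ (i ≤ suc n × suc n ≤ i × (2 * k + i) ≤ n + j × j ≤ 2 + 2 * k)
 lower-▽ n i j k = mk⇔ (λ (a , b , c , d) → to e₁ a , to e₂ b , to e₃ c , to e₄ d)
                          (λ (a , b , c , d) → from e₁ a , from e₂ b , from e₃ c , from e₄ d)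
   where
   e₁ = ≤⇔≤ 2 i (suc n) ℕ.≤-refl (l▽1 (+ n) (+ i))
   e₂ = ≤⇔≤ 1 (suc n) i (s≤s z≤n) (l▽2 (+ n) (+ i))
   e₃ = ≤⇔≤ 1 (2 * k + i) (n + j) (s≤s z≤n) (l▽3 (+ n) (+ i) (+ j) (+ k))
   e₄ = ≤⇔≤ 1 j (2 + 2 * k) (s≤s z≤n) (l▽4 (+ n) (+ j) (+ k))

 parity : ∀ m → ∃ λ k → m ≡ 2 * k ⊎ m ≡ suc (2 * k)
 parity zero    = 0 , inj₁ refl
 parity (suc m) with parity m
 ... | k , inj₁ refl = k , inj₂ refl
 ... | k , inj₂ refl = suc k , inj₁ (sym (ℕ.*-suc 2 k))

 odd-2* : ∀ k → odd (2 * k) ≡ false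
 odd-2* zero    = refl
 odd-2* (suc k) = trans (cong odd (ℕ.*-suc 2 k)) (trans (Bool.not-involutive _) (odd-2* k))

 shift₁ : ∀ n k → 2 * k + suc n ≡ n + suc (2 * k)
 shift₁ = ℕRing.solve-∀

 shift₂ : ∀ n k → suc (2 * k + suc n) ≡ n + (2 + 2 * k)
 shift₂ = ℕRing.solve-∀

 2+2*k≤ : ∀ {n k} → k < n → 2 + 2 * k ≤ n + n
 2+2*k≤ {n} {k} k<n = subst₂ _≤_ (ℕ.*-suc 2 k) (cong (λ x → n + x) (ℕ.+-identityʳ n)) (ℕ.*-monoʳ-≤ 2 k<n)

 half< : ∀ {n k} → suc (2 * k) ≤ n + n → k < n
 half< {n} {k} le = ℕ.*-cancelˡ-< 2 k n (subst (suc (2 * k) ≤_) (cong (λ x → n + x) (sym (ℕ.+-identityʳ n))) le)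

-- On row `n + 1` the trapezoid with index `k` contains a single △, at position `2 k + 2`, where the
-- last two bounds of `lower-△` meet. This is the origin of the parity condition.
InR-△ : ∀ n i j → InR n (△ (pt n i j)) ⇔ △In n i j
InR-△ n i j = mk⇔ f g
  where
  f : InR n (△ (pt n i j)) → △In n i j
  f (inj₁ u) with i≤n , 1≤i , 1≤j , j≤n+i ← to (upper-△ n i j) u =
    1≤i , ℕ.m≤n⇒m≤1+n i≤n , 1≤j , j≤n+i , λ { refl → contradiction i≤n ℕ.1+n≰n }
  f (inj₂ l) with k , k∈ , l′ ← find l
    with i≤ , ≤i , k≤j , j≤k ← to (lower-△ n i j k) l′
    with refl ← ℕ.≤-antisym i≤ ≤i
    with refl ← ℕ.≤-antisym j≤k (ℕ.+-cancelˡ-≤ n _ _ (subst (_≤ n + j) (shift₂ n k) k≤j)) =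
    s≤s z≤n , ℕ.≤-refl , s≤s z≤n ,
    subst (2 + 2 * k ≤_) (sym (ℕ.+-suc n n)) (ℕ.m≤n⇒m≤1+n (2+2*k≤ (∈.∈-upTo⁻ k∈))) ,
    λ _ → trans (Bool.not-involutive _) (odd-2* k)
  g : △In n i j → InR n (△ (pt n i j))
  g (1≤i , i≤1+n , 1≤j , j≤n+i , even) with ℕ.m≤n⇒m<n∨m≡n i≤1+n
  ... | inj₁ i<1+n = inj₁ (from (upper-△ n i j) (ℕ.≤-pred i<1+n , 1≤i , 1≤j , j≤n+i))
  g (1≤i , i≤1+n , s≤s {n = m} _ , j≤n+i , even) | inj₂ refl with parity m
  ... | k , inj₁ refl = contradiction (trans (cong not (sym (odd-2* k))) (even refl)) λ ()
  ... | k , inj₂ refl = inj₂ (lose (∈.∈-upTo⁺ k<n)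
          (from (lower-△ n i j k) (ℕ.≤-refl , ℕ.≤-refl , ℕ.≤-reflexive (shift₂ n k) , ℕ.≤-refl)))
    where
    k<n : k < n
    k<n = half< (ℕ.≤-pred (subst (2 + 2 * k ≤_) (ℕ.+-suc n n) j≤n+i))

-- The trapezoid with index `k` contains the ▽ at positions `2 k + 1` and `2 k + 2` of row `n + 1`,
-- so together the trapezoids leave no gap there.
InR-▽ : ∀ n i j → InR n (▽ (pt n i j)) ⇔ ▽In n i j
InR-▽ n i j = mk⇔ f g
  where
  f : InR n (▽ (pt n i j)) → ▽In n i j
  f (inj₁ u) with i≤n , 1≤i , 1≤j , j<n+i ← to (upper-▽ n i j) u =
    1≤i , ℕ.m≤n⇒m≤1+n i≤n , 1≤j , j<n+i
  f (inj₂ l) with k , k∈ , l′ ← find l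
    with i≤ , ≤i , k≤j , j≤k ← to (lower-▽ n i j k) l′
    with refl ← ℕ.≤-antisym i≤ ≤i =
    s≤s z≤n , ℕ.≤-refl ,
    ℕ.≤-trans (s≤s z≤n) (ℕ.+-cancelˡ-≤ n (suc (2 * k)) _ (subst (_≤ n + j) (shift₁ n k) k≤j)) ,
    subst (suc j ≤_) (sym (ℕ.+-suc n n)) (s≤s (ℕ.≤-trans j≤k (2+2*k≤ (∈.∈-upTo⁻ k∈))))
  g : ▽In n i j → InR n (▽ (pt n i j))
  g (1≤i , i≤1+n , 1≤j , j<n+i) with ℕ.m≤n⇒m<n∨m≡n i≤1+n
  ... | inj₁ i<1+n = inj₁ (from (upper-▽ n i j) (ℕ.≤-pred i<1+n , 1≤i , 1≤j , j<n+i))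
  g (1≤i , i≤1+n , s≤s {n = m} _ , j<n+i) | inj₂ refl with parity m
  ... | k , inj₁ refl = inj₂ (lose (∈.∈-upTo⁺ (half< {k = k} j≤))
          (from (lower-▽ n i j k) (ℕ.≤-refl , ℕ.≤-refl , ℕ.≤-reflexive (shift₁ n k) , ℕ.m≤n⇒m≤1+n ℕ.≤-refl)))
    where
    j≤ : j ≤ n + n
    j≤ = ℕ.≤-pred (subst (suc j ≤_) (ℕ.+-suc n n) j<n+i)
  ... | k , inj₂ refl = inj₂ (lose (∈.∈-upTo⁺ (half< {k = k} (ℕ.≤-trans (ℕ.n≤1+n _) j≤)))
          (from (lower-▽ n i j k) (ℕ.≤-refl , ℕ.≤-refl , ℕ.≤-trans (ℕ.≤-reflexive (shift₁ n k)) (ℕ.+-monoʳ-≤ n (ℕ.n≤1+n _)) , ℕ.≤-refl)))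
    where
    j≤ : j ≤ n + n
    j≤ = ℕ.≤-pred (subst (suc j ≤_) (ℕ.+-suc n n) j<n+i)

-- Left inverses of `pt`; the absolute values make them total and do nothing on the points
-- `pt n i j`.
rowOf colOf : ℕ → Point → ℕ
rowOf n (a , b) = ℤ.∣ + n ℤ.- b ∣
colOf n (a , b) = ℤ.∣ a ℤ.+ + suc n ∣

rowOf-pt : ∀ n i j → rowOf n (pt n i j) ≡ i
rowOf-pt n i j = cong ℤ.∣_∣ (eq (+ n) (+ i))
  where
  eq : ∀ N I → N ℤ.- (N ℤ.- I) ≡ I
  eq = ℤRing.solve-∀

colOf-pt : ∀ n i j → colOf n (pt n i j) ≡ j
colOf-pt n i j = cong ℤ.∣_∣ (eq (+ j) (+ suc n))
  where
  eq : ∀ J N → J ℤ.- N ℤ.+ N ≡ J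
  eq = ℤRing.solve-∀

pt-injective : ∀ {n i j k l} → pt n i j ≡ pt n k l → i ≡ k × j ≡ l
pt-injective {n} {i} {j} {k} {l} eq =
  trans (sym (rowOf-pt n i j)) (trans (cong (rowOf n) eq) (rowOf-pt n k l)) ,
  trans (sym (colOf-pt n i j)) (trans (cong (colOf n) eq) (colOf-pt n k l))

pred-pt : ∀ n i j → (proj₁ (pt n i j) , ℤ.pred (proj₂ (pt n i j))) ≡ pt n (suc i) j
pred-pt n i j = cong (_ ,_) (eq (+ n) (+ i))
  where
  eq : ∀ N I → ℤ.- + 1 ℤ.+ (N ℤ.- I) ≡ N ℤ.- (+ 1 ℤ.+ I)
  eq = ℤRing.solve-∀

suc-pt : ∀ n i j → (proj₁ (pt n (suc i) j) , ℤ.suc (proj₂ (pt n (suc i) j))) ≡ pt n i j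
suc-pt n i j = cong (_ ,_) (eq (+ n) (+ i))
  where
  eq : ∀ N I → + 1 ℤ.+ (N ℤ.- (+ 1 ℤ.+ I)) ≡ N ℤ.- I
  eq = ℤRing.solve-∀

pt-suc : ∀ n i j → (ℤ.suc (proj₁ (pt n i j)) , proj₂ (pt n i j)) ≡ pt n i (suc j)
pt-suc n i j = cong (_, _) (eq (+ j) (+ suc n))
  where
  eq : ∀ J N → + 1 ℤ.+ (J ℤ.- N) ≡ + 1 ℤ.+ J ℤ.- N
  eq = ℤRing.solve-∀

pt-pred : ∀ n i j → (ℤ.pred (proj₁ (pt n i (suc j))) , proj₂ (pt n i j)) ≡ pt n i j
pt-pred n i j = cong (_, _) (eq (+ j) (+ suc n))
  where
  eq : ∀ J N → ℤ.- + 1 ℤ.+ (+ 1 ℤ.+ J ℤ.- N) ≡ J ℤ.- N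
  eq = ℤRing.solve-∀

private
 coordinates : ∀ n a b → ℤ.- (+ suc n) ℤ.≤ a → b ℤ.≤ + n → ∃₂ λ i j → (a , b) ≡ pt n i j
 coordinates n a b -n≤a b≤n = ℤ.∣ + n ℤ.- b ∣ , ℤ.∣ a ℤ.- ℤ.- + suc n ∣ ,
   cong₂ _,_
    (trans (eq₁ a (+ suc n)) (cong (ℤ._- + suc n) (sym (ℤ.0≤i⇒+∣i∣≡i (ℤ.i≤j⇒0≤j-i -n≤a)))))
    (trans (eq₂ b (+ n)) (cong (λ x → + n ℤ.- x) (sym (ℤ.0≤i⇒+∣i∣≡i (ℤ.i≤j⇒0≤j-i b≤n)))))
   where
   eq₁ : ∀ a N → a ≡ a ℤ.- ℤ.- N ℤ.- N
   eq₁ = ℤRing.solve-∀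
   eq₂ : ∀ b N → b ≡ N ℤ.- (N ℤ.- b)
   eq₂ = ℤRing.solve-∀

 -- These are the two bounds that natural row and position numbers require. In a lower trapezoid,
 -- `y ≤ 0` gives `x ≥ x + y ≥ 3 (2 k - n) ≥ - 3 n`.
 centre-bounds : ∀ n {x y} → InUpper n (x , y) ⊎ Any (λ i → InLower (lowerCentre n i) (x , y)) (upTo n) →
   ℤ.- (+ 3 ℤ.* + n) ℤ.≤ x × y ℤ.≤ + 3 ℤ.* + n
 centre-bounds n (inj₁ (_ , y≤ , ≤x , _)) = ≤x , y≤
 centre-bounds n {x} {y} (inj₂ l) with k , _ , (_ , y≤0 , c≤ , _) ← find l =
   ℤ.≤-trans (subst (_ ℤ.≤_) (sym (eq (+ n) (+ k))) (ℤ.i≤i+j _ (+ (k + (k + (k + (k + (k + k))))))))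
     (ℤ.≤-trans c≤ (subst (x ℤ.+ y ℤ.≤_) (ℤ.+-identityʳ x) (ℤ.+-monoʳ-≤ x y≤0))) ,
   ℤ.≤-trans y≤0 (subst (+ 0 ℤ.≤_) (ℤ.pos-* 3 n) (ℤ.+≤+ z≤n))
   where
   eq : ∀ N K → + 3 ℤ.* (ℤ.- + 1 ℤ.+ (+ 1 ℤ.+ (K ℤ.+ (K ℤ.+ + 0) ℤ.- N))) ≡
                ℤ.- (+ 3 ℤ.* N) ℤ.+ (K ℤ.+ (K ℤ.+ (K ℤ.+ (K ℤ.+ (K ℤ.+ K)))))
   eq = ℤRing.solve-∀

 centre-coordinates : ∀ n a b e → e ≤ 3 → ℤ.- (+ 3 ℤ.* + n) ℤ.≤ + 3 ℤ.* a ℤ.+ + e →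
   + 3 ℤ.* b ℤ.+ + e ℤ.≤ + 3 ℤ.* + n → ∃₂ λ i j → (a , b) ≡ pt n i j
 centre-coordinates n a b e e≤3 ≤a b≤ = coordinates n a b
   (ℤ.*-cancelˡ-≤-pos _ _ (+ 3) (ℤ.i-j≤0⇒i≤j (subst (ℤ._≤ + 0) (eq (+ n) a)
     (ℤ.i≤j⇒i-j≤0 (ℤ.≤-trans ≤a (ℤ.+-monoʳ-≤ (+ 3 ℤ.* a) (ℤ.+≤+ e≤3)))))))
   (ℤ.*-cancelˡ-≤-pos _ _ (+ 3) (ℤ.≤-trans (ℤ.i≤i+j _ (+ e)) b≤))
   where
   eq : ∀ N a → ℤ.- (+ 3 ℤ.* N) ℤ.- (+ 3 ℤ.* a ℤ.+ + 3) ≡ + 3 ℤ.* ℤ.- (+ 1 ℤ.+ N) ℤ.- + 3 ℤ.* a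
   eq = ℤRing.solve-∀

△-coordinates : ∀ n p → InR n (△ p) → ∃₂ λ i j → p ≡ pt n i j × △In n i j
△-coordinates n (a , b) r with ≤a , b≤ ← centre-bounds n r
  with i , j , refl ← centre-coordinates n a b 1 (s≤s z≤n) ≤a b≤ = i , j , refl , to (InR-△ n i j) r

▽-coordinates : ∀ n p → InR n (▽ p) → ∃₂ λ i j → p ≡ pt n i j × ▽In n i j
▽-coordinates n (a , b) r with ≤a , b≤ ← centre-bounds n r
  with i , j , refl ← centre-coordinates n a b 2 (s≤s (s≤s z≤n)) ≤a b≤ = i , j , refl , to (InR-▽ n i j) r

-- The position may be one beyond the last △ of the row, since the right side of a △ is based at the
-- next position.
pt∈box : ∀ n i j → i ≤ suc n → j ≤ suc (n + i) → pt n i j ∈ box n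
pt∈box n i j i≤ j≤ = ∈.∈-cartesianProduct⁺
  (∈.∈-map⁺ _ (∈.∈-upTo⁺ (subst (j <_) (width n) (s≤s (ℕ.≤-trans j≤ (s≤s (ℕ.+-monoʳ-≤ n i≤)))))))
  (second (ℕ.m≤n⇒∃[o]m+o≡n i≤))
  where
  width : ∀ n → suc (suc (n + suc n)) ≡ 2 * suc n + 1
  width = ℕRing.solve-∀
  eq : ∀ N D I → N ℤ.+ D ℤ.- (I ℤ.+ D) ≡ N ℤ.- I
  eq = ℤRing.solve-∀
  second : ∃ (λ d → i + d ≡ suc n) → + n ℤ.- + i ∈ map (λ k → + k ℤ.- + suc n) (upTo (2 * suc n + 1))
  second (d , e) = subst (_∈ _) (trans (cong (λ x → + (n + d) ℤ.- + x) (sym e)) (eq (+ n) (+ d) (+ i)))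
    (∈.∈-map⁺ _ (∈.∈-upTo⁺ (subst (n + d <_) (width n)
       (s≤s (ℕ.m≤n⇒m≤1+n (ℕ.+-monoʳ-≤ n (ℕ.m+n≤o⇒n≤o i (ℕ.≤-reflexive e))))))))

-- The `W` edge at position `j + 1` separates ▽ `j` from △ `j + 1`; the `W−V` edge at position
-- `j + 1` separates △ `j` from ▽ `j`; a vertical edge joins △ `j` to the ▽ below it in row `i + 1`.
data EdgeView (n : ℕ) (e : Edge) : Set where
  vertical : ∀ {i j} → e ≡ (pt n i j , V) → △In n i j → ▽In n (suc i) j → EdgeView n e
  left     : ∀ {i j} → e ≡ (pt n i (suc j) , W) → △In n i (suc j) → ▽In n i j → EdgeView n e
  right    : ∀ {i j} → e ≡ (pt n i (suc j) , W−V) → △In n i j → ▽In n i j → EdgeView n e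

edge-view : ∀ {n e} → e ∈ edges n → EdgeView n e
edge-view {n} {(a , b) , d} e∈ = view d (proj₂ (∈.∈-filter⁻ (λ e → all? (inR? n) (faces e)) {xs = cartesianProduct (box n) (V ∷ W ∷ W−V ∷ [])} e∈))
  where
  view : ∀ d → All (InR n) (faces ((a , b) , d)) → EdgeView n ((a , b) , d)
  view V (△∈ ∷ ▽∈ ∷ []) with i , j , refl , tri ← △-coordinates n (a , b) △∈ =
    vertical refl tri (to (InR-▽ n (suc i) j) (subst (λ p → InR n (▽ p)) (pred-pt n i j) ▽∈))
  view W (△∈ ∷ ▽∈ ∷ []) with △-coordinates n (a , b) △∈
  ... | i , suc j , refl , tri = left refl tri (to (InR-▽ n i j) (subst (λ p → InR n (▽ p)) (pt-pred n i j) ▽∈))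
  ... | i , zero , refl , _ , _ , () , _
  view W−V (△∈ ∷ ▽∈ ∷ []) with i , j , eq , tri ← △-coordinates n (ℤ.pred a , b) △∈ =
    right (cong (_, W−V) (trans (cong (_, b) (sym (ℤ.suc-pred a)))
                         (trans (cong (λ p → ℤ.suc (proj₁ p) , proj₂ p) eq) (pt-suc n i j))))
      tri (to (InR-▽ n i j) (subst (λ p → InR n (▽ p)) eq ▽∈))

private
 ∈-filter-edges : ∀ {n p d} → p ∈ box n → d ∈ V ∷ W ∷ W−V ∷ [] → All (InR n) (faces (p , d)) → (p , d) ∈ edges n
 ∈-filter-edges {n} {p} {d} p∈ d∈ all = ∈.∈-filter⁺ (λ e → all? (inR? n) (faces e))
   {xs = cartesianProduct (box n) (V ∷ W ∷ W−V ∷ [])} (∈.∈-cartesianProduct⁺ p∈ d∈) all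

∈-edges : ∀ {n e} → EdgeView n e → e ∈ edges n
∈-edges {n} (vertical {i} {j} refl tri@(_ , i≤ , _ , j≤ , _) inv) = ∈-filter-edges
  (pt∈box n i j i≤ (ℕ.m≤n⇒m≤1+n j≤)) (here refl)
  (from (InR-△ n i j) tri ∷ subst (λ p → InR n (▽ p)) (sym (pred-pt n i j)) (from (InR-▽ n (suc i) j) inv) ∷ [])
∈-edges {n} (left {i} {j} refl tri@(_ , i≤ , _ , j≤ , _) inv) = ∈-filter-edges
  (pt∈box n i (suc j) i≤ (ℕ.m≤n⇒m≤1+n j≤)) (there (here refl))
  (from (InR-△ n i (suc j)) tri ∷ subst (λ p → InR n (▽ p)) (sym (pt-pred n i j)) (from (InR-▽ n i j) inv) ∷ [])
∈-edges {n} (right {i} {j} refl tri@(_ , i≤ , _ , j≤ , _) inv) = ∈-filter-edges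
  (pt∈box n i (suc j) i≤ (s≤s j≤)) (there (there (here refl)))
  (subst (λ p → InR n (△ p)) (sym (pt-pred n i j)) (from (InR-△ n i j) tri)
    ∷ subst (λ p → InR n (▽ p)) (sym (pt-pred n i j)) (from (InR-▽ n i j) inv) ∷ [])

-- Matchings of a row of triangles

-- The first list is the row below. The inequality is weak on the left and strict on the right
-- because ▽ `y` comes after △ `y` and before △ `y + 1` in the path.
data Interlaces : List ℕ → List ℕ → Set where
  single : ∀ {x} → Interlaces (x ∷ []) []
  cons : ∀ {x y x′ xs ys} → x ≤ y → y < x′ → Interlaces (x′ ∷ xs) ys → Interlaces (x ∷ x′ ∷ xs) (y ∷ ys)

interlaces-∷ : ∀ {x y xs ys} → x ≤ y → All (y <_) xs → Interlaces xs ys → Interlaces (x ∷ xs) (y ∷ ys)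
interlaces-∷ x≤y (y<x′ ∷ _) i@single       = cons x≤y y<x′ i
interlaces-∷ x≤y (y<x′ ∷ _) i@(cons _ _ _) = cons x≤y y<x′ i

interlaces-tail : ∀ {x y xs ys} → Interlaces (x ∷ xs) (y ∷ ys) → Interlaces xs ys
interlaces-tail (cons _ _ i) = i

first≰ : ∀ {y xs ys} → All (y <_) xs → ¬ Interlaces xs (y ∷ ys)
first≰ (y<x ∷ _) (cons x≤y _ _) = ℕ.<⇒≱ y<x x≤y

second≰ : ∀ {x x′ xs ys} → All (x′ ≤_) ys → ¬ Interlaces (x ∷ x′ ∷ xs) ys
second≰ (x′≤y ∷ _) (cons _ y<x′ _) = ℕ.<⇒≱ y<x′ x′≤y

indices : (ℕ → Bool) → ℕ → ℕ → List ℕ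
indices f a zero    = []
indices f a (suc m) = if f a then a ∷ indices f (suc a) m else indices f (suc a) m

indices-≥ : ∀ f a m → All (a ≤_) (indices f a m)
indices-≥ f a zero    = []
indices-≥ f a (suc m) with f a
... | true  = ℕ.≤-refl ∷ All.map ℕ.<⇒≤ (indices-≥ f (suc a) m)
... | false = All.map ℕ.<⇒≤ (indices-≥ f (suc a) m)

bit : Bool → ℕ
bit b = if b then 1 else 0

One : Bool → Bool → Bool → Set
One a b c = bit a + (bit b + bit c) ≡ 1

-- A row of triangles △ ▽ △ … ▽ △ numbered from a, each of which is covered once:
-- u and w mark the vertical edges below the △ and above the ▽, q and p the edges
-- on the left and on the right of each △.
data Path (u w q p : ℕ → Bool) : ℕ → ℕ → Set where
  end  : ∀ {a} → One (u a) (q a) (p a) → p a ≡ false → Path u w q p a 0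
  step : ∀ {a m} → One (u a) (q a) (p a) → One (w a) (q (suc a)) (p a) →
         Path u w q p (suc a) m → Path u w q p a (suc m)

module _ {u w q p : ℕ → Bool} where

  path : ∀ a m → (∀ j → a ≤ j → j ≤ a + m → One (u j) (q j) (p j)) →
         (∀ j → a ≤ j → j < a + m → One (w j) (q (suc j)) (p j)) →
         p (a + m) ≡ false → Path u w q p a m
  path a zero    tri inv e = end (tri a ℕ.≤-refl (ℕ.m≤m+n a 0)) (trans (cong p (sym (ℕ.+-identityʳ a))) e)
  path a (suc m) tri inv e = step (tri a ℕ.≤-refl (ℕ.m≤m+n a _)) (inv a ℕ.≤-refl (ℕ.m<m+n a (s≤s z≤n)))
    (path (suc a) m (λ j a<j j≤ → tri j (ℕ.<⇒≤ a<j) (subst (j ≤_) (sym (ℕ.+-suc a m)) j≤))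
                    (λ j a<j j< → inv j (ℕ.<⇒≤ a<j) (subst (j <_) (sym (ℕ.+-suc a m)) j<))
                    (trans (cong p (sym (ℕ.+-suc a m))) e))

  path-△ : ∀ {a m} → Path u w q p a m → ∀ j → a ≤ j → j ≤ a + m → One (u j) (q j) (p j)
  path-△ {a} {zero} (end o _) j a≤j j≤ = subst (λ j → One (u j) (q j) (p j)) (ℕ.≤-antisym a≤j (subst (j ≤_) (ℕ.+-identityʳ a) j≤)) o
  path-△ {a} {suc m} (step o _ π) j a≤j j≤ with ℕ.m≤n⇒m<n∨m≡n a≤j
  ... | inj₁ a<j  = path-△ π j a<j (subst (j ≤_) (ℕ.+-suc a m) j≤)
  ... | inj₂ refl = o

  path-▽ : ∀ {a m} → Path u w q p a m → ∀ j → a ≤ j → j < a + m → One (w j) (q (suc j)) (p j)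
  path-▽ {a} {zero} (end o _) j a≤j j< = contradiction (ℕ.<-≤-trans (subst (j <_) (ℕ.+-identityʳ a) j<) a≤j) (ℕ.<-irrefl refl)
  path-▽ {a} {suc m} (step _ o π) j a≤j j< with ℕ.m≤n⇒m<n∨m≡n a≤j
  ... | inj₁ a<j  = path-▽ π j a<j (subst (j <_) (ℕ.+-suc a m) j<)
  ... | inj₂ refl = o

  path-end : ∀ {a m} → Path u w q p a m → p (a + m) ≡ false
  path-end {a} (end _ e) = trans (cong p (ℕ.+-identityʳ a)) e
  path-end {a} {suc m} (step _ _ π) = trans (cong p (ℕ.+-suc a m)) (path-end π)

  -- An edge on the left of △ j is used exactly if some x ≤ j - 1 is still waiting for its y.
  path⇒interlaces : ∀ {a m} → Path u w q p a m → q a ≡ false →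
                    Interlaces (indices u a (suc m)) (indices w a m)
  path⇒interlaces′ : ∀ {x a m} → Path u w q p a m → q a ≡ true → x ≤ a →
                     Interlaces (x ∷ indices u a (suc m)) (indices w a m)
  path⇒interlaces {a} (end o e) q≡ rewrite q≡ | e with u a
  ... | true = single
  path⇒interlaces {a} {suc m} (step o o′ π) q≡ rewrite q≡ with u a | p a | w a | q (suc a) in q′≡
  ... | true  | false | true  | false = interlaces-∷ ℕ.≤-refl (indices-≥ u (suc a) (suc m)) (path⇒interlaces π q′≡)
  ... | true  | false | false | true  = path⇒interlaces′ π q′≡ (ℕ.n≤1+n a)
  ... | false | true  | false | false = path⇒interlaces π q′≡
  ... | false | true  | true  | true  = contradiction o′ λ ()
  ... | false | true  | false | true  = contradiction o′ λ ()
  path⇒interlaces′ {x} {a} (end o e) q≡ x≤a rewrite q≡ | e with u a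
  ... | false = single
  path⇒interlaces′ {x} {a} {suc m} (step o o′ π) q≡ x≤a rewrite q≡ with u a | p a | w a | q (suc a) in q′≡
  ... | false | false | true  | false = interlaces-∷ x≤a (indices-≥ u (suc a) (suc m)) (path⇒interlaces π q′≡)
  ... | false | false | false | true  = path⇒interlaces′ π q′≡ (ℕ.m≤n⇒m≤1+n x≤a)

-- This is `not w ∧ not p` for `p = rightOf u q`: a ▽ matched neither upwards nor with the △ before
-- it must be matched with the △ after it.
nextLeft : Bool → Bool → Bool → Bool
nextLeft u w q = not w ∧ (u ∨ q)

rightOf : Bool → Bool → Bool
rightOf u q = not u ∧ not q

rightOf-unique : ∀ u q p → One u q p → p ≡ rightOf u q
rightOf-unique true  false false _ = refl
rightOf-unique false true  false _ = refl
rightOf-unique false false true  _ = refl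

nextLeft-unique : ∀ u w q q′ p → One u q p → One w q′ p → q′ ≡ nextLeft u w q
nextLeft-unique true  true  false false false _ _ = refl
nextLeft-unique true  false false true  false _ _ = refl
nextLeft-unique false true  true  false false _ _ = refl
nextLeft-unique false false true  true  false _ _ = refl
nextLeft-unique false false false false true  _ _ = refl

-- Position 0 is a dummy, and the △ at position 1 has no ▽ on its left.
leftEdge : (u w : ℕ → Bool) → ℕ → Bool
leftEdge u w zero    = false
leftEdge u w (suc zero) = false
leftEdge u w (suc j@(suc _)) = nextLeft (u j) (w j) (leftEdge u w j)

rightEdge : (u w : ℕ → Bool) → ℕ → Bool
rightEdge u w j = rightOf (u j) (leftEdge u w j)

module _ {u w q p : ℕ → Bool} (p≡ : ∀ j → p j ≡ rightOf (u j) (q j)) where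

  private
   end′ : ∀ {a b d} → u a ≡ b → q a ≡ d → One b d (rightOf b d) → rightOf b d ≡ false → Path u w q p a 0
   end′ {a} refl refl o e = end (subst (One (u a) (q a)) (sym (p≡ a)) o) (trans (p≡ a) e)

   step′ : ∀ {a m b c d} → q (suc a) ≡ nextLeft (u a) (w a) (q a) → u a ≡ b → w a ≡ c → q a ≡ d →
           One b d (rightOf b d) → One c (nextLeft b c d) (rightOf b d) →
           (q (suc a) ≡ nextLeft b c d → Path u w q p (suc a) m) → Path u w q p a (suc m)
   step′ {a} q≡ refl refl refl o o′ π =
     step (subst (One (u a) (q a)) (sym (p≡ a)) o) (subst₂ (One (w a)) (sym q≡) (sym (p≡ a)) o′) (π q≡)

  -- The recursion breaks a covering condition inside the path in two situations only: a ▽ matched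
  -- upwards while no `x` is waiting, and a △ matched downwards while one is. `first≰` and `second≰`
  -- exclude them, and `single` settles the last △.
  interlaces⇒path : ∀ a m → (∀ j → a ≤ j → q (suc j) ≡ nextLeft (u j) (w j) (q j)) →
                    Interlaces (indices u a (suc m)) (indices w a m) →
                    q a ≡ false → Path u w q p a m
  interlaces⇒path′ : ∀ x a m → (∀ j → a ≤ j → q (suc j) ≡ nextLeft (u j) (w j) (q j)) →
                     Interlaces (x ∷ indices u a (suc m)) (indices w a m) →
                     q a ≡ true → Path u w q p a m
  interlaces⇒path a zero s i q≡ with u a in u≡
  interlaces⇒path a zero s single q≡ | true = end′ u≡ q≡ refl refl
  interlaces⇒path a (suc m) s i q≡ with u a in u≡ | w a in w≡
  ... | true  | true  = step′ (s a ℕ.≤-refl) u≡ w≡ q≡ refl refl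
                          (interlaces⇒path (suc a) m (λ j a<j → s j (ℕ.<⇒≤ a<j)) (interlaces-tail i))
  ... | true  | false = step′ (s a ℕ.≤-refl) u≡ w≡ q≡ refl refl
                          (interlaces⇒path′ a (suc a) m (λ j a<j → s j (ℕ.<⇒≤ a<j)) i)
  ... | false | true  = contradiction i (first≰ (indices-≥ u (suc a) (suc m)))
  ... | false | false = step′ (s a ℕ.≤-refl) u≡ w≡ q≡ refl refl
                          (interlaces⇒path (suc a) m (λ j a<j → s j (ℕ.<⇒≤ a<j)) i)
  interlaces⇒path′ x a zero s i q≡ with u a in u≡
  interlaces⇒path′ x a zero s single q≡ | false = end′ u≡ q≡ refl refl
  interlaces⇒path′ x a (suc m) s i q≡ with u a in u≡
  ... | true = contradiction i (second≰ (indices-≥ w a (suc m)))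
  ... | false with w a in w≡
  ...   | true  = step′ (s a ℕ.≤-refl) u≡ w≡ q≡ refl refl
                    (interlaces⇒path (suc a) m (λ j a<j → s j (ℕ.<⇒≤ a<j)) (interlaces-tail i))
  ...   | false = step′ (s a ℕ.≤-refl) u≡ w≡ q≡ refl refl
                    (interlaces⇒path′ x (suc a) m (λ j a<j → s j (ℕ.<⇒≤ a<j)) i)

-- The matching is forced from left to right: covering △ `j` decides its right edge, and covering ▽
-- `j` then decides the left edge of △ `j + 1`.
path-unique : ∀ {u w q p u′ w′ q′ p′ a m} → Path u w q p a m → Path u′ w′ q′ p′ a m →
              (∀ j → a ≤ j → j ≤ a + m → u j ≡ u′ j) → (∀ j → a ≤ j → j < a + m → w j ≡ w′ j) → q a ≡ q′ a →
              ∀ j → a ≤ j → j ≤ a + m → q j ≡ q′ j × p j ≡ p′ j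
path-unique {u} {w} {q} {p} {u′} {w′} {q′} {p′} {a} {m} (end o _) (end o′ _) u≡ w≡ q≡ j a≤j j≤
  with refl ← ℕ.≤-antisym a≤j (subst (j ≤_) (ℕ.+-identityʳ a) j≤) =
  q≡ , trans (rightOf-unique (u a) (q a) (p a) o) (trans (cong₂ rightOf (u≡ a a≤j j≤) q≡) (sym (rightOf-unique (u′ a) (q′ a) (p′ a) o′)))
path-unique {u} {w} {q} {p} {u′} {w′} {q′} {p′} {a} {suc m} (step o i π) (step o′ i′ π′) u≡ w≡ q≡ j a≤j j≤ with ℕ.m≤n⇒m<n∨m≡n a≤j
... | inj₂ refl = q≡ , trans (rightOf-unique (u a) (q a) (p a) o) (trans (cong₂ rightOf (u≡ a a≤j j≤) q≡) (sym (rightOf-unique (u′ a) (q′ a) (p′ a) o′)))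
... | inj₁ a<j  = path-unique π π′
  (λ j a<j j≤ → u≡ j (ℕ.<⇒≤ a<j) (subst (j ≤_) (sym (ℕ.+-suc a m)) j≤))
  (λ j a<j j< → w≡ j (ℕ.<⇒≤ a<j) (subst (j <_) (sym (ℕ.+-suc a m)) j<))
  (trans (nextLeft-unique (u a) (w a) (q a) (q (suc a)) (p a) o i)
    (trans (cong₂ (λ u (w , q) → nextLeft u w q) (u≡ a ℕ.≤-refl (ℕ.m≤m+n a _)) (cong₂ _,_ (w≡ a ℕ.≤-refl (ℕ.m<m+n a (s≤s z≤n))) q≡))
           (sym (nextLeft-unique (u′ a) (w′ a) (q′ a) (q′ (suc a)) (p′ a) o′ i′))))
  j a<j (subst (j ≤_) (ℕ.+-suc a m) j≤)

-- Sorted lists and their characteristic functions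

interlaces-head< : ∀ {x xs ys} → Interlaces (x ∷ xs) ys → All (x <_) xs
interlaces-head< single = []
interlaces-head< (cons x≤y y<x′ i) = x<x′ ∷ All.map (ℕ.<-trans x<x′) (interlaces-head< i)
  where x<x′ = ℕ.≤-<-trans x≤y y<x′

interlaces-sorted : ∀ {xs ys} → Interlaces xs ys → AllPairs _<_ xs
interlaces-sorted single              = [] ∷ []
interlaces-sorted i@(cons _ _ i′) = interlaces-head< i ∷ interlaces-sorted i′

interlaces-≥ : ∀ {a xs ys} → Interlaces xs ys → All (a ≤_) xs → All (a ≤_) ys
interlaces-≥ single         _           = []
interlaces-≥ (cons x≤y _ i) (a≤x ∷ a≤xs) = ℕ.≤-trans a≤x x≤y ∷ interlaces-≥ i a≤xs

interlaces-< : ∀ {b xs ys} → Interlaces xs ys → All (_≤ b) xs → All (_< b) ys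
interlaces-< single         _                     = []
interlaces-< (cons _ y<x i) (_ ∷ x≤bs@(x≤b ∷ _)) = ℕ.<-≤-trans y<x x≤b ∷ interlaces-< i x≤bs

interlaces-length : ∀ {xs ys} → Interlaces xs ys → length xs ≡ suc (length ys)
interlaces-length single       = refl
interlaces-length (cons _ _ i) = cong suc (interlaces-length i)

indices-cong : ∀ {f g} a m → (∀ j → a ≤ j → j < a + m → f j ≡ g j) → indices f a m ≡ indices g a m
indices-cong a zero    eq = refl
indices-cong {f} {g} a (suc m) eq
  rewrite eq a ℕ.≤-refl (ℕ.m<m+n a (s≤s z≤n))
        | indices-cong {f} {g} (suc a) m (λ j a<j j< → eq j (ℕ.<⇒≤ a<j) (subst (j <_) (sym (ℕ.+-suc a m)) j<)) = refl

∈-indices : ∀ f a m {j} → j ∈ indices f a m → a ≤ j × j < a + m × f j ≡ true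
∈-indices f a (suc m) j∈ with f a in fa
∈-indices f a (suc m) (here refl) | true = ℕ.≤-refl , ℕ.m<m+n a (s≤s z≤n) , fa
∈-indices f a (suc m) {j} (there j∈)  | true =
  let a<j , j< , fj = ∈-indices f (suc a) m j∈ in ℕ.<⇒≤ a<j , subst (j <_) (sym (ℕ.+-suc a m)) j< , fj
∈-indices f a (suc m) {j} j∈      | false =
  let a<j , j< , fj = ∈-indices f (suc a) m j∈ in ℕ.<⇒≤ a<j , subst (j <_) (sym (ℕ.+-suc a m)) j< , fj

indices-∈ : ∀ f a m {j} → a ≤ j → j < a + m → f j ≡ true → j ∈ indices f a m
indices-∈ f a zero    {j} a≤j j< fj = contradiction (ℕ.<-≤-trans (subst (j <_) (ℕ.+-identityʳ a) j<) a≤j) (ℕ.<-irrefl refl)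
indices-∈ f a (suc m) {j} a≤j j< fj with ℕ.m≤n⇒m<n∨m≡n a≤j
... | inj₂ refl rewrite fj = here refl
... | inj₁ a<j with f a | indices-∈ f (suc a) m a<j (subst (j <_) (ℕ.+-suc a m) j<) fj
...   | true  | j∈ = there j∈
...   | false | j∈ = j∈

indices-injective : ∀ {f g} a m → indices f a m ≡ indices g a m → ∀ j → a ≤ j → j < a + m → f j ≡ g j
indices-injective {f} {g} a m eq j a≤j j< with f j in fj | g j in gj
... | true  | true  = refl
... | false | false = refl
... | true  | false = trans (sym (proj₂ (proj₂ (∈-indices g a m (subst (j ∈_) eq (indices-∈ f a m a≤j j< fj)))))) gj
... | false | true  = trans (sym fj) (proj₂ (proj₂ (∈-indices f a m (subst (j ∈_) (sym eq) (indices-∈ g a m a≤j j< gj)))))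

-- `f` is `a +_` up to pointwise equality only, because the recursion of `applyUpTo` replaces `f` by
-- its composite with `suc`.
filter≡indices : ∀ {P : ℕ → Set} (P? : Decidable P) a m f → (∀ k → f k ≡ a + k) →
                 filter P? (applyUpTo f m) ≡ indices (λ j → does (P? j)) a m
filter≡indices P? a zero    f eq = refl
filter≡indices P? a (suc m) f eq with refl ← trans (sym (ℕ.+-identityʳ a)) (sym (eq 0)) with does (P? (f 0))
... | true  = cong (f 0 ∷_) (filter≡indices P? (suc (f 0)) m (λ k → f (suc k)) λ k → trans (eq (suc k)) (ℕ.+-suc (f 0) k))
... | false = filter≡indices P? (suc (f 0)) m (λ k → f (suc k)) λ k → trans (eq (suc k)) (ℕ.+-suc (f 0) k)

indices-sorted : ∀ {f} a m {xs} → AllPairs _<_ xs → All (a ≤_) xs → All (_< a + m) xs →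
                 (∀ {j} → a ≤ j → f j ≡ true → j ∈ xs) → (∀ {j} → j ∈ xs → f j ≡ true) → indices f a m ≡ xs
indices-sorted a zero {[]} s ≤xs <xs ∈xs xs∈ = refl
indices-sorted a zero {x ∷ xs} s (a≤x ∷ _) (x<a ∷ _) ∈xs xs∈ =
  contradiction (ℕ.<-≤-trans (subst (x <_) (ℕ.+-identityʳ a) x<a) a≤x) (ℕ.<-irrefl refl)
indices-sorted {f} a (suc m) {xs} s ≤xs <xs ∈xs xs∈ with f a in fa
indices-sorted {f} a (suc m) {xs} s ≤xs <xs ∈xs xs∈ | false =
  indices-sorted (suc a) m s (All.tabulate λ {x} x∈ → ℕ.≤∧≢⇒< (All.lookup ≤xs x∈) λ { refl → contradiction (trans (sym fa) (xs∈ x∈)) λ () })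
    (subst (λ b → All (_< b) xs) (ℕ.+-suc a m) <xs) (λ a<j → ∈xs (ℕ.<⇒≤ a<j)) xs∈
indices-sorted {f} a (suc m) {xs} s ≤xs <xs ∈xs xs∈ | true with xs | s | ≤xs | <xs | (λ {j} → ∈xs {j}) | ∈xs ℕ.≤-refl fa
... | x ∷ xs | (x< ∷ s) | (_ ∷ ≤xs) | (_ ∷ <xs) | ∈xs | here refl = cong (a ∷_)
  (indices-sorted (suc a) m s x< (subst (λ b → All (_< b) xs) (ℕ.+-suc a m) <xs)
    (λ a<j fj → Any.tail (λ { refl → ℕ.<-irrefl refl a<j }) (∈xs (ℕ.<⇒≤ a<j) fj)) (λ j∈ → xs∈ (there j∈)))
... | x ∷ xs | (x< ∷ s) | (a≤x ∷ ≤xs) | _ | _ | there a∈ = contradiction (ℕ.<-≤-trans (All.lookup x< a∈) a≤x) (ℕ.<-irrefl refl)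

-- Enumeration of tableaux

between : ℕ → ℕ → List ℕ
between x x′ = map (λ k → x + k) (upTo (x′ ∸ x))

interlacing : List ℕ → List (List ℕ)
interlacing []            = []
interlacing (x ∷ [])      = [] ∷ []
interlacing (x ∷ x′ ∷ xs) = cartesianProductWith _∷_ (between x x′) (interlacing (x′ ∷ xs))

-- The rows above the given one, from the lowest to the highest.
data Pattern : List ℕ → List (List ℕ) → Set where
  done : ∀ {x} → Pattern (x ∷ []) []
  _∷_  : ∀ {xs ys yss} → Interlaces xs ys → Pattern ys yss → Pattern xs (ys ∷ yss)

patterns : ℕ → List ℕ → List (List (List ℕ))
patterns zero    xs = [] ∷ []
patterns (suc n) xs = concatMap (λ ys → map (ys ∷_) (patterns n ys)) (interlacing xs)

between-∈ : ∀ {x y x′} → x ≤ y → y < x′ → y ∈ between x x′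
between-∈ {x} {y} {x′} x≤y y<x′ = subst (_∈ _) (ℕ.m+[n∸m]≡n x≤y) (∈.∈-map⁺ _ (∈.∈-upTo⁺ (ℕ.∸-monoˡ-< y<x′ x≤y)))

∈-between : ∀ {x y x′} → y ∈ between x x′ → x ≤ y × y < x′
∈-between {x} {x′ = x′} y∈ with k , k∈ , refl ← ∈.∈-map⁻ _ y∈ =
  ℕ.m≤m+n x k , subst (x + k <_) (ℕ.m+[n∸m]≡n (ℕ.<⇒≤ (ℕ.m∸n≢0⇒n<m {x′} {x} λ eq → contradiction (subst (k <_) eq k<) λ ()))) (ℕ.+-monoʳ-< x k<)
  where k< = ∈.∈-upTo⁻ k∈

between-unique : ∀ x x′ → Unique (between x x′)
between-unique x x′ = Unique.map⁺ (ℕ.+-cancelˡ-≡ x _ _) (Unique.upTo⁺ _)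

interlacing-∈ : ∀ {xs ys} → Interlaces xs ys → ys ∈ interlacing xs
interlacing-∈ single = here refl
interlacing-∈ (cons x≤y y<x′ i) = ∈.∈-cartesianProductWith⁺ _∷_ (between-∈ x≤y y<x′) (interlacing-∈ i)

∈-interlacing : ∀ {xs ys} → ys ∈ interlacing xs → Interlaces xs ys
∈-interlacing {x ∷ []} (here refl) = single
∈-interlacing {x ∷ x′ ∷ xs} ys∈ with y , ys , y∈ , ys∈ , refl ← ∈.∈-cartesianProductWith⁻ _∷_ (between x x′) (interlacing (x′ ∷ xs)) ys∈ =
  let x≤y , y<x′ = ∈-between y∈ in cons x≤y y<x′ (∈-interlacing ys∈)

interlacing-unique : ∀ xs → Unique (interlacing xs)
interlacing-unique []            = []
interlacing-unique (x ∷ [])      = [] ∷ []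
interlacing-unique (x ∷ x′ ∷ xs) = Unique.cartesianProductWith⁺ _∷_ ∷-injective (between-unique x x′) (interlacing-unique (x′ ∷ xs))

patterns-∈ : ∀ n {xs yss} → length xs ≡ suc n → Pattern xs yss → yss ∈ patterns n xs
patterns-∈ zero    l done    = here refl
patterns-∈ zero    l (i ∷ c) with interlaces-length i
patterns-∈ zero l (i ∷ done)    | eq = contradiction (trans (sym l) eq) λ ()
patterns-∈ zero l (i ∷ (i′ ∷ c)) | eq = contradiction (trans (sym l) (trans eq (cong suc (interlaces-length i′)))) λ ()
patterns-∈ (suc n) l (i ∷ c) = ∈.∈-concatMap⁺ _ (lose (interlacing-∈ i)
  (∈.∈-map⁺ _ (patterns-∈ n (ℕ.suc-injective (trans (sym (interlaces-length i)) l)) c)))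

∈-patterns : ∀ n {xs yss} → length xs ≡ suc n → yss ∈ patterns n xs → Pattern xs yss
∈-patterns zero {x ∷ []} l (here refl) = done
∈-patterns (suc n) {xs} l yss∈ with ys , ys∈ , m ← find (∈.∈-concatMap⁻ (λ ys → map (ys ∷_) (patterns n ys)) {xs = interlacing xs} yss∈)
  with yss , yss∈ , refl ← ∈.∈-map⁻ _ m =
  i ∷ ∈-patterns n (ℕ.suc-injective (trans (sym (interlaces-length i)) l)) yss∈
  where i = ∈-interlacing ys∈

concatMap-∷-unique : ∀ {A : Set} (f : A → List (List A)) {xs} → Unique xs → (∀ x → Unique (f x)) →
                     Unique (concatMap (λ x → map (x ∷_) (f x)) xs)
concatMap-∷-unique f [] u = []
concatMap-∷-unique f {x ∷ xs} (x∉ ∷ us) u = Unique.++⁺ (Unique.map⁺ ∷-injectiveʳ (u x)) (concatMap-∷-unique f us u) disj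
  where
  disj : ∀ {v} → ¬ (v ∈ map (x ∷_) (f x) × v ∈ concatMap (λ x → map (x ∷_) (f x)) xs)
  disj (v∈ , v∈′) with _ , _ , refl ← ∈.∈-map⁻ _ v∈
    with y , y∈ , m ← find (∈.∈-concatMap⁻ (λ x → map (x ∷_) (f x)) {xs = xs} v∈′)
    with _ , _ , eq ← ∈.∈-map⁻ _ m = All.lookup x∉ y∈ (∷-injectiveˡ eq)

patterns-unique : ∀ n xs → Unique (patterns n xs)
patterns-unique zero    xs = [] ∷ []
patterns-unique (suc n) xs = concatMap-∷-unique (patterns n) (interlacing-unique xs) (patterns-unique n)

-- Sublists of a repetition-free list as sets

module _ {A : Set} where

  ∈-sublists : ∀ {xs ys : List A} {x} → ys ∈ sublists xs → x ∈ ys → x ∈ xs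
  ∈-sublists {[]} (here refl) ()
  ∈-sublists {x ∷ xs} ys∈ x∈ with ∈.∈-++⁻ (sublists xs) ys∈
  ... | inj₁ ys∈ = there (∈-sublists ys∈ x∈)
  ... | inj₂ ys∈′ with zs , zs∈ , refl ← ∈.∈-map⁻ _ ys∈′ with x∈
  ...   | here refl = here refl
  ...   | there x∈′ = there (∈-sublists zs∈ x∈′)

  filter∈sublists : ∀ {P : A → Set} (P? : Decidable P) xs → filter P? xs ∈ sublists xs
  filter∈sublists P? [] = here refl
  filter∈sublists P? (x ∷ xs) with does (P? x)
  ... | true  = ∈.∈-++⁺ʳ (sublists xs) (∈.∈-map⁺ _ (filter∈sublists P? xs))
  ... | false = ∈.∈-++⁺ˡ (filter∈sublists P? xs)

  sublists-unique : ∀ {xs : List A} → Unique xs → Unique (sublists xs)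
  sublists-unique []        = [] ∷ []
  sublists-unique {x ∷ xs} (x∉ ∷ u) = Unique.++⁺ (sublists-unique u) (Unique.map⁺ ∷-injectiveʳ (sublists-unique u))
    λ { (ys∈ , ys∈′) → let _ , _ , eq = ∈.∈-map⁻ _ ys∈′ in
        All.lookup x∉ (∈-sublists ys∈ (subst (x ∈_) (sym eq) (here refl))) refl }

  -- This is what allows two matchings to be identified by comparing which edges they contain.
  sublists-ext : ∀ {xs ys zs : List A} → Unique xs → ys ∈ sublists xs → zs ∈ sublists xs →
                 (∀ {x} → x ∈ ys → x ∈ zs) → (∀ {x} → x ∈ zs → x ∈ ys) → ys ≡ zs
  sublists-ext {[]} u (here refl) (here refl) f g = refl
  sublists-ext {x ∷ xs} (x∉ ∷ u) ys∈ zs∈ f g with ∈.∈-++⁻ (sublists xs) ys∈ | ∈.∈-++⁻ (sublists xs) zs∈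
  ... | inj₁ ys∈ | inj₁ zs∈ = sublists-ext u ys∈ zs∈ f g
  ... | inj₁ ys∈ | inj₂ zs∈ with zs , zs∈ , refl ← ∈.∈-map⁻ _ zs∈ =
    contradiction refl (All.lookup x∉ (∈-sublists ys∈ (g (here refl))))
  ... | inj₂ ys∈ | inj₁ zs∈ with ys , ys∈ , refl ← ∈.∈-map⁻ _ ys∈ =
    contradiction refl (All.lookup x∉ (∈-sublists zs∈ (f (here refl))))
  ... | inj₂ ys∈ | inj₂ zs∈ with ys , ys∈ , refl ← ∈.∈-map⁻ _ ys∈ | zs , zs∈ , refl ← ∈.∈-map⁻ _ zs∈ =
    cong (x ∷_) (sublists-ext u ys∈ zs∈
      (λ y∈ → Any.tail (λ { refl → All.lookup x∉ (∈-sublists ys∈ y∈) refl }) (f (there y∈)))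
      (λ z∈ → Any.tail (λ { refl → All.lookup x∉ (∈-sublists zs∈ z∈) refl }) (g (there z∈))))

-- Finite sums over lists

∑ : ∀ {A : Set} → List A → (A → ℕ) → ℕ
∑ xs f = sum (map f xs)

module _ {A : Set} where

  ∑-cong : ∀ (xs : List A) {f g} → (∀ {x} → x ∈ xs → f x ≡ g x) → ∑ xs f ≡ ∑ xs g
  ∑-cong []       eq = refl
  ∑-cong (x ∷ xs) eq = cong₂ _+_ (eq (here refl)) (∑-cong xs λ x∈ → eq (there x∈))

  ∑-++ : ∀ (xs ys : List A) f → ∑ (xs ++ ys) f ≡ ∑ xs f + ∑ ys f
  ∑-++ xs ys f = trans (cong sum (map-++ f xs ys)) (sum-++ (map f xs) (map f ys))

  ∑-map : ∀ {B : Set} (g : B → A) xs (f : A → ℕ) → ∑ (map g xs) f ≡ ∑ xs (λ x → f (g x))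
  ∑-map g []       f = refl
  ∑-map g (x ∷ xs) f = cong (λ k → f (g x) + k) (∑-map g xs f)

  ∑-concatMap : ∀ {B : Set} (g : B → List A) xs (f : A → ℕ) → ∑ (concatMap g xs) f ≡ ∑ xs (λ x → ∑ (g x) f)
  ∑-concatMap g []       f = refl
  ∑-concatMap g (x ∷ xs) f = trans (∑-++ (g x) (concatMap g xs) f) (cong (λ k → ∑ (g x) f + k) (∑-concatMap g xs f))

  ∑-*ˡ : ∀ (xs : List A) c f → ∑ xs (λ x → c * f x) ≡ c * ∑ xs f
  ∑-*ˡ []       c f = sym (ℕ.*-zeroʳ c)
  ∑-*ˡ (x ∷ xs) c f = trans (cong (λ k → c * f x + k) (∑-*ˡ xs c f)) (sym (ℕ.*-distribˡ-+ c (f x) _))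

  ∑-*ʳ : ∀ (xs : List A) c f → ∑ xs (λ x → f x * c) ≡ ∑ xs f * c
  ∑-*ʳ []       c f = refl
  ∑-*ʳ (x ∷ xs) c f = trans (cong (λ k → f x * c + k) (∑-*ʳ xs c f)) (sym (ℕ.*-distribʳ-+ c (f x) _))

  ∑-const : ∀ (xs : List A) c → ∑ xs (λ _ → c) ≡ length xs * c
  ∑-const []       c = refl
  ∑-const (x ∷ xs) c = cong (λ k → c + k) (∑-const xs c)

  ∑-+ : ∀ (xs : List A) f g → ∑ xs (λ x → f x + g x) ≡ ∑ xs f + ∑ xs g
  ∑-+ []       f g = refl
  ∑-+ (x ∷ xs) f g = trans (cong (λ k → f x + g x + k) (∑-+ xs f g)) (+-interchange (f x) (g x) _ _)
    where
    +-interchange : ∀ a b c d → a + b + (c + d) ≡ a + c + (b + d)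
    +-interchange = ℕRing.solve-∀

  length-filter≡∑ : ∀ {P : A → Set} (P? : Decidable P) xs → length (filter P? xs) ≡ ∑ xs (λ x → bit (does (P? x)))
  length-filter≡∑ P? [] = refl
  length-filter≡∑ P? (x ∷ xs) with does (P? x)
  ... | true  = cong suc (length-filter≡∑ P? xs)
  ... | false = length-filter≡∑ P? xs

∑-swap : ∀ {A B : Set} (xs : List A) (ys : List B) (f : A → B → ℕ) → ∑ xs (λ x → ∑ ys (f x)) ≡ ∑ ys (λ y → ∑ xs (λ x → f x y))
∑-swap []       ys f = sym (trans (∑-const ys 0) (ℕ.*-zeroʳ (length ys)))
∑-swap (x ∷ xs) ys f = trans (cong (λ k → ∑ ys (f x) + k) (∑-swap xs ys f)) (sym (∑-+ ys (f x) _))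

∑-zero : ∀ {A : Set} (xs : List A) {f} → (∀ {x} → x ∈ xs → f x ≡ 0) → ∑ xs f ≡ 0
∑-zero xs eq = trans (∑-cong xs eq) (trans (∑-const xs 0) (ℕ.*-zeroʳ (length xs)))

∑-single : ∀ {A : Set} {xs : List A} {f x} → Unique xs → x ∈ xs → f x ≡ 1 →
           (∀ {y} → y ∈ xs → ¬ y ≡ x → f y ≡ 0) → ∑ xs f ≡ 1
∑-single {xs = x ∷ xs} (x∉ ∷ u) (here refl) one zeros = cong₂ _+_ one
  (∑-zero xs λ y∈ → zeros (there y∈) λ { refl → All.lookup x∉ y∈ refl })
∑-single {xs = x ∷ xs} (x∉ ∷ u) (there x∈) one zeros = cong₂ _+_
  (zeros (here refl) λ { refl → All.lookup x∉ x∈ refl }) (∑-single u x∈ one λ y∈ → zeros (there y∈))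

-- Perfect matchings as tableaux

Supported : ℕ → (Edge → Bool) → Set
Supported n m = ∀ {e} → m e ≡ true → e ∈ edges n

deg : (Edge → Bool) → Triangle → ℕ
deg m t = ∑ (sides t) (λ e → bit (m e))

module Marks (n : ℕ) (m : Edge → Bool) where

  left? right? vert? : ℕ → ℕ → Bool
  left? i j  = m (pt n i j , W)
  right? i j = m (pt n i (suc j) , W−V)
  -- The missing △ of row n + 1 count as matched with a triangle below.
  vert? i j  = if i ≡ᵇ suc n then odd j else m (pt n i j , V)

  deg-△ : ∀ i j → deg m (△ (pt n i j)) ≡ bit (m (pt n i j , V)) + (bit (left? i j) + bit (right? i j))
  deg-△ i j rewrite pt-suc n i j | ℕ.+-identityʳ (bit (right? i j)) = refl

  deg-▽ : ∀ i j → deg m (▽ (pt n (suc i) j)) ≡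
          bit (m (pt n i j , V)) + (bit (left? (suc i) (suc j)) + bit (right? (suc i) j))
  deg-▽ i j rewrite pt-suc n (suc i) j | suc-pt n i j | ℕ.+-identityʳ (bit (right? (suc i) j)) = refl

  vert-≤ : ∀ {i} j → i ≤ n → vert? i j ≡ m (pt n i j , V)
  vert-≤ {i} j i≤n with i ≡ᵇ suc n in eq
  ... | false = refl
  ... | true  = contradiction (subst (_≤ n) (ℕ.≡ᵇ⇒≡ i (suc n) (subst T (sym eq) _)) i≤n) ℕ.1+n≰n

  vert-bottom : ∀ j → vert? (suc n) j ≡ odd j
  vert-bottom j with n ≡ᵇ n in eq
  ... | true  = refl
  ... | false = contradiction (trans (sym (to Bool.T-≡ (ℕ.≡⇒≡ᵇ n n refl))) eq) λ ()

  -- Row `i + 1` consists of `n + i + 1` triangles △ and `n + i` triangles ▽ between them; the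
  -- vertical edges below it are those of row `i + 1` and those above it are those of row `i`. One
  -- path thus compares two consecutive rows of the tableau.
  Rows : Set
  Rows = ∀ i → i ≤ n → Path (vert? (suc i)) (vert? i) (left? (suc i)) (right? (suc i)) 1 (n + i)

  module _ (supp : Supported n m) where

    no-vert : ∀ {i j} → ¬ (△In n i j × ▽In n (suc i) j) → m (pt n i j , V) ≡ false
    no-vert {i} {j} ¬in = Bool.¬-not λ eq → case (edge-view (supp eq))
      where
      case : ¬ EdgeView n (pt n i j , V)
      case (vertical {k} {l} e t r) with refl , refl ← pt-injective {n} {i} {j} {k} {l} (cong proj₁ e) = ¬in (t , r)
      case (left e _ _) = contradiction (cong proj₂ e) λ ()
      case (right e _ _) = contradiction (cong proj₂ e) λ ()

    no-left : ∀ {i j} → (∀ {k} → j ≡ suc k → ¬ (△In n i j × ▽In n i k)) → left? i j ≡ false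
    no-left {i} {j} ¬in = Bool.¬-not λ eq → case (edge-view (supp eq))
      where
      case : ¬ EdgeView n (pt n i j , W)
      case (left {k} {l} e t r) with refl , refl ← pt-injective {n} {i} {j} {k} {suc l} (cong proj₁ e) = ¬in refl (t , r)
      case (vertical e _ _) = contradiction (cong proj₂ e) λ ()
      case (right e _ _) = contradiction (cong proj₂ e) λ ()

    no-right : ∀ {i j} → ¬ (△In n i j × ▽In n i j) → right? i j ≡ false
    no-right {i} {j} ¬in = Bool.¬-not λ eq → case (edge-view (supp eq))
      where
      case : ¬ EdgeView n (pt n i (suc j) , W−V)
      case (right {k} {l} e t r) with refl , eq ← pt-injective {n} {i} {suc j} {k} {suc l} (cong proj₁ e) with refl ← ℕ.suc-injective eq = ¬in (t , r)
      case (vertical e _ _) = contradiction (cong proj₂ e) λ ()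
      case (left e _ _) = contradiction (cong proj₂ e) λ ()

    left-first : ∀ i → left? i 1 ≡ false
    left-first i = no-left {i} {1} λ { refl (_ , _ , _ , () , _) }

    vert-bottom-even : ∀ j → m (pt n (suc n) j , V) ≡ false
    vert-bottom-even j = no-vert {suc n} {j} λ (_ , _ , le , _) → ℕ.1+n≰n le

    row-△ : ∀ i j → △In n i j → deg m (△ (pt n i j)) ≡
            bit (vert? i j) + (bit (left? i j) + bit (right? i j))
    row-△ i j (_ , i≤ , _ , _ , even) = trans (deg-△ i j) (cong (λ b → bit b + (bit (left? i j) + bit (right? i j))) (eq (ℕ.m≤n⇒m<n∨m≡n i≤)))
      where
      eq : i < suc n ⊎ i ≡ suc n → m (pt n i j , V) ≡ vert? i j
      eq (inj₁ i≤n)  = sym (vert-≤ j (ℕ.≤-pred i≤n))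
      eq (inj₂ refl) = trans (vert-bottom-even j) (sym (trans (vert-bottom j) (even refl)))

    row-▽ : ∀ i j → i ≤ n → deg m (▽ (pt n (suc i) j)) ≡
            bit (vert? i j) + (bit (left? (suc i) (suc j)) + bit (right? (suc i) j))
    row-▽ i j i≤n = trans (deg-▽ i j) (cong (λ b → bit b + (bit (left? (suc i) (suc j)) + bit (right? (suc i) j))) (sym (vert-≤ j i≤n)))

    perfect⇒rows : (∀ t → InR n t → deg m t ≡ 1) → Rows
    perfect⇒rows perf i i≤n = path 1 (n + i) tri inv (no-right {suc i} {suc (n + i)} λ (_ , _ , _ , _ , lt) → ℕ.<-irrefl (sym (ℕ.+-suc n i)) lt)
      where
      tri : ∀ j → 1 ≤ j → j ≤ suc (n + i) → One (vert? (suc i) j) (left? (suc i) j) (right? (suc i) j)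
      tri j 1≤j j≤ with Bool._≟_ (odd j) false
      ... | yes even = trans (sym (row-△ (suc i) j t)) (perf (△ (pt n (suc i) j)) (from (InR-△ n (suc i) j) t))
        where t = s≤s z≤n , s≤s i≤n , 1≤j , subst (j ≤_) (sym (ℕ.+-suc n i)) j≤ , λ _ → even
      ... | no ¬even with i ℕ.≟ n
      ...   | no i≢n = trans (sym (row-△ (suc i) j t)) (perf (△ (pt n (suc i) j)) (from (InR-△ n (suc i) j) t))
        where t = s≤s z≤n , s≤s i≤n , 1≤j , subst (j ≤_) (sym (ℕ.+-suc n i)) j≤ , λ eq → contradiction (ℕ.suc-injective eq) i≢n
      -- An odd △ of row `n + 1` is outside the region, so neither of its side edges exists and the
      -- fictitious edge below is its only cover.
      ...   | yes refl = cong₂ (λ b c → bit b + c) (trans (vert-bottom j) (Bool.¬-not ¬even))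
                           (cong₂ (λ b c → bit b + bit c) (no-left {suc i} {j} λ { refl ((_ , _ , _ , _ , even) , _) → ¬even (even refl) })
                                                           (no-right {suc i} {j} λ ((_ , _ , _ , _ , even) , _) → ¬even (even refl)))
      inv : ∀ j → 1 ≤ j → j < suc (n + i) → One (vert? i j) (left? (suc i) (suc j)) (right? (suc i) j)
      inv j 1≤j j< = trans (sym (row-▽ i j i≤n)) (perf (▽ (pt n (suc i) j)) (from (InR-▽ n (suc i) j)
        (s≤s z≤n , s≤s i≤n , 1≤j , subst (j <_) (sym (ℕ.+-suc n i)) j<)))

    rows⇒perfect : Rows → ∀ t → InR n t → deg m t ≡ 1
    rows⇒perfect rows (△ p) r with △-coordinates n p r
    ... | zero  , j , refl , () , _
    ... | suc i , j , refl , t@(_ , s≤s i≤n , 1≤j , j≤ , _) = trans (row-△ (suc i) j t)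
      (path-△ (rows i i≤n) j 1≤j (subst (j ≤_) (ℕ.+-suc n i) j≤))
    rows⇒perfect rows (▽ p) r with ▽-coordinates n p r
    ... | zero  , j , refl , () , _
    ... | suc i , j , refl , (_ , s≤s i≤n , 1≤j , j<) = trans (row-▽ i j i≤n)
      (path-▽ (rows i i≤n) j 1≤j (subst (j <_) (ℕ.+-suc n i) j<))

open DecMembership _≟ᵉ_ using (_∈?_)
open DecMembership ℕ._≟_ using () renaming (_∈?_ to _∈ℕ?_)

mem : List Edge → Edge → Bool
mem M e = does (e ∈? M)

mem-∈ : ∀ {M e} → mem M e ≡ true → e ∈ M
mem-∈ {M} {e} eq with e ∈? M
... | yes e∈ = e∈

degree≡deg : ∀ M t → degree M t ≡ deg (mem M) t
degree≡deg M t = length-filter≡∑ (_∈? M) (sides t)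

∈-vertices : ∀ n t → InR n t → t ∈ vertices n
∈-vertices n t r = ∈.∈-filter⁺ (inR? n) (∈.∈-concatMap⁺ (λ p → △ p ∷ ▽ p ∷ []) (base t r)) r
  where
  base : ∀ t → InR n t → Any (λ p → t ∈ △ p ∷ ▽ p ∷ []) (box n)
  base (△ p) r with i , j , refl , (_ , i≤ , _ , j≤ , _) ← △-coordinates n p r = lose (pt∈box n i j i≤ (ℕ.m≤n⇒m≤1+n j≤)) (here refl)
  base (▽ p) r with i , j , refl , (_ , i≤ , _ , j≤) ← ▽-coordinates n p r = lose (pt∈box n i j i≤ (ℕ.<⇒≤ (ℕ.m≤n⇒m≤1+n j≤))) (there (here refl))

edges-unique : ∀ n → Unique (edges n)
edges-unique n = Unique.filter⁺ (λ e → all? (inR? n) (faces e)) {xs = cartesianProduct (box n) (V ∷ W ∷ W−V ∷ [])}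
    (Unique.cartesianProduct⁺ (Unique.cartesianProduct⁺ range range) directions)
  where
  directions : Unique (V ∷ W ∷ W−V ∷ [])
  directions = ((λ ()) ∷ (λ ()) ∷ []) ∷ ((λ ()) ∷ []) ∷ [] ∷ []
  range : Unique (map (λ k → + k ℤ.- + suc n) (upTo (2 * suc n + 1)))
  range = Unique.map⁺ (λ {k} {l} eq → ℤ.+-injective (Group.∙-cancelʳ (AbelianGroup.group ℤ.+-0-abelianGroup) (ℤ.- + suc n) (+ k) (+ l) eq)) (Unique.upTo⁺ _)

perfectMatchings-unique : ∀ n → Unique (perfectMatchings n)
perfectMatchings-unique n = Unique.filter⁺ (λ M → all? (λ t → degree M t ℕ.≟ 1) (vertices n)) (sublists-unique (edges-unique n))

∈-perfectMatchings : ∀ {n M} → M ∈ perfectMatchings n → M ∈ sublists (edges n) × (∀ t → InR n t → deg (mem M) t ≡ 1)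
∈-perfectMatchings {n} {M} M∈ = let M∈s , perf = ∈.∈-filter⁻ (λ M → all? (λ t → degree M t ℕ.≟ 1) (vertices n)) {xs = sublists (edges n)} M∈ in
  M∈s , λ t r → trans (sym (degree≡deg M t)) (All.lookup perf (∈-vertices n t r))

perfectMatchings-∈ : ∀ {n M} → M ∈ sublists (edges n) → (∀ t → InR n t → deg (mem M) t ≡ 1) → M ∈ perfectMatchings n
perfectMatchings-∈ {n} {M} M∈ perf = ∈.∈-filter⁺ (λ M → all? (λ t → degree M t ℕ.≟ 1) (vertices n)) M∈
  (All.tabulate λ {t} t∈ → trans (degree≡deg M t) (perf t (proj₂ (∈.∈-filter⁻ (inR? n) {xs = concatMap (λ p → △ p ∷ ▽ p ∷ []) (box n)} t∈))))

sublist-supported : ∀ {n M} → M ∈ sublists (edges n) → Supported n (mem M)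
sublist-supported {n} {M} M∈ eq = ∈-sublists M∈ (mem-∈ {M} eq)

-- The fixed row 1, 3, ..., 2 n + 1, written as the index list that `vert?` yields on row `n + 1`,
-- whose window has width `2 n + 1`.
odds : ℕ → List ℕ
odds n = indices odd 1 (n + suc n)

-- Lowest row first, as in `Pattern`; the empty row 0 is left out.
rowsUpTo : (ℕ → List ℕ) → ℕ → List (List ℕ)
rowsUpTo X zero    = []
rowsUpTo X (suc k) = X (suc k) ∷ rowsUpTo X k

rowsOf : ℕ → List Edge → List (List ℕ)
rowsOf n M = rowsUpTo (positions n M) n

rowsUpTo-cong : ∀ {X Y} k → (∀ i → 1 ≤ i → i ≤ k → X i ≡ Y i) → rowsUpTo X k ≡ rowsUpTo Y k
rowsUpTo-cong zero    eq = refl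
rowsUpTo-cong (suc k) eq = cong₂ _∷_ (eq (suc k) (s≤s z≤n) ℕ.≤-refl) (rowsUpTo-cong k λ i 1≤i i≤ → eq i 1≤i (ℕ.m≤n⇒m≤1+n i≤))

rowsUpTo-injective : ∀ {X Y} k → rowsUpTo X k ≡ rowsUpTo Y k → ∀ i → 1 ≤ i → i ≤ k → X i ≡ Y i
rowsUpTo-injective zero    eq i 1≤i i≤ = contradiction (ℕ.≤-trans 1≤i i≤) λ ()
rowsUpTo-injective (suc k) eq i 1≤i i≤ with ℕ.m≤n⇒m<n∨m≡n i≤
... | inj₁ i<1+k = rowsUpTo-injective k (∷-injectiveʳ eq) i 1≤i (ℕ.≤-pred i<1+k)
... | inj₂ refl  = ∷-injectiveˡ eq

rowsUpTo-pattern : ∀ {X} k → (∀ i → i ≤ k → Interlaces (X (suc i)) (X i)) → X 0 ≡ [] → Pattern (X (suc k)) (rowsUpTo X k)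
rowsUpTo-pattern {X} zero i X₀ with X 1 | subst (Interlaces (X 1)) X₀ (i 0 z≤n)
... | _ | single = done
rowsUpTo-pattern (suc k) i X₀ = i (suc k) ℕ.≤-refl ∷ rowsUpTo-pattern k (λ j j≤ → i j (ℕ.m≤n⇒m≤1+n j≤)) X₀

module _ {n : ℕ} {M : List Edge} where

  open Marks n (mem M)

  rowIndices : ℕ → List ℕ
  rowIndices i = indices (vert? i) 1 (n + i)

  positions≡indices : ∀ {i} → i ≤ n → positions n M i ≡ rowIndices i
  positions≡indices {i} i≤n = trans (cong (filter _) (map-upTo suc (n + i)))
    (trans (filter≡indices (λ j → verticalEdge n i j ∈? M) 1 (n + i) suc λ _ → refl)
           (indices-cong 1 (n + i) λ j _ _ → sym (vert-≤ j i≤n)))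

  matching⇒pattern : M ∈ perfectMatchings n → Pattern (odds n) (rowsOf n M)
  matching⇒pattern M∈ = subst₂ Pattern bottom (sym (rowsUpTo-cong n λ i 1≤i i≤n → positions≡indices i≤n))
    (rowsUpTo-pattern n (λ i i≤n → subst (λ l → Interlaces (indices (vert? (suc i)) 1 l) (rowIndices i)) (sym (ℕ.+-suc n i))
      (path⇒interlaces (perfect⇒rows supp perf i i≤n) (left-first supp (suc i)))) top)
    where
    supp = sublist-supported {n} {M} (proj₁ (∈-perfectMatchings {n} {M} M∈))
    perf = proj₂ (∈-perfectMatchings {n} {M} M∈)
    bottom : rowIndices (suc n) ≡ odds n
    bottom = indices-cong 1 (n + suc n) λ j _ _ → vert-bottom j
    top : rowIndices 0 ≡ []
    top = indices-sorted 1 (n + 0) [] [] [] (λ {j} _ eq → contradiction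
      (trans (sym eq) (no-vert supp {0} {j} λ { ((() , _) , _) })) λ ()) λ ()

module _ {n : ℕ} {m m′ : Edge → Bool} (supp : Supported n m) (supp′ : Supported n m′) where

  private
    module m = Marks n m
    module m′ = Marks n m′

  -- The vertical edges determine the matching: no row begins with a left edge, so `path-unique`
  -- applies to each row with the same starting state.
  rows-unique : m.Rows → m′.Rows → (∀ i j → i ≤ suc n → 1 ≤ j → j ≤ n + i → m.vert? i j ≡ m′.vert? i j) →
                ∀ {e} → e ∈ edges n → m e ≡ m′ e
  rows-unique rows rows′ vert≡ e∈ = case (edge-view {n} e∈)
    where
    sides≡ : ∀ i → i ≤ n → ∀ j → 1 ≤ j → j ≤ n + suc i →
             m.left? (suc i) j ≡ m′.left? (suc i) j × m.right? (suc i) j ≡ m′.right? (suc i) j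
    sides≡ i i≤n j 1≤j j≤ = path-unique (rows i i≤n) (rows′ i i≤n)
      (λ j 1≤j j≤ → vert≡ (suc i) j (s≤s i≤n) 1≤j (subst (j ≤_) (sym (ℕ.+-suc n i)) j≤))
      (λ j 1≤j j< → vert≡ i j (ℕ.m≤n⇒m≤1+n i≤n) 1≤j (ℕ.≤-pred j<))
      (trans (m.left-first supp (suc i)) (sym (m′.left-first supp′ (suc i))))
      j 1≤j (subst (j ≤_) (ℕ.+-suc n i) j≤)
    case : ∀ {e} → EdgeView n e → m e ≡ m′ e
    case (vertical {i} {j} refl (_ , i≤ , 1≤j , j≤ , _) (_ , s≤s i≤n , _)) =
      trans (sym (m.vert-≤ j i≤n)) (trans (vert≡ i j i≤ 1≤j j≤) (m′.vert-≤ j i≤n))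
    case (left {suc i} {j} refl (_ , s≤s i≤n , _ , j≤ , _) _) = proj₁ (sides≡ i i≤n (suc j) (s≤s z≤n) j≤)
    case (right {suc i} {j} refl (_ , s≤s i≤n , 1≤j , j≤ , _) _) = proj₂ (sides≡ i i≤n j 1≤j j≤)

vert-top : ∀ {n m} → Supported n m → ∀ j → Marks.vert? n m 0 j ≡ false
vert-top {n} {m} supp j = trans (Marks.vert-≤ n m j z≤n) (Marks.no-vert n m supp {0} {j} λ { ((() , _) , _) })

rowsOf-injective : ∀ {n M M′} → M ∈ perfectMatchings n → M′ ∈ perfectMatchings n → rowsOf n M ≡ rowsOf n M′ → M ≡ M′
rowsOf-injective {n} {M} {M′} M∈ M′∈ eq =
  sublists-ext (edges-unique n) s s′ (λ e∈ → mem-∈ {M′} (trans (sym (mem≡ (∈-sublists s e∈))) (∈-mem {M} e∈)))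
                                     (λ e∈ → mem-∈ {M} (trans (mem≡ (∈-sublists s′ e∈)) (∈-mem {M′} e∈)))
  where
  s  = proj₁ (∈-perfectMatchings {n} {M} M∈)
  s′ = proj₁ (∈-perfectMatchings {n} {M′} M′∈)
  supp  = sublist-supported {n} {M} s
  supp′ = sublist-supported {n} {M′} s′
  ∈-mem : ∀ {M e} → e ∈ M → mem M e ≡ true
  ∈-mem {M} {e} e∈ = dec-true (e ∈? M) e∈
  vert≡ : ∀ i j → i ≤ suc n → 1 ≤ j → j ≤ n + i → Marks.vert? n (mem M) i j ≡ Marks.vert? n (mem M′) i j
  vert≡ zero    j i≤ 1≤j j≤ = trans (vert-top {n} supp j) (sym (vert-top {n} supp′ j))
  vert≡ (suc i) j i≤ 1≤j j≤ with ℕ.m≤n⇒m<n∨m≡n i≤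
  ... | inj₁ (s≤s i≤n) = indices-injective 1 (n + suc i)
          (trans (sym (positions≡indices {n} {M} i≤n)) (trans (rowsUpTo-injective {positions n M} {positions n M′} n eq (suc i) (s≤s z≤n) i≤n) (positions≡indices {n} {M′} i≤n)))
          j 1≤j (s≤s j≤)
  ... | inj₂ refl = trans (Marks.vert-bottom n (mem M) j) (sym (Marks.vert-bottom n (mem M′) j))
  mem≡ : ∀ {e} → e ∈ edges n → mem M e ≡ mem M′ e
  mem≡ = rows-unique {n} {mem M} {mem M′} supp supp′
    (Marks.perfect⇒rows n (mem M) supp (proj₂ (∈-perfectMatchings {n} {M} M∈)))
    (Marks.perfect⇒rows n (mem M′) supp′ (proj₂ (∈-perfectMatchings {n} {M′} M′∈))) vert≡

-- The matching with prescribed vertical edges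

module FromRows (n : ℕ) (X : ℕ → List ℕ) (X₀ : X 0 ≡ []) (Xₙ : X (suc n) ≡ odds n)
  (X-interlaces : ∀ i → i ≤ n → Interlaces (X (suc i)) (X i))
  (X-bounds : ∀ i → i ≤ suc n → All (1 ≤_) (X i) × All (_≤ n + i) (X i)) where

  U : ℕ → ℕ → Bool
  U i j = does (j ∈ℕ? X i)

  lft rgt : ℕ → ℕ → Bool
  lft i = leftEdge (U i) (U (pred i))
  rgt i = rightEdge (U i) (U (pred i))

  -- Vertical edges are prescribed and side edges follow the left-to-right recursion. A `W−V` edge
  -- is based one position to the right of its △, hence the `pred`. Values outside the region are
  -- discarded when `M` restricts to `edges n`.
  mark : Edge → Bool
  mark (p , V)   = U (rowOf n p) (colOf n p)
  mark (p , W)   = lft (rowOf n p) (colOf n p)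
  mark (p , W−V) = rgt (rowOf n p) (pred (colOf n p))

  M : List Edge
  M = filter (λ e → mark e Bool.≟ true) (edges n)

  M∈sublists : M ∈ sublists (edges n)
  M∈sublists = filter∈sublists (λ e → mark e Bool.≟ true) (edges n)

  supp : Supported n (mem M)
  supp = sublist-supported {n} {M} M∈sublists

  mem-M : ∀ {e} → e ∈ edges n → mem M e ≡ mark e
  mem-M {e} e∈ with mark e in eq
  ... | true  = dec-true (e ∈? M) (∈.∈-filter⁺ (λ e → mark e Bool.≟ true) e∈ eq)
  ... | false = dec-false (e ∈? M) λ e∈M → contradiction
    (trans (sym eq) (proj₂ (∈.∈-filter⁻ (λ e → mark e Bool.≟ true) {xs = edges n} e∈M))) λ ()

  U-indices : ∀ i → i ≤ suc n → indices (U i) 1 (n + i) ≡ X i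
  U-indices i i≤ = indices-sorted 1 (n + i) (sorted i i≤) (proj₁ (X-bounds i i≤)) (All.map s≤s (proj₂ (X-bounds i i≤)))
    (λ {j} _ eq → U-∈ j eq) (λ {j} j∈ → dec-true (j ∈ℕ? X i) j∈)
    where
    U-∈ : ∀ j → U i j ≡ true → j ∈ X i
    U-∈ j eq with j ∈ℕ? X i
    ... | yes j∈ = j∈
    sorted : ∀ i → i ≤ suc n → AllPairs _<_ (X i)
    sorted zero    _         = subst (AllPairs _<_) (sym X₀) []
    sorted (suc i) (s≤s i≤n) = interlaces-sorted (X-interlaces i i≤n)

  row : ∀ i → i ≤ n → Path (U (suc i)) (U i) (lft (suc i)) (rgt (suc i)) 1 (n + i)
  row i i≤n = interlaces⇒path (λ _ → refl) 1 (n + i) (λ { (suc j) _ → refl })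
    (subst₂ Interlaces (trans (sym (U-indices (suc i) (s≤s i≤n))) (cong (indices (U (suc i)) 1) (ℕ.+-suc n i)))
      (sym (U-indices i (ℕ.m≤n⇒m≤1+n i≤n))) (X-interlaces i i≤n)) refl

  open Marks n (mem M)

  △In⊎bottom : ∀ i j → i ≤ n → 1 ≤ j → j ≤ n + suc i → △In n (suc i) j ⊎ (i ≡ n × odd j ≡ true)
  △In⊎bottom i j i≤n 1≤j j≤ with Bool._≟_ (odd j) false
  ... | yes even = inj₁ (s≤s z≤n , s≤s i≤n , 1≤j , j≤ , λ _ → even)
  ... | no ¬even with i ℕ.≟ n
  ...   | no i≢n   = inj₁ (s≤s z≤n , s≤s i≤n , 1≤j , j≤ , λ eq → contradiction (ℕ.suc-injective eq) i≢n)
  ...   | yes refl = inj₂ (refl , Bool.¬-not ¬even)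

  U-bottom : ∀ j → 1 ≤ j → j ≤ n + suc n → odd j ≡ U (suc n) j
  U-bottom j 1≤j j≤ = indices-injective 1 (n + suc n) (trans (sym Xₙ) (sym (U-indices (suc n) ℕ.≤-refl))) j 1≤j (s≤s j≤)

  vert-U : ∀ i j → i ≤ suc n → 1 ≤ j → j ≤ n + i → vert? i j ≡ U i j
  vert-U zero    j i≤ 1≤j j≤ = trans (vert-top {n} supp j) (sym (trans (cong (λ xs → does (j ∈ℕ? xs)) X₀) refl))
  vert-U (suc i) j i≤ 1≤j j≤ with ℕ.m≤n⇒m<n∨m≡n i≤
  ... | inj₂ refl = trans (vert-bottom j) (U-bottom j 1≤j j≤)
  ... | inj₁ (s≤s i≤n) = trans (vert-≤ j i≤n) (trans (mem-M (∈-edges {n} (vertical {i = suc i} {j} refl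
          (s≤s z≤n , i≤ , 1≤j , j≤ , λ { refl → contradiction i≤n ℕ.1+n≰n })
          (s≤s z≤n , s≤s i≤n , 1≤j , subst (j <_) (sym (ℕ.+-suc n (suc i))) (s≤s j≤)))))
          (cong₂ U (rowOf-pt n (suc i) j) (colOf-pt n (suc i) j)))

  -- Restricting to the edges of the region loses nothing at a missing △: the path covers it from
  -- below, so the recursion leaves both its sides unmarked.
  bottom-sides : ∀ j → 1 ≤ j → j ≤ n + suc n → odd j ≡ true → lft (suc n) j ≡ false × rgt (suc n) j ≡ false
  bottom-sides j 1≤j j≤ eq with U (suc n) j | U-bottom j 1≤j j≤ | lft (suc n) j | path-△ (row n ℕ.≤-refl) j 1≤j (subst (j ≤_) (ℕ.+-suc n n) j≤)
  ... | true  | _ | false | _ = refl , refl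
  ... | false | o | _     | _ = contradiction (trans (sym eq) o) λ ()

  left-U : ∀ i j → i ≤ n → 1 ≤ j → j ≤ n + suc i → left? (suc i) j ≡ lft (suc i) j
  left-U i (suc zero) i≤n 1≤j j≤ = left-first supp (suc i)
  left-U i (suc (suc j)) i≤n 1≤j j≤ with △In⊎bottom i (suc (suc j)) i≤n 1≤j j≤
  ... | inj₁ t = trans (mem-M (∈-edges {n} (left {i = suc i} {suc j} refl t (s≤s z≤n , s≤s i≤n , s≤s z≤n , j≤))))
                   (cong₂ lft (rowOf-pt n (suc i) (suc (suc j))) (colOf-pt n (suc i) (suc (suc j))))
  ... | inj₂ (refl , o) = trans (no-left supp {suc i} {suc (suc j)} λ { refl ((_ , _ , _ , _ , even) , _) → contradiction (trans (sym o) (even refl)) λ () })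
                   (sym (proj₁ (bottom-sides (suc (suc j)) 1≤j j≤ o)))

  right-U : ∀ i j → i ≤ n → 1 ≤ j → j ≤ n + suc i → right? (suc i) j ≡ rgt (suc i) j
  right-U i j i≤n 1≤j j≤ with ℕ.m≤n⇒m<n∨m≡n j≤
  -- The last △ of a row has no ▽ on its right, and the path ends without a right edge there.
  ... | inj₂ refl = trans (no-right supp {suc i} {n + suc i} λ (_ , _ , _ , _ , lt) → ℕ.<-irrefl refl lt)
                      (sym (trans (cong (rgt (suc i)) (ℕ.+-suc n i)) (path-end (row i i≤n))))
  ... | inj₁ j< with △In⊎bottom i j i≤n 1≤j j≤
  ...   | inj₁ t = trans (mem-M (∈-edges {n} (right {i = suc i} {j} refl t (s≤s z≤n , s≤s i≤n , 1≤j , j<))))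
                     (cong₂ rgt (rowOf-pt n (suc i) (suc j)) (cong pred (colOf-pt n (suc i) (suc j))))
  ...   | inj₂ (refl , o) = trans (no-right supp {suc i} {j} λ ((_ , _ , _ , _ , even) , _) → contradiction (trans (sym o) (even refl)) λ ())
                     (sym (proj₂ (bottom-sides j 1≤j j≤ o)))

  rows : Rows
  rows i i≤n = path 1 (n + i)
    (λ j 1≤j j≤ → let j≤′ = subst (j ≤_) (sym (ℕ.+-suc n i)) j≤ in
      One-cong (vert-U (suc i) j (s≤s i≤n) 1≤j j≤′) (left-U i j i≤n 1≤j j≤′) (right-U i j i≤n 1≤j j≤′) (path-△ (row i i≤n) j 1≤j j≤))
    (λ j 1≤j j< → let j<′ = subst (j <_) (sym (ℕ.+-suc n i)) j< in
      One-cong (vert-U i j (ℕ.m≤n⇒m≤1+n i≤n) 1≤j (ℕ.≤-pred j<)) (left-U i (suc j) i≤n (s≤s z≤n) j<′)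
        (right-U i j i≤n 1≤j (ℕ.<⇒≤ j<′)) (path-▽ (row i i≤n) j 1≤j j<))
    (trans (right-U i (suc (n + i)) i≤n (s≤s z≤n) (ℕ.≤-reflexive (sym (ℕ.+-suc n i)))) (path-end (row i i≤n)))
    where
    One-cong : ∀ {a b c a′ b′ c′} → a ≡ a′ → b ≡ b′ → c ≡ c′ → One a′ b′ c′ → One a b c
    One-cong refl refl refl o = o

  M∈perfectMatchings : M ∈ perfectMatchings n
  M∈perfectMatchings = perfectMatchings-∈ {n} {M} M∈sublists (rows⇒perfect supp rows)

  rowsOf-M : rowsOf n M ≡ rowsUpTo X n
  rowsOf-M = rowsUpTo-cong n λ i 1≤i i≤n → trans (positions≡indices {n} {M} i≤n)
    (trans (indices-cong 1 (n + i) λ j 1≤j j< → vert-U i j (ℕ.m≤n⇒m≤1+n i≤n) 1≤j (ℕ.≤-pred j<)) (U-indices i (ℕ.m≤n⇒m≤1+n i≤n)))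

-- The bottom row, and lists of rows accessed by row number

odd-indices-∷ : ∀ a k → odd a ≡ true → indices odd a (2 + k) ≡ a ∷ indices odd (2 + a) k
odd-indices-∷ a k o rewrite o = refl

private
 odd-indices-∷′ : ∀ a m → odd a ≡ true → indices odd a (suc (2 * suc m)) ≡ a ∷ indices odd (2 + a) (suc (2 * m))
 odd-indices-∷′ a m o = trans (cong (λ k → indices odd a (suc k)) (ℕ.*-suc 2 m)) (odd-indices-∷ a (suc (2 * m)) o)

odd-indices-length : ∀ a m → odd a ≡ true → length (indices odd a (suc (2 * m))) ≡ suc m
odd-indices-length a zero    o rewrite o = refl
odd-indices-length a (suc m) o = trans (cong length (odd-indices-∷′ a m o))
  (cong suc (odd-indices-length (2 + a) m (trans (Bool.not-involutive _) o)))

odd-indices-nth : ∀ a m j → odd a ≡ true → j ≤ m → nth (indices odd a (suc (2 * m))) j ≡ a + 2 * j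
odd-indices-nth a zero    zero    o z≤n rewrite o = sym (ℕ.+-identityʳ a)
odd-indices-nth a (suc m) zero    o z≤n rewrite odd-indices-∷′ a m o = sym (ℕ.+-identityʳ a)
odd-indices-nth a (suc m) (suc j) o (s≤s j≤m) rewrite odd-indices-∷′ a m o = trans
  (odd-indices-nth (2 + a) m j (trans (Bool.not-involutive _) o) j≤m)
  (trans (cong suc (sym (ℕ.+-suc a (2 * j)))) (trans (sym (ℕ.+-suc a _)) (cong (λ k → a + k) (sym (ℕ.*-suc 2 j)))))

private
 width : ∀ n → n + suc n ≡ suc (2 * n)
 width n = trans (ℕ.+-suc n n) (cong (λ k → suc (n + k)) (sym (ℕ.+-identityʳ n)))

odds-length : ∀ n → length (odds n) ≡ suc n
odds-length n = trans (cong (λ w → length (indices odd 1 w)) (width n)) (odd-indices-length 1 n refl)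

odds-nth : ∀ n j → j ≤ n → nth (odds n) j ≡ 2 * j + 1
odds-nth n j j≤n = trans (cong (λ w → nth (indices odd 1 w) j) (width n)) (trans (odd-indices-nth 1 n j refl j≤n) (ℕ.+-comm 1 (2 * j)))

-- The list begins with the lowest row, so its head has its length as row number; row 0 and rows out
-- of range are empty.
rowAt : List (List ℕ) → ℕ → List ℕ
rowAt []         i = []
rowAt (xs ∷ xss) i = if i ≡ᵇ suc (length xss) then xs else rowAt xss i

rowAt-top : ∀ xs xss → rowAt (xs ∷ xss) (suc (length xss)) ≡ xs
rowAt-top xs xss rewrite to Bool.T-≡ (ℕ.≡⇒≡ᵇ (length xss) (length xss) refl) = refl

rowAt-below : ∀ xs xss {i} → i ≤ length xss → rowAt (xs ∷ xss) i ≡ rowAt xss i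
rowAt-below xs xss {i} i≤ with i ≡ᵇ suc (length xss) in eq
... | false = refl
... | true  = contradiction (subst (_≤ length xss) (ℕ.≡ᵇ⇒≡ i _ (subst T (sym eq) _)) i≤) ℕ.1+n≰n

rowsUpTo-rowAt : ∀ xss → rowsUpTo (rowAt xss) (length xss) ≡ xss
rowsUpTo-rowAt []         = refl
rowsUpTo-rowAt (xs ∷ xss) = cong₂ _∷_ (rowAt-top xs xss)
  (trans (rowsUpTo-cong (length xss) λ i _ i≤ → rowAt-below xs xss i≤) (rowsUpTo-rowAt xss))

rowAt-rowsUpTo : ∀ {X} n i → 1 ≤ i → i ≤ n → rowAt (rowsUpTo X n) i ≡ X i
rowAt-rowsUpTo {X} n = rowsUpTo-injective {rowAt (rowsUpTo X n)} {X} n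
  (trans (cong (rowsUpTo (rowAt (rowsUpTo X n))) (sym (rowsUpTo-length n))) (rowsUpTo-rowAt (rowsUpTo X n)))
  where
  rowsUpTo-length : ∀ {X : ℕ → List ℕ} k → length (rowsUpTo X k) ≡ k
  rowsUpTo-length zero    = refl
  rowsUpTo-length (suc k) = cong suc (rowsUpTo-length k)

rowAt-0 : ∀ xss → rowAt xss 0 ≡ []
rowAt-0 []         = refl
rowAt-0 (xs ∷ xss) = rowAt-0 xss

pattern-length : ∀ {xs xss} → Pattern xs xss → length xs ≡ suc (length xss)
pattern-length done    = refl
pattern-length (i ∷ p) = trans (interlaces-length i) (cong suc (pattern-length p))

pattern-interlaces : ∀ {xs xss} → Pattern xs xss → ∀ i → i ≤ length xss → Interlaces (rowAt (xs ∷ xss) (suc i)) (rowAt (xs ∷ xss) i)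
pattern-interlaces done zero z≤n = single
pattern-interlaces {xs} {ys ∷ xss} (int ∷ p) i i≤ with ℕ.m≤n⇒m<n∨m≡n i≤
... | inj₂ refl = subst₂ Interlaces (sym (rowAt-top xs (ys ∷ xss))) (sym (trans (rowAt-below xs (ys ∷ xss) ℕ.≤-refl) (rowAt-top ys xss))) int
... | inj₁ (s≤s i≤′) = subst₂ Interlaces (sym (rowAt-below xs (ys ∷ xss) {suc i} (s≤s i≤′))) (sym (rowAt-below xs (ys ∷ xss) i≤)) (pattern-interlaces p i i≤′)

-- Each step upwards lowers the upper bound by one, by strictness on the right, just as the width
-- `n + i` of row `i` shrinks.
pattern-bounds : ∀ n {xs xss} → Pattern xs xss → All (1 ≤_) xs → All (_≤ n + suc (length xss)) xs →
                 ∀ i → i ≤ suc (length xss) → All (1 ≤_) (rowAt (xs ∷ xss) i) × All (_≤ n + i) (rowAt (xs ∷ xss) i)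
pattern-bounds n {xs} {xss} p 1≤ ≤n i i≤ with ℕ.m≤n⇒m<n∨m≡n i≤
... | inj₂ refl = subst (λ ys → All (1 ≤_) ys × All (_≤ n + i) ys) (sym (rowAt-top xs xss)) (1≤ , ≤n)
pattern-bounds n {xs} {[]} done 1≤ ≤n zero i≤ | inj₁ _ = [] , []
pattern-bounds n {xs} {[]} done 1≤ ≤n (suc i) i≤ | inj₁ (s≤s ())
pattern-bounds n {xs} {ys ∷ xss} (int ∷ p) 1≤ ≤n i i≤ | inj₁ (s≤s i≤′) =
  subst (λ ys → All (1 ≤_) ys × All (_≤ n + i) ys) (sym (rowAt-below xs (ys ∷ xss) i≤′))
    (pattern-bounds n p (interlaces-≥ int 1≤) (All.map (λ {x} lt → ℕ.≤-pred (subst (x <_) (ℕ.+-suc n _) lt)) (interlaces-< int ≤n)) i i≤′)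

pattern⇒matching : ∀ {n xss} → Pattern (odds n) xss → ∃ λ M → M ∈ perfectMatchings n × rowsOf n M ≡ xss
pattern⇒matching {n} {xss} p = M , M∈perfectMatchings , trans rowsOf-M
  (trans (trans (cong (λ k → rowsUpTo (rowAt (odds n ∷ xss)) k) len)
    (rowsUpTo-cong (length xss) λ i _ i≤ → rowAt-below (odds n) xss i≤)) (rowsUpTo-rowAt xss))
  where
  len : n ≡ length xss
  len = ℕ.suc-injective (trans (sym (odds-length n)) (pattern-length p))
  open FromRows n (rowAt (odds n ∷ xss)) (rowAt-0 (odds n ∷ xss))
    (trans (cong (λ k → rowAt (odds n ∷ xss) (suc k)) len) (rowAt-top (odds n) xss))
    (λ i i≤ → pattern-interlaces p i (subst (i ≤_) len i≤))
    (λ i i≤ → pattern-bounds n p (indices-≥ odd 1 (n + suc n))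
       (All.tabulate λ {x} x∈ → subst (λ k → x ≤ n + suc k) len (ℕ.≤-pred (proj₁ (proj₂ (∈-indices odd 1 (n + suc n) x∈)))))
       i (subst (λ k → i ≤ suc k) len i≤))

map-unique : ∀ {A B : Set} (f : A → B) {xs} → (∀ {x y} → x ∈ xs → y ∈ xs → f x ≡ f y → x ≡ y) → Unique xs → Unique (map f xs)
map-unique f inj []       = []
map-unique f inj (x∉ ∷ u) = All.tabulate (λ y∈ eq → let y , y∈′ , eq′ = ∈.∈-map⁻ f y∈ in
    All.lookup x∉ y∈′ (inj (here refl) (there y∈′) (trans eq eq′)))
  ∷ map-unique f (λ x∈ y∈ → inj (there x∈) (there y∈)) u

-- Both lists are free of repetitions and have the same elements, which suffices for a permutation;
-- sums over matchings thereby become sums over patterns.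
rowsOf-↭ : ∀ n → map (rowsOf n) (perfectMatchings n) ↭ patterns n (odds n)
rowsOf-↭ n = ∼bag⇒↭ (unique∧set⇒bag
  (map-unique (rowsOf n) (λ {M} {M′} → rowsOf-injective {n} {M} {M′}) (perfectMatchings-unique n))
  (patterns-unique n (odds n))
  (mk⇔ (λ xss∈ → let M , M∈ , eq = ∈.∈-map⁻ (rowsOf n) xss∈ in
          subst (_∈ patterns n (odds n)) (sym eq) (patterns-∈ n (odds-length n) (matching⇒pattern {n} {M} M∈)))
       (λ xss∈ → let M , M∈ , eq = pattern⇒matching (∈-patterns n (odds-length n) xss∈) in
          subst (_∈ map (rowsOf n) (perfectMatchings n)) eq (∈.∈-map⁺ (rowsOf n) M∈))))

-- Counting the inputs of a given output

∏ : ℕ → (ℕ → ℕ) → ℕ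
∏ m f = product (applyUpTo f m)

∏-cong : ∀ m {f g} → (∀ j → j < m → f j ≡ g j) → ∏ m f ≡ ∏ m g
∏-cong zero    eq = refl
∏-cong (suc m) eq = cong₂ _*_ (eq 0 (s≤s z≤n)) (∏-cong m λ j j<m → eq (suc j) (s≤s j<m))

∏-* : ∀ m f g → ∏ m (λ j → f j * g j) ≡ ∏ m f * ∏ m g
∏-* zero    f g = refl
∏-* (suc m) f g = trans (cong (λ k → f 0 * g 0 * k) (∏-* m (λ j → f (suc j)) (λ j → g (suc j)))) (ℕ.[m*n]*[o*p]≡[m*o]*[n*p] (f 0) (g 0) _ _)

∏-last : ∀ m f → ∏ (suc m) f ≡ ∏ m f * f m
∏-last zero    f = trans (ℕ.*-identityʳ (f 0)) (sym (ℕ.+-identityʳ (f 0)))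
∏-last (suc m) f = trans (cong (λ k → f 0 * k) (∏-last m (λ j → f (suc j)))) (sym (ℕ.*-assoc (f 0) _ (f (suc m))))

∏-const : ∀ m c → ∏ m (λ _ → c) ≡ c ^ m
∏-const zero    c = refl
∏-const (suc m) c = cong (λ k → c * k) (∏-const m c)

∏-zero : ∀ m f {j} → j < m → f j ≡ 0 → ∏ m f ≡ 0
∏-zero (suc m) f {zero}  j<m eq rewrite eq = refl
∏-zero (suc m) f {suc j} (s≤s j<m) eq rewrite ∏-zero m (λ j → f (suc j)) j<m eq = ℕ.*-zeroʳ (f 0)

all-or-zero : ∀ {P : ℕ → Set} m (f : ℕ → ℕ) → (∀ j → P j ⊎ f j ≡ 0) → (∀ j → j < m → P j) ⊎ (∃ λ j → j < m × f j ≡ 0)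
all-or-zero zero    f d = inj₁ λ _ ()
all-or-zero {P} (suc m) f d with d 0 | all-or-zero {λ j → P (suc j)} m (λ j → f (suc j)) (λ j → d (suc j))
... | inj₂ z | _ = inj₂ (0 , s≤s z≤n , z)
... | inj₁ _ | inj₂ (j , j< , z) = inj₂ (suc j , s≤s j< , z)
... | inj₁ p | inj₁ ps = inj₁ λ { zero _ → p ; (suc j) (s≤s j<) → ps j j< }

≡ᵇ-true : ∀ m {n} → m ≡ n → (m ≡ᵇ n) ≡ true
≡ᵇ-true zero    refl = refl
≡ᵇ-true (suc m) refl = ≡ᵇ-true m refl

≡ᵇ-false : ∀ m n → ¬ m ≡ n → (m ≡ᵇ n) ≡ false
≡ᵇ-false zero    zero    m≢n = contradiction refl m≢n
≡ᵇ-false zero    (suc n) m≢n = refl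
≡ᵇ-false (suc m) zero    m≢n = refl
≡ᵇ-false (suc m) (suc n) m≢n = ≡ᵇ-false m n λ eq → m≢n (cong suc eq)

true-≡ᵇ : ∀ m n → (m ≡ᵇ n) ≡ true → m ≡ n
true-≡ᵇ m n eq = ℕ.≡ᵇ⇒≡ m n (subst T (sym eq) _)

-- The number of values of a free bit that turn `x` into `h`, which is also the indicator of `h`
-- being `x` or `x + 1`.
admissible : ℕ → ℕ → ℕ
admissible x h = bit (x ≡ᵇ h) + bit (suc x ≡ᵇ h)

double : Bool → ℕ
double b = if b then 2 else 1

shuffleCell : Bool → Bool → ℕ → ℕ → ℕ
shuffleCell stay move g ξ = if stay then g else if move then g + 1 else g + ξ

ways : Bool → Bool → ℕ → ℕ → ℕ
ways stay move g h = bit (shuffleCell stay move g 0 ≡ᵇ h) + bit (shuffleCell stay move g 1 ≡ᵇ h)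

-- A forced entry ignores its bit, so both values count and give a factor 2. The hypotheses, which
-- will follow from the interlacing of `h`, exclude that both tests succeed and remove from
-- `admissible` the target that the forced entry cannot reach.
ways≡ : ∀ stay move x h → (stay ≡ true → h ≤ x) → (move ≡ true → x < h) →
        ways stay move x h ≡ admissible x h * (double move * double stay)
ways≡ true true x h stay move = contradiction (ℕ.<-≤-trans (move refl) (stay refl)) (ℕ.<-irrefl refl)
ways≡ true false x h stay move rewrite ≡ᵇ-false (suc x) h (λ { refl → ℕ.1+n≰n (stay refl) }) = eq (bit (x ≡ᵇ h))
  where
  eq : ∀ b → b + b ≡ (b + 0) * 2
  eq = ℕRing.solve-∀
ways≡ false true x h stay move rewrite ≡ᵇ-false x h (λ { refl → ℕ.<-irrefl refl (move refl) }) | ℕ.+-comm x 1 = eq (bit (suc x ≡ᵇ h))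
  where
  eq : ∀ b → b + b ≡ b * 2
  eq = ℕRing.solve-∀
ways≡ false false x h stay move rewrite ℕ.+-comm x 1 | ℕ.+-identityʳ x = sym (ℕ.*-identityʳ _)

between-hits : ∀ {x x′ H} → x ≤ H → H < x′ → ∑ (between x x′) (λ y → bit (y ≡ᵇ H)) ≡ 1
between-hits {x} {x′} {H} x≤H H<x′ = ∑-single {f = λ y → bit (y ≡ᵇ H)} (between-unique x x′) (between-∈ x≤H H<x′)
  (cong bit (≡ᵇ-true H refl)) λ {y} _ y≢H → cong bit (≡ᵇ-false y H y≢H)

between-misses : ∀ {x x′} (b : ℕ → Bool) → (∀ {y} → x ≤ y → y < x′ → b y ≡ false) → ∑ (between x x′) (λ y → bit (b y)) ≡ 0
between-misses {x} {x′} b ≢ = ∑-zero (between x x′) {λ y → bit (b y)} λ y∈ → let x≤y , y<x′ = ∈-between y∈ in cong bit (≢ x≤y y<x′)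

-- A candidate y is lost exactly if H is one of the ends, where a factor 2 is gained.
between-admissible : ∀ {x x′ H} → x < x′ → x ≤ H → H ≤ x′ →
                     double (x ≡ᵇ H) * double (x′ ≡ᵇ H) * ∑ (between x x′) (λ y → admissible y H) ≡ 2
between-admissible {x} {x′} {H} x<x′ x≤H H≤x′ = trans
  (cong (λ s → double (x ≡ᵇ H) * double (x′ ≡ᵇ H) * s) (∑-+ (between x x′) (λ y → bit (y ≡ᵇ H)) (λ y → bit (suc y ≡ᵇ H))))
  (cases H x≤H H≤x′ (ℕ.m≤n⇒m<n∨m≡n x≤H) (ℕ.m≤n⇒m<n∨m≡n H≤x′))
  where
  substitute : ∀ {p q c d p′ q′ c′ d′} → p ≡ p′ → q ≡ q′ → c ≡ c′ → d ≡ d′ →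
               p′ * q′ * (c′ + d′) ≡ 2 → p * q * (c + d) ≡ 2
  substitute refl refl refl refl eq = eq
  cases : ∀ H → x ≤ H → H ≤ x′ → x < H ⊎ x ≡ H → H < x′ ⊎ H ≡ x′ →
          double (x ≡ᵇ H) * double (x′ ≡ᵇ H) *
          (∑ (between x x′) (λ y → bit (y ≡ᵇ H)) + ∑ (between x x′) (λ y → bit (suc y ≡ᵇ H))) ≡ 2
  cases H x≤H H≤x′ (inj₂ refl) _ = substitute
    (cong double (≡ᵇ-true x refl)) (cong double (≡ᵇ-false x′ x (λ eq → ℕ.<-irrefl (sym eq) x<x′))) (between-hits {x} {x′} {x} ℕ.≤-refl x<x′)
    (between-misses {x} {x′} (λ y → suc y ≡ᵇ x) (λ {y} x≤y _ → ≡ᵇ-false (suc y) x λ eq → ℕ.<-irrefl (sym eq) (s≤s x≤y))) refl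
  cases (suc H) x≤H H≤x′ (inj₁ (s≤s x≤H′)) (inj₂ refl) = substitute
    (cong double (≡ᵇ-false x (suc H) (λ eq → ℕ.<-irrefl eq (s≤s x≤H′)))) (cong double (≡ᵇ-true H refl))
    (between-misses {x} {suc H} (λ y → y ≡ᵇ suc H) (λ {y} _ y<H → ≡ᵇ-false y (suc H) λ eq → ℕ.<-irrefl eq y<H))
    (between-hits {x} {suc H} {H} x≤H′ H≤x′) refl
  cases (suc H) x≤H H≤x′ (inj₁ (s≤s x≤H′)) (inj₁ H<x′) = substitute
    (cong double (≡ᵇ-false x (suc H) (λ eq → ℕ.<-irrefl eq (s≤s x≤H′)))) (cong double (≡ᵇ-false x′ (suc H) (λ eq → ℕ.<-irrefl (sym eq) H<x′)))
    (between-hits {x} {x′} {suc H} x≤H H<x′) (between-hits {x} {x′} {H} x≤H′ H≤x′) refl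

-- The entries of a row interlacing with `x` range independently over the gaps of `x`, so the sum of
-- products factors.
∑-interlacing : ∀ m x (φ : ℕ → ℕ → ℕ) → length x ≡ suc m →
                ∑ (interlacing x) (λ y → ∏ m (λ j → φ j (nth y j))) ≡
                ∏ m (λ j → ∑ (between (nth x j) (nth x (suc j))) (φ j))
∑-interlacing zero    (x ∷ [])      φ l = refl
∑-interlacing (suc m) (x ∷ x′ ∷ xs) φ l = trans
  (∑-cartesianProductWith (between x x′) (interlacing (x′ ∷ xs)))
  (cong (λ k → ∑ (between x x′) (φ 0) * k) (∑-interlacing m (x′ ∷ xs) (λ j → φ (suc j)) (ℕ.suc-injective l)))
  where
  ∑-cartesianProductWith : ∀ as bs → ∑ (cartesianProductWith _∷_ as bs) (λ y → ∏ (suc m) (λ j → φ j (nth y j))) ≡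
    ∑ as (φ 0) * ∑ bs (λ y → ∏ m (λ j → φ (suc j) (nth y j)))
  ∑-cartesianProductWith []       bs = refl
  ∑-cartesianProductWith (a ∷ as) bs = trans (∑-++ (map (a ∷_) bs) (cartesianProductWith _∷_ as bs) _)
    (trans (cong₂ _+_ (trans (∑-map (a ∷_) bs (λ y → ∏ (suc m) (λ j → φ j (nth y j))))
                             (∑-*ˡ bs (φ 0 a) (λ y → ∏ m (λ j → φ (suc j) (nth y j)))))
                      (∑-cartesianProductWith as bs))
           (sym (ℕ.*-distribʳ-+ (∑ bs (λ y → ∏ m (λ j → φ (suc j) (nth y j)))) (φ 0 a) (∑ as (φ 0)))))

interlaces-≤< : ∀ {xs ys} → Interlaces xs ys → ∀ j → j < length ys → nth xs j ≤ nth ys j × nth ys j < nth xs (suc j)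
interlaces-≤< (cons x≤y y<x′ i) zero    j<       = x≤y , y<x′
interlaces-≤< (cons x≤y y<x′ i) (suc j) (s≤s j<) = interlaces-≤< i j j<

record Staircase (n : ℕ) (h : ℕ → ℕ → ℕ) : Set where
  field
    bottom : ∀ j → j ≤ n → h n j ≡ 2 * j + 1
    weak   : ∀ i j → i < n → j ≤ i → h (suc i) j ≤ h i j
    strict : ∀ i j → i < n → j ≤ i → h i j < h (suc i) (suc j)

-- The zero row above row 0 is the one that `shuffleRows` uses.
above : (ℕ → ℕ → ℕ) → ℕ → ℕ → ℕ
above h zero    = λ _ → 0
above h (suc i) = h i

-- The tests read the prescribed row `i - 1` of `h` instead of a computed one; `agree⇔cells`
-- justifies this.
cellWays : (ℕ → ℕ → ℕ) → (ℕ → ℕ) → ℕ → ℕ → ℕ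
cellWays h g i j = ways ((j <ᵇ i) ∧ (g j ≡ᵇ above h i j)) ((0 <ᵇ j) ∧ (g j ≡ᵇ above h i (pred j))) (g j) (h i j)

rowWays : (ℕ → ℕ → ℕ) → (ℕ → ℕ) → ℕ → ℕ
rowWays h g i = ∏ (suc i) (cellWays h g i)

<ᵇ-true : ∀ {m n} → m < n → (m <ᵇ n) ≡ true
<ᵇ-true {zero}  (s≤s _)         = refl
<ᵇ-true {suc m} (s≤s m<n) = <ᵇ-true m<n

<ᵇ-irrefl : ∀ n → (n <ᵇ n) ≡ false
<ᵇ-irrefl zero    = refl
<ᵇ-irrefl (suc n) = <ᵇ-irrefl n

admissible-bounds : ∀ {x h} → (x ≤ h × h ≤ suc x) ⊎ admissible x h ≡ 0
admissible-bounds {x} {h} with x ℕ.≟ h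
... | yes refl = inj₁ (ℕ.≤-refl , ℕ.n≤1+n x)
... | no x≢h with suc x ℕ.≟ h
...   | yes refl = inj₁ (ℕ.n≤1+n x , ℕ.≤-refl)
...   | no sx≢h  = inj₂ (cong₂ (λ a b → bit a + bit b) (≡ᵇ-false x h x≢h) (≡ᵇ-false (suc x) h sx≢h))

module _ (n : ℕ) (h : ℕ → ℕ → ℕ) (st : Staircase (suc n) h) where
  open Staircase st

  module Row (k : ℕ) (k<n : k < n) (x : List ℕ) (len : length x ≡ suc (suc k))
             (x-mono : ∀ j → j ≤ k → nth x j < nth x (suc j)) where

    g = nth x

    stays moves : ℕ → Bool
    stays j = (j <ᵇ suc k) ∧ (g j ≡ᵇ h k j)
    moves j = (0 <ᵇ j) ∧ (g j ≡ᵇ h k (pred j))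

    a m s : ℕ → ℕ
    a j = admissible (g j) (h (suc k) j)
    m j = double (moves j)
    s j = double (stays j)

    cellWays≡ : ∀ j → j < suc (suc k) → cellWays h g (suc k) j ≡ a j * (m j * s j)
    cellWays≡ j j< = ways≡ (stays j) (moves j) (g j) (h (suc k) j) stay (move j j<)
      where
      stay : stays j ≡ true → h (suc k) j ≤ g j
      stay eq with j <ᵇ suc k in lt
      ... | true = subst (h (suc k) j ≤_) (sym (true-≡ᵇ (g j) (h k j) eq)) (weak k j (ℕ.m≤n⇒m≤1+n k<n) (ℕ.≤-pred (ℕ.<ᵇ⇒< j (suc k) (subst T (sym lt) _))))
      move : ∀ j → j < suc (suc k) → moves j ≡ true → g j < h (suc k) j
      move (suc j) (s≤s j<) eq = subst (_< h (suc k) (suc j)) (sym (true-≡ᵇ (g (suc j)) (h k j) eq)) (strict k j (ℕ.m≤n⇒m≤1+n k<n) (ℕ.≤-pred j<))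

    gaps : ℕ → ℕ
    gaps j = ∑ (between (g j) (g (suc j))) (λ y → admissible y (h k j))

    admissibles : ℕ
    admissibles = ∏ (suc (suc k)) a

    -- The `stays` test of cell `j` and the `moves` test of cell `j + 1` both compare with `h k j`.
    -- Regrouping their factors by the entries of the row above gives exactly the product in
    -- `between-admissible`, equal to 2 for each gap. Nothing is left over, since the first cell
    -- cannot move and the last cannot stay. If some cell is inadmissible, both sides vanish.
    rowWays-gaps : rowWays h g (suc k) * ∏ (suc k) gaps ≡ admissibles * 2 ^ suc k
    rowWays-gaps with all-or-zero (suc (suc k)) a (λ j → admissible-bounds {g j} {h (suc k) j})
    ... | inj₂ (j , j< , z) = trans (cong (_* ∏ (suc k) gaps)
            (∏-zero (suc (suc k)) (cellWays h g (suc k)) j< (trans (cellWays≡ j j<) (cong (_* (m j * s j)) z))))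
            (sym (cong (_* 2 ^ suc k) (∏-zero (suc (suc k)) a j< z)))
    ... | inj₁ adm = begin
      rowWays h g (suc k) * ∏ (suc k) gaps
        ≡⟨ cong (_* ∏ (suc k) gaps) (trans (∏-cong (suc (suc k)) cellWays≡) (trans (∏-* (suc (suc k)) a (λ j → m j * s j))
             (cong (λ p → admissibles * p) (∏-* (suc (suc k)) m s)))) ⟩
      admissibles * (∏ (suc (suc k)) m * ∏ (suc (suc k)) s) * ∏ (suc k) gaps
        ≡⟨ cong (λ p → admissibles * p * ∏ (suc k) gaps) (cong₂ _*_ (ℕ.*-identityˡ (∏ (suc k) (λ j → m (suc j))))
             (trans (∏-last (suc k) s) (trans (cong (λ b → ∏ (suc k) s * double (b ∧ (g (suc k) ≡ᵇ h k (suc k)))) (<ᵇ-irrefl (suc k)))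
                                              (ℕ.*-identityʳ (∏ (suc k) s))))) ⟩
      admissibles * (∏ (suc k) (λ j → m (suc j)) * ∏ (suc k) s) * ∏ (suc k) gaps
        ≡⟨ trans (ℕ.*-assoc admissibles _ (∏ (suc k) gaps)) (cong (λ p → admissibles * p)
             (sym (trans (∏-* (suc k) (λ j → m (suc j) * s j) gaps) (cong (_* ∏ (suc k) gaps) (∏-* (suc k) (λ j → m (suc j)) s))))) ⟩
      admissibles * ∏ (suc k) (λ j → m (suc j) * s j * gaps j)
        ≡⟨ cong (λ p → admissibles * p) (trans (∏-cong (suc k) λ j j< → two j (ℕ.≤-pred j<)) (∏-const (suc k) 2)) ⟩
      admissibles * 2 ^ suc k ∎
      where
      open ≡-Reasoning
      two : ∀ j → j ≤ k → m (suc j) * s j * gaps j ≡ 2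
      two j j≤k rewrite <ᵇ-true (s≤s j≤k) = trans (cong (_* gaps j) (ℕ.*-comm (double (g (suc j) ≡ᵇ h k j)) (double (g j ≡ᵇ h k j))))
        -- Admissibility of cells `j` and `j + 1` places `h k j` in the closed gap:
        -- `g j ≤ h (suc k) j ≤ h k j` and `h k j < h (suc k) (suc j) ≤ g (suc j) + 1`.
        (between-admissible (x-mono j j≤k)
          (ℕ.≤-trans (proj₁ (adm j (s≤s (ℕ.m≤n⇒m≤1+n j≤k)))) (weak k j (ℕ.m≤n⇒m≤1+n k<n) j≤k))
          (ℕ.≤-pred (ℕ.≤-trans (strict k j (ℕ.m≤n⇒m≤1+n k<n) j≤k) (proj₂ (adm (suc j) (s≤s (s≤s j≤k)))))))

-- The number of outcomes that lead to `h` from the input with rows `x`, `y`, ... upwards. The value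
-- 0 is a default: a member of `patterns (suc k) x` is never empty.
weight : (ℕ → ℕ → ℕ) → ℕ → List ℕ → List (List ℕ) → ℕ
weight h zero    x _         = rowWays h (nth x) 0
weight h (suc k) x []        = 0
weight h (suc k) x (y ∷ yss) = rowWays h (nth x) (suc k) * weight h k y yss

-- The number of pairs of an input tableau and an outcome of the bits that lead to a given output.
total : ℕ → ℕ
total zero    = 1
total (suc k) = 2 ^ suc k * total k

Increasing : List ℕ → Set
Increasing x = ∀ j → suc j < length x → nth x j < nth x (suc j)

interlaces-increasing : ∀ {xs ys} → Interlaces xs ys → Increasing ys
interlaces-increasing i j j< =
  ℕ.<-≤-trans (proj₂ (interlaces-≤< i j (ℕ.<⇒≤ j<))) (proj₁ (interlaces-≤< i (suc j) j<))

admissible≡1 : ∀ {x h} → x ≤ h → h ≤ suc x → admissible x h ≡ 1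
admissible≡1 {x} {h} x≤h h≤ with ℕ.m≤n⇒m<n∨m≡n x≤h
... | inj₂ refl = cong₂ (λ a b → bit a + bit b) (≡ᵇ-true x refl) (≡ᵇ-false (suc x) x ℕ.1+n≢n)
... | inj₁ x<h with refl ← ℕ.≤-antisym h≤ x<h = cong₂ (λ a b → bit a + bit b) (≡ᵇ-false x (suc x) λ eq → ℕ.1+n≢n (sym eq)) (≡ᵇ-true x refl)

module _ (n : ℕ) (h : ℕ → ℕ → ℕ) (st : Staircase (suc n) h) where
  open Staircase st

  -- The admissibility product of row `x` must stay in the statement: summed over the choices of `x`
  -- within the row below, it becomes the product of gaps that `rowWays-gaps` needs for that lower
  -- row.
  weight-sum : ∀ k x → k ≤ n → length x ≡ suc k → Increasing x →
               ∑ (patterns k x) (weight h k x) ≡ ∏ (suc k) (λ j → admissible (nth x j) (h k j)) * total k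
  weight-sum zero x k≤n len inc = trans (ℕ.+-identityʳ _) (trans (ℕ.*-identityʳ _)
    (trans (ways≡ false false (nth x 0) (h 0 0) (λ ()) (λ ())) (sym (ℕ.*-identityʳ _))))
  weight-sum (suc k) x k<n len inc = begin
    ∑ (patterns (suc k) x) (weight h (suc k) x)
      ≡⟨ ∑-concatMap (λ y → map (y ∷_) (patterns k y)) (interlacing x) (weight h (suc k) x) ⟩
    ∑ (interlacing x) (λ y → ∑ (map (y ∷_) (patterns k y)) (weight h (suc k) x))
      ≡⟨ ∑-cong (interlacing x) (λ {y} y∈ → trans (∑-map (y ∷_) (patterns k y) (weight h (suc k) x))
           (trans (∑-*ˡ (patterns k y) R (weight h k y)) (cong (λ p → R * p) (above-row y (∈-interlacing y∈))))) ⟩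
    ∑ (interlacing x) (λ y → R * (∏ (suc k) (λ j → admissible (nth y j) (h k j)) * total k))
      ≡⟨ trans (∑-*ˡ (interlacing x) R _) (cong (λ p → R * p) (∑-*ʳ (interlacing x) (total k) _)) ⟩
    R * (∑ (interlacing x) (λ y → ∏ (suc k) (λ j → admissible (nth y j) (h k j))) * total k)
      ≡⟨ cong (λ p → R * (p * total k)) (∑-interlacing (suc k) x (λ j y → admissible y (h k j)) len) ⟩
    R * (∏ (suc k) gaps * total k)
      ≡⟨ sym (ℕ.*-assoc R _ _) ⟩
    R * ∏ (suc k) gaps * total k
      ≡⟨ cong (_* total k) rowWays-gaps ⟩
    admissibles * 2 ^ suc k * total k
      ≡⟨ ℕ.*-assoc admissibles _ _ ⟩
    admissibles * total (suc k) ∎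
    where
    open ≡-Reasoning
    open Row n h st k k<n x len (λ j j≤k → inc j (subst (suc j <_) (sym len) (s≤s (s≤s j≤k))))
    R = rowWays h (nth x) (suc k)
    above-row : ∀ y → Interlaces x y → ∑ (patterns k y) (weight h k y) ≡ ∏ (suc k) (λ j → admissible (nth y j) (h k j)) * total k
    above-row y i = weight-sum k y (ℕ.<⇒≤ k<n) (ℕ.suc-injective (trans (sym (interlaces-length i)) len)) (interlaces-increasing i)

  weight-total : ∑ (patterns n (odds n)) (weight h n (odds n)) ≡ total n
  weight-total = trans (weight-sum n (odds n) ℕ.≤-refl (odds-length n) inc)
    (trans (cong (_* total n) (trans (∏-cong (suc n) λ j j< → adm j (ℕ.≤-pred j<)) (trans (∏-const (suc n) 1) (ℕ.^-zeroˡ (suc n))))) (ℕ.*-identityˡ _))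
    where
    2*suc : ∀ j → 2 * suc j + 1 ≡ suc (suc (2 * j + 1))
    2*suc j = cong (_+ 1) (ℕ.*-suc 2 j)
    inc : Increasing (odds n)
    inc j j< = subst₂ _<_ (sym (odds-nth n j (ℕ.<⇒≤ j<n))) (sym (trans (odds-nth n (suc j) j<n) (2*suc j))) (s≤s (ℕ.n≤1+n _))
      where j<n = ℕ.≤-pred (subst (suc j <_) (odds-length n) j<)
    adm : ∀ j → j ≤ n → admissible (nth (odds n) j) (h n j) ≡ 1
    -- The fixed bottom row of `h` gives `2 j + 1 ≤ h n j < 2 j + 3`.
    adm j j≤n = trans (cong (λ x → admissible x (h n j)) (odds-nth n j j≤n)) (admissible≡1
      (subst (_≤ h n j) (bottom j (ℕ.m≤n⇒m≤1+n j≤n)) (weak n j ℕ.≤-refl j≤n))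
      (ℕ.≤-pred (subst (h n j <_) (trans (bottom (suc j) (s≤s j≤n)) (2*suc j)) (strict n j ℕ.≤-refl j≤n))))

-- Outcomes of the bits as independent choices per cell

open DecMembership (≡-dec ℕ._≟_ ℕ._≟_) using () renaming (_∈?_ to _∈ᶜ?_)

∏ᴸ : ∀ {A : Set} → List A → (A → ℕ) → ℕ
∏ᴸ xs f = product (map f xs)

∏ᴸ-++ : ∀ {A : Set} (xs ys : List A) f → ∏ᴸ (xs ++ ys) f ≡ ∏ᴸ xs f * ∏ᴸ ys f
∏ᴸ-++ xs ys f = trans (cong product (map-++ f xs ys)) (product-++ (map f xs) (map f ys))

∏ᴸ-concatMap : ∀ {A B : Set} (g : A → List B) xs f → ∏ᴸ (concatMap g xs) f ≡ ∏ᴸ xs (λ x → ∏ᴸ (g x) f)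
∏ᴸ-concatMap g []       f = refl
∏ᴸ-concatMap g (x ∷ xs) f = trans (∏ᴸ-++ (g x) (concatMap g xs) f) (cong (λ p → ∏ᴸ (g x) f * p) (∏ᴸ-concatMap g xs f))

∏ᴸ-map : ∀ {A B : Set} (g : A → B) xs f → ∏ᴸ (map g xs) f ≡ ∏ᴸ xs (λ x → f (g x))
∏ᴸ-map g []       f = refl
∏ᴸ-map g (x ∷ xs) f = cong (λ p → f (g x) * p) (∏ᴸ-map g xs f)

∏ᴸ-cong : ∀ {A : Set} (xs : List A) {f g} → (∀ {x} → x ∈ xs → f x ≡ g x) → ∏ᴸ xs f ≡ ∏ᴸ xs g
∏ᴸ-cong []       eq = refl
∏ᴸ-cong (x ∷ xs) eq = cong₂ _*_ (eq (here refl)) (∏ᴸ-cong xs λ x∈ → eq (there x∈))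

∏ᴸ-upTo : ∀ m f → ∏ᴸ (upTo m) f ≡ ∏ m f
∏ᴸ-upTo m f = cong product (map-upTo f m)

∏ᴸ-cells : ∀ n f → ∏ᴸ (cells n) f ≡ ∏ (suc n) (λ i → ∏ (suc i) (λ j → f (i , j)))
∏ᴸ-cells n f = trans (∏ᴸ-concatMap (λ i → map (i ,_) (upTo (suc i))) (upTo (suc n)) f)
  (trans (∏ᴸ-upTo (suc n) (λ i → ∏ᴸ (map (i ,_) (upTo (suc i))) f)) (∏-cong (suc n) λ i _ → trans (∏ᴸ-map (i ,_) (upTo (suc i)) f) (∏ᴸ-upTo (suc i) (λ j → f (i , j)))))

cells-∈ : ∀ {n i j} → i ≤ n → j ≤ i → (i , j) ∈ cells n
cells-∈ {n} {i} {j} i≤n j≤i = ∈.∈-concatMap⁺ (λ i → map (i ,_) (upTo (suc i)))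
  (lose (∈.∈-upTo⁺ (s≤s i≤n)) (∈.∈-map⁺ (i ,_) (∈.∈-upTo⁺ (s≤s j≤i))))

∈-cells : ∀ {n i j} → (i , j) ∈ cells n → i ≤ n × j ≤ i
∈-cells {n} c∈ with i , i∈ , m ← find (∈.∈-concatMap⁻ (λ i → map (i ,_) (upTo (suc i))) {xs = upTo (suc n)} c∈)
  with j , j∈ , refl ← ∈.∈-map⁻ (i ,_) m = ℕ.≤-pred (∈.∈-upTo⁻ i∈) , ℕ.≤-pred (∈.∈-upTo⁻ j∈)

cells-unique : ∀ n → Unique (cells n)
cells-unique n = go (upTo (suc n)) (Unique.upTo⁺ (suc n))
  where
  row = λ (i : ℕ) → map (i ,_) (upTo (suc i))
  go : ∀ is → Unique is → Unique (concatMap row is)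
  go []       []       = []
  go (i ∷ is) (i∉ ∷ u) = Unique.++⁺ (Unique.map⁺ (λ { refl → refl }) (Unique.upTo⁺ (suc i))) (go is u) disjoint
    where
    disjoint : ∀ {c} → ¬ (c ∈ row i × c ∈ concatMap row is)
    disjoint (c∈ , c∈′) with k , k∈ , m ← find (∈.∈-concatMap⁻ row {xs = is} c∈′)
      with _ , _ , refl ← ∈.∈-map⁻ (i ,_) c∈ | _ , _ , refl ← ∈.∈-map⁻ (k ,_) m = All.lookup i∉ k∈ refl

module _ {A : Set} (_≟_ : DecidableEquality A) where

  open DecMembership _≟_ using () renaming (_∈?_ to _∈ᴬ?_)

  -- Independence of the bits: expanding the product on the right chooses a bit at each cell, and
  -- the choices correspond to the subsets.
  ∑-sublists-∏ : ∀ {xs} → Unique xs → (φ : A → Bool → ℕ) →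
                 ∑ (sublists xs) (λ S → ∏ᴸ xs (λ c → φ c (does (c ∈ᴬ? S)))) ≡ ∏ᴸ xs (λ c → φ c false + φ c true)
  ∑-sublists-∏ {[]}     []       φ = refl
  ∑-sublists-∏ {x ∷ xs} (x∉ ∷ u) φ = begin
    ∑ (sublists xs ++ map (x ∷_) (sublists xs)) F
      ≡⟨ trans (∑-++ (sublists xs) _ F) (cong (λ p → ∑ (sublists xs) F + p) (∑-map (x ∷_) (sublists xs) F)) ⟩
    ∑ (sublists xs) F + ∑ (sublists xs) (λ S → F (x ∷ S))
      ≡⟨ cong₂ _+_ (trans (∑-cong (sublists xs) without) (∑-*ˡ (sublists xs) (φ x false) G))
                   (trans (∑-cong (sublists xs) with-x) (∑-*ˡ (sublists xs) (φ x true) G)) ⟩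
    φ x false * ∑ (sublists xs) G + φ x true * ∑ (sublists xs) G
      ≡⟨ sym (ℕ.*-distribʳ-+ (∑ (sublists xs) G) (φ x false) (φ x true)) ⟩
    (φ x false + φ x true) * ∑ (sublists xs) G
      ≡⟨ cong (λ p → (φ x false + φ x true) * p) (∑-sublists-∏ u φ) ⟩
    (φ x false + φ x true) * ∏ᴸ xs (λ c → φ c false + φ c true) ∎
    where
    open ≡-Reasoning
    F G : List A → ℕ
    F S = ∏ᴸ (x ∷ xs) (λ c → φ c (does (c ∈ᴬ? S)))
    G S = ∏ᴸ xs (λ c → φ c (does (c ∈ᴬ? S)))
    without : ∀ {S} → S ∈ sublists xs → F S ≡ φ x false * G S
    without {S} S∈ = cong (λ b → φ x b * G S) (dec-false (x ∈ᴬ? S) λ x∈ → All.lookup x∉ (∈-sublists S∈ x∈) refl)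
    with-x : ∀ {S} → S ∈ sublists xs → F (x ∷ S) ≡ φ x true * G S
    with-x {S} S∈ = cong₂ (λ b p → φ x b * p) (dec-true (x ∈ᴬ? (x ∷ S)) (here refl))
      (∏ᴸ-cong xs λ {c} c∈ → cong (φ c) (same c∈))
      where
      same : ∀ {c} → c ∈ xs → does (c ∈ᴬ? (x ∷ S)) ≡ does (c ∈ᴬ? S)
      same {c} c∈ = does-⇔ (mk⇔ (Any.tail λ { refl → All.lookup x∉ c∈ refl }) there) (c ∈ᴬ? (x ∷ S)) (c ∈ᴬ? S)

bit-all? : ∀ {A : Set} {P : A → Set} (P? : Decidable P) xs → bit (does (all? P? xs)) ≡ ∏ᴸ xs (λ x → bit (does (P? x)))
bit-all? P? []       = refl
bit-all? P? (x ∷ xs) with does (P? x)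
... | false = refl
... | true  = trans (bit-all? P? xs) (sym (ℕ.+-identityʳ _))

shuffleRow-cong : ∀ i {b b′} g ξ j → j ≤ i → (∀ k → k < i → b k ≡ b′ k) →
                  shuffleRow i b g ξ j ≡ shuffleRow i b′ g ξ j
shuffleRow-cong i g ξ j j≤i b≡ with j <ᵇ i in lt
shuffleRow-cong i g ξ zero    j≤i b≡ | false = refl
shuffleRow-cong i g ξ (suc j) j≤i b≡ | false rewrite b≡ j j≤i = refl
shuffleRow-cong i g ξ zero    j≤i b≡ | true rewrite b≡ 0 (ℕ.<ᵇ⇒< 0 i (subst T (sym lt) _)) = refl
shuffleRow-cong i g ξ (suc j) j≤i b≡ | true rewrite b≡ (suc j) (ℕ.<ᵇ⇒< (suc j) i (subst T (sym lt) _)) | b≡ j j≤i = refl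

shuffle-≤ : ∀ n g ξ {i} j → i ≤ n → shuffle n g ξ i j ≡ shuffleRows g ξ i j
shuffle-≤ n g ξ {i} j i≤n with i ≤ᵇ n in le
... | true  = refl
... | false = contradiction (subst T le (ℕ.≤⇒≤ᵇ i≤n)) λ ()

shuffle-bottom : ∀ n g ξ j → shuffle n g ξ (suc n) j ≡ 2 * j + 1
shuffle-bottom n g ξ j rewrite <ᵇ-irrefl n = refl

-- By induction on the row, the whole output agrees with h if every cell does
-- when its row is computed from the row of h above it.
agree⇔cells : ∀ n g h ξ → (∀ j → j ≤ suc n → h (suc n) j ≡ 2 * j + 1) →
  Agree (suc n) (shuffle n g ξ) h ⇔ All (λ (i , j) → shuffleRow i (above h i) (g i) (ξ i) j ≡ h i j) (cells n)
agree⇔cells n g h ξ h-bottom = mk⇔ forth back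
  where
  rows≡ : ∀ i j → shuffleRows g ξ i j ≡ shuffleRow i (above (shuffleRows g ξ) i) (g i) (ξ i) j
  rows≡ zero    j = refl
  rows≡ (suc i) j = refl
  above-cong : ∀ {h h′} i → i ≤ n → (∀ i j → i ≤ n → j ≤ i → h i j ≡ h′ i j) → ∀ k → k < i → above h i k ≡ above h′ i k
  above-cong (suc i) i≤n eq k k<i = eq i k (ℕ.<⇒≤ i≤n) (ℕ.≤-pred k<i)
  forth : _ → _
  forth agree = All.tabulate λ {(i , j)} c∈ → let i≤n , j≤i = ∈-cells {n} c∈ in
      trans (shuffleRow-cong i (g i) (ξ i) j j≤i (above-cong i i≤n λ i j i≤n j≤i → sym (eq i j i≤n j≤i)))
            (trans (sym (rows≡ i j)) (eq i j i≤n j≤i))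
    where
    eq : ∀ i j → i ≤ n → j ≤ i → shuffleRows g ξ i j ≡ h i j
    eq i j i≤n j≤i = trans (sym (shuffle-≤ n g ξ j i≤n)) (All.lookup agree (cells-∈ {suc n} (ℕ.m≤n⇒m≤1+n i≤n) j≤i))
  back : _ → _
  back ok = All.tabulate λ {(i , j)} c∈ → let i≤ , j≤i = ∈-cells {suc n} c∈ in eq′ i j j≤i (ℕ.m≤n⇒m<n∨m≡n i≤)
    where
    ok′ : ∀ i j → i ≤ n → j ≤ i → shuffleRow i (above h i) (g i) (ξ i) j ≡ h i j
    ok′ i j i≤n j≤i = All.lookup ok (cells-∈ {n} i≤n j≤i)
    eq : ∀ i j → i ≤ n → j ≤ i → shuffleRows g ξ i j ≡ h i j
    eq zero    j i≤n j≤i = ok′ zero j i≤n j≤i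
    eq (suc i) j i≤n j≤i = trans (shuffleRow-cong (suc i) (g (suc i)) (ξ (suc i)) j j≤i (λ k k<i → eq i k (ℕ.<⇒≤ i≤n) (ℕ.≤-pred k<i))) (ok′ (suc i) j i≤n j≤i)
    eq′ : ∀ i j → j ≤ i → i < suc n ⊎ i ≡ suc n → shuffle n g ξ i j ≡ h i j
    eq′ i j j≤i (inj₁ i≤n)  = trans (shuffle-≤ n g ξ j (ℕ.≤-pred i≤n)) (eq i j (ℕ.≤-pred i≤n) j≤i)
    eq′ i j j≤i (inj₂ refl) = trans (shuffle-bottom n g ξ j) (sym (h-bottom j j≤i))

outcomeCount : ∀ n → (g h : ℕ → ℕ → ℕ) → ℕ
outcomeCount n g h = length (filter (λ S → agree? (suc n) (shuffle n g (bits S)) h) (outcomes n))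

outcomeCount≡∏ : ∀ n g h → (∀ j → j ≤ suc n → h (suc n) j ≡ 2 * j + 1) →
                 outcomeCount n g h ≡ ∏ (suc n) (λ i → rowWays h (g i) i)
outcomeCount≡∏ n g h h-bottom = begin
  outcomeCount n g h
    ≡⟨ length-filter≡∑ (λ S → agree? (suc n) (shuffle n g (bits S)) h) (outcomes n) ⟩
  ∑ (outcomes n) (λ S → bit (does (agree? (suc n) (shuffle n g (bits S)) h)))
    ≡⟨ ∑-cong (outcomes n) (λ {S} _ → 
         trans (cong bit (does-⇔ (agree⇔cells n g h (bits S) h-bottom) (agree? (suc n) (shuffle n g (bits S)) h) (all? (ok? S) (cells n))))
               (bit-all? (ok? S) (cells n))) ⟩
  ∑ (outcomes n) (λ S → ∏ᴸ (cells n) (λ c → φ c (does (c ∈ᶜ? S))))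
    ≡⟨ ∑-sublists-∏ (≡-dec ℕ._≟_ ℕ._≟_) (cells-unique n) φ ⟩
  ∏ᴸ (cells n) (λ c → φ c false + φ c true)
    ≡⟨ ∏ᴸ-cells n (λ c → φ c false + φ c true) ⟩
  ∏ (suc n) (λ i → rowWays h (g i) i) ∎
  where
  open ≡-Reasoning
  ok? : ∀ S → Decidable (λ ((i , j) : ℕ × ℕ) → shuffleRow i (above h i) (g i) (bits S i) j ≡ h i j)
  ok? S (i , j) = shuffleRow i (above h i) (g i) (bits S i) j ℕ.≟ h i j
  φ : ℕ × ℕ → Bool → ℕ
  -- A cell reads its own bit only, so a constant row of bits can stand for `bits S i`.
  φ (i , j) b = bit (shuffleRow i (above h i) (g i) (λ _ → bit b) j ≡ᵇ h i j)

rowWays-cong : ∀ h {g g′} i → (∀ j → j ≤ i → g j ≡ g′ j) → rowWays h g i ≡ rowWays h g′ i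
rowWays-cong h {g} {g′} i eq = ∏-cong (suc i) λ j j<1+i → cell j (eq j (ℕ.≤-pred j<1+i))
  where
  cell : ∀ j → g j ≡ g′ j → cellWays h g i j ≡ cellWays h g′ i j
  cell j e rewrite e = refl

∏-rowWays≡weight : ∀ h (X : ℕ → List ℕ) k x →
  ∏ k (λ i → rowWays h (nth (X (suc i))) i) * rowWays h (nth x) k ≡ weight h k x (rowsUpTo X k)
∏-rowWays≡weight h X zero    x = ℕ.*-identityˡ _
∏-rowWays≡weight h X (suc k) x = trans (ℕ.*-comm _ (rowWays h (nth x) (suc k))) (cong (λ p → rowWays h (nth x) (suc k) * p)
  (trans (∏-last k (λ i → rowWays h (nth (X (suc i))) i)) (∏-rowWays≡weight h X k (X (suc k)))))

-- Staircase tableaux as arrays and as patterns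

nth-ext : ∀ xs f m → length xs ≡ m → (∀ j → j < m → nth xs j ≡ f j) → xs ≡ applyUpTo f m
nth-ext []       f zero    l eq = refl
nth-ext (x ∷ xs) f (suc m) l eq = cong₂ _∷_ (eq 0 (s≤s z≤n))
  (nth-ext xs (λ j → f (suc j)) m (ℕ.suc-injective l) λ j j< → eq (suc j) (s≤s j<))

nth-applyUpTo : ∀ f m j → j < m → nth (applyUpTo f m) j ≡ f j
nth-applyUpTo f (suc m) zero    j<       = refl
nth-applyUpTo f (suc m) (suc j) (s≤s j<) = nth-applyUpTo (λ j → f (suc j)) m j j<

interlaces-applyUpTo : ∀ m f g → (∀ j → j < m → f j ≤ g j) → (∀ j → j < m → g j < f (suc j)) →
                       Interlaces (applyUpTo f (suc m)) (applyUpTo g m)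
interlaces-applyUpTo zero    f g le lt = single
interlaces-applyUpTo (suc m) f g le lt = cons (le 0 (s≤s z≤n)) (lt 0 (s≤s z≤n))
  (interlaces-applyUpTo m (λ j → f (suc j)) (λ j → g (suc j)) (λ j j< → le (suc j) (s≤s j<)) (λ j j< → lt (suc j) (s≤s j<)))

array : ℕ → List (List ℕ) → ℕ → ℕ → ℕ
array n xss i j = if i <ᵇ n then nth (rowAt xss (suc i)) j else 2 * j + 1

array-nth : ∀ n xss → length xss ≡ n → ∀ i j → i ≤ n → j ≤ n → array n xss i j ≡ nth (rowAt (odds n ∷ xss) (suc i)) j
array-nth n xss refl i j i≤n j≤n with ℕ.m≤n⇒m<n∨m≡n i≤n
... | inj₁ i<n rewrite <ᵇ-true i<n = cong (λ xs → nth xs j) (sym (rowAt-below (odds n) xss i<n))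
... | inj₂ refl rewrite <ᵇ-irrefl (length xss) = sym (trans (cong (λ xs → nth xs j) (rowAt-top (odds n) xss)) (odds-nth n j j≤n))

pattern-row-length : ∀ {xs xss} → Pattern xs xss → ∀ i → i ≤ suc (length xss) → length (rowAt (xs ∷ xss) i) ≡ i
pattern-row-length {xs} {xss} p i i≤ with ℕ.m≤n⇒m<n∨m≡n i≤
... | inj₂ refl = trans (cong length (rowAt-top xs xss)) (pattern-length p)
pattern-row-length {xs} {[]} done zero i≤ | inj₁ _ = refl
pattern-row-length {xs} {[]} done (suc i) i≤ | inj₁ (s≤s ())
pattern-row-length {xs} {ys ∷ xss} (_ ∷ p) i i≤ | inj₁ (s≤s i≤′) =
  trans (cong length (rowAt-below xs (ys ∷ xss) i≤′)) (pattern-row-length p i i≤′)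

module _ {n : ℕ} {xss : List (List ℕ)} (p : Pattern (odds n) xss) where

  private
    len : length xss ≡ n
    len = ℕ.suc-injective (trans (sym (pattern-length p)) (odds-length n))

  array-staircase : Staircase n (array n xss)
  array-staircase = record { bottom = bottom ; weak = λ i j i<n j≤i → proj₁ (both i j i<n j≤i) ; strict = λ i j i<n j≤i → proj₂ (both i j i<n j≤i) }
    where
    bottom : ∀ j → j ≤ n → array n xss n j ≡ 2 * j + 1
    bottom j _ rewrite <ᵇ-irrefl n = refl
    both : ∀ i j → i < n → j ≤ i → array n xss (suc i) j ≤ array n xss i j × array n xss i j < array n xss (suc i) (suc j)
    both i j i<n j≤i rewrite array-nth n xss len (suc i) j i<n (ℕ.≤-trans j≤i (ℕ.<⇒≤ i<n))
        | array-nth n xss len i j (ℕ.<⇒≤ i<n) (ℕ.≤-trans j≤i (ℕ.<⇒≤ i<n))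
        | array-nth n xss len (suc i) (suc j) i<n (ℕ.≤-trans (s≤s j≤i) i<n) =
      interlaces-≤< (pattern-interlaces p (suc i) (subst (suc i ≤_) (sym len) i<n)) j
        (subst (j <_) (sym (pattern-row-length p (suc i) (s≤s (subst (i ≤_) (sym len) (ℕ.<⇒≤ i<n))))) (s≤s j≤i))

module FromStaircase {n : ℕ} {h : ℕ → ℕ → ℕ} (st : Staircase n h) where
  open Staircase st

  rowList : ℕ → List ℕ
  rowList i = applyUpTo (h (pred i)) i

  pattern-of : List (List ℕ)
  pattern-of = rowsUpTo rowList n

  isPattern : Pattern (odds n) pattern-of
  isPattern = subst (λ xs → Pattern xs pattern-of)
    (sym (nth-ext (odds n) (h n) (suc n) (odds-length n) λ j j< → trans (odds-nth n j (ℕ.≤-pred j<)) (sym (bottom j (ℕ.≤-pred j<)))))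
    (rowsUpTo-pattern n int refl)
    where
    int : ∀ i → i ≤ n → Interlaces (rowList (suc i)) (rowList i)
    int zero    _   = single
    int (suc i) i<n = interlaces-applyUpTo (suc i) (h (suc i)) (h i)
      (λ j j< → weak i j i<n (ℕ.≤-pred j<)) (λ j j< → strict i j i<n (ℕ.≤-pred j<))

  array-agrees : Agree n h (array n pattern-of)
  array-agrees = All.tabulate λ {(i , j)} c∈ → let i≤n , j≤i = ∈-cells {n} c∈ in agrees i j j≤i (ℕ.m≤n⇒m<n∨m≡n i≤n)
    where
    agrees : ∀ i j → j ≤ i → i < n ⊎ i ≡ n → h i j ≡ array n pattern-of i j
    agrees i j j≤i (inj₁ i<n) rewrite <ᵇ-true i<n | rowAt-rowsUpTo {rowList} n (suc i) (s≤s z≤n) i<n = sym (nth-applyUpTo (h i) (suc i) j (s≤s j≤i))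
    agrees i j j≤i (inj₂ refl) rewrite <ᵇ-irrefl n = bottom j j≤i

  agrees-unique : ∀ {xss} → Pattern (odds n) xss → Agree n h (array n xss) → xss ≡ pattern-of
  agrees-unique {xss} p agree = trans (sym (rowsUpTo-rowAt xss)) (trans (cong (rowsUpTo (rowAt xss)) len)
    (rowsUpTo-cong n row≡))
    where
    len : length xss ≡ n
    len = ℕ.suc-injective (trans (sym (pattern-length p)) (odds-length n))
    row≡ : ∀ i → 1 ≤ i → i ≤ n → rowAt xss i ≡ rowList i
    row≡ (suc i) _ i<n = nth-ext (rowAt xss (suc i)) (h i) (suc i)
      (trans (cong length (sym (rowAt-below (odds n) xss (subst (suc i ≤_) (sym len) i<n))))
             (pattern-row-length p (suc i) (s≤s (subst (i ≤_) (sym len) (ℕ.<⇒≤ i<n)))))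
      λ j j< → trans (nth≡ j) (sym (All.lookup agree (cells-∈ {n} (ℕ.<⇒≤ i<n) (ℕ.≤-pred j<))))
      where
      nth≡ : ∀ j → nth (rowAt xss (suc i)) j ≡ array n xss i j
      nth≡ j rewrite <ᵇ-true i<n = refl

  -- Every staircase tableau comes from exactly one pattern, so no output of the shuffle is lost or
  -- counted twice.
  ∑-agree : ∑ (patterns n (odds n)) (λ xss → bit (does (agree? n h (array n xss)))) ≡ 1
  ∑-agree = ∑-single {f = λ xss → bit (does (agree? n h (array n xss)))} (patterns-unique n (odds n)) (patterns-∈ n (odds-length n) isPattern)
    (cong bit (dec-true (agree? n h (array n pattern-of)) array-agrees))
    λ {xss} xss∈ xss≢ → cong bit (dec-false (agree? n h (array n xss)) λ agree →
      xss≢ (agrees-unique (∈-patterns n (odds-length n) xss∈) agree))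

-- The output of the shuffle is a staircase tableau

module _ {n : ℕ} {g ξ : ℕ → ℕ → ℕ} (st : Staircase n g) (ξ≤1 : ∀ i j → ξ i j ≤ 1) where
  open Staircase st

  private
    R = shuffleRows g ξ

    shuffleCell-≥ : ∀ a b x {e} → x ≤ shuffleCell a b x e
    shuffleCell-≥ true  _     x = ℕ.≤-refl
    shuffleCell-≥ false true  x = ℕ.m≤m+n x 1
    shuffleCell-≥ false false x = ℕ.m≤m+n x _

    shuffleCell-≤ : ∀ a b x {e} → e ≤ 1 → shuffleCell a b x e ≤ suc x
    shuffleCell-≤ true  _     x e≤1 = ℕ.n≤1+n x
    shuffleCell-≤ false true  x e≤1 = ℕ.≤-reflexive (ℕ.+-comm x 1)
    shuffleCell-≤ false false x e≤1 = ℕ.≤-trans (ℕ.+-monoʳ-≤ x e≤1) (ℕ.≤-reflexive (ℕ.+-comm x 1))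

    R-≥ : ∀ i j → g i j ≤ R i j
    R-≥ zero    j = shuffleCell-≥ false ((0 <ᵇ j) ∧ (g 0 j ≡ᵇ 0)) (g 0 j)
    R-≥ (suc i) j = shuffleCell-≥ ((j <ᵇ suc i) ∧ (g (suc i) j ≡ᵇ R i j)) _ (g (suc i) j)

    R-≤ : ∀ i j → R i j ≤ suc (g i j)
    R-≤ zero    j = shuffleCell-≤ false ((0 <ᵇ j) ∧ (g 0 j ≡ᵇ 0)) (g 0 j) (ξ≤1 0 j)
    R-≤ (suc i) j = shuffleCell-≤ ((j <ᵇ suc i) ∧ (g (suc i) j ≡ᵇ R i j)) _ (g (suc i) j) (ξ≤1 (suc i) j)

    -- An entry equal to the output above it is kept; any other entry starts strictly below that
    -- output and grows by at most one.
    R-weak : ∀ i j → i < n → j ≤ i → R (suc i) j ≤ R i j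
    R-weak i j i<n j≤i with g (suc i) j ℕ.≟ R i j
    ... | yes eq rewrite <ᵇ-true (s≤s j≤i) | ≡ᵇ-true (g (suc i) j) eq = ℕ.≤-reflexive eq
    ... | no neq = ℕ.≤-trans (R-≤ (suc i) j) (ℕ.≤∧≢⇒< (ℕ.≤-trans (weak i j i<n j≤i) (R-≥ i j)) neq)

    -- A kept entry equals the output entry `R i (suc j)`, so strictness there needs row `i` of the
    -- output to increase, which in turn comes from the inequalities between it and the row above. A
    -- moved entry lands exactly one beyond `R i j`, and an entry in neither case already exceeds
    -- it.
    R-strict : ∀ i j → i < n → j ≤ i → R i j < R (suc i) (suc j)
    R-mono : ∀ i j → i < n → suc j ≤ i → R i j < R i (suc j)

    R-strict i j i<n j≤i with (suc j <ᵇ suc i) ∧ (g (suc i) (suc j) ≡ᵇ R i (suc j)) in stay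
    ... | true = subst (R i j <_) (sym (true-≡ᵇ (g (suc i) (suc j)) (R i (suc j)) (Bool.∧-conicalʳ (suc j <ᵇ suc i) _ stay))) (R-mono i j i<n (ℕ.<ᵇ⇒< j i (subst T (sym (Bool.∧-conicalˡ (suc j <ᵇ suc i) _ stay)) _)))
    ... | false with g (suc i) (suc j) ℕ.≟ R i j
    ...   | yes eq rewrite ≡ᵇ-true (g (suc i) (suc j)) eq = ℕ.≤-reflexive (trans (cong suc (sym eq)) (ℕ.+-comm 1 (g (suc i) (suc j))))
    ...   | no neq = ℕ.<-≤-trans (ℕ.≤∧≢⇒< (ℕ.≤-trans (R-≤ i j) (strict i j i<n j≤i)) λ eq → neq (sym eq))
                       (shuffleCell-≥ false (g (suc i) (suc j) ≡ᵇ R i j) (g (suc i) (suc j)))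
    R-mono (suc i) j i<n (s≤s j≤i) = ℕ.≤-<-trans (R-weak i j (ℕ.<⇒≤ i<n) j≤i) (R-strict i j (ℕ.<⇒≤ i<n) j≤i)

  -- The new bottom row fits because row `n` of the output starts from `2 j + 1` and gains at most
  -- one, staying below `2 j + 3`.
  shuffle-staircase : Staircase (suc n) (shuffle n g ξ)
  shuffle-staircase = record
    { bottom = λ j _ → shuffle-bottom n g ξ j
    ; weak   = λ i j i<1+n j≤i → weak′ i j j≤i (ℕ.m≤n⇒m<n∨m≡n (ℕ.≤-pred i<1+n))
    ; strict = λ i j i<1+n j≤i → strict′ i j j≤i (ℕ.m≤n⇒m<n∨m≡n (ℕ.≤-pred i<1+n)) }
    where
    weak′ : ∀ i j → j ≤ i → i < n ⊎ i ≡ n → shuffle n g ξ (suc i) j ≤ shuffle n g ξ i j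
    weak′ i j j≤i (inj₁ i<n) = subst₂ _≤_ (sym (shuffle-≤ n g ξ j i<n)) (sym (shuffle-≤ n g ξ j (ℕ.<⇒≤ i<n))) (R-weak i j i<n j≤i)
    weak′ i j j≤i (inj₂ refl) = subst₂ _≤_ (trans (bottom j j≤i) (sym (shuffle-bottom n g ξ j))) (sym (shuffle-≤ n g ξ j ℕ.≤-refl)) (R-≥ n j)
    strict′ : ∀ i j → j ≤ i → i < n ⊎ i ≡ n → shuffle n g ξ i j < shuffle n g ξ (suc i) (suc j)
    strict′ i j j≤i (inj₁ i<n) = subst₂ _<_ (sym (shuffle-≤ n g ξ j (ℕ.<⇒≤ i<n))) (sym (shuffle-≤ n g ξ (suc j) i<n)) (R-strict i j i<n j≤i)
    strict′ i j j≤i (inj₂ refl) = subst₂ _<_ (sym (shuffle-≤ n g ξ j ℕ.≤-refl))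
      (trans (cong (λ x → suc (suc x)) (bottom j j≤i)) (trans (cong (_+ 1) (sym (ℕ.*-suc 2 j))) (sym (shuffle-bottom n g ξ (suc j))))) (s≤s (R-≤ n j))

-- Double counting of transitions

matchingArray : ℕ → List Edge → ℕ → ℕ → ℕ
matchingArray n M i j = if i <ᵇ n then nth (positions n M (suc i)) j else 2 * j + 1

matchingArray≡ : ∀ n M i j → matchingArray n M i j ≡ array n (rowsOf n M) i j
matchingArray≡ n M i j with i <ᵇ n in lt
... | false = refl
... | true  = cong (λ xs → nth xs j) (sym (rowAt-rowsUpTo {positions n M} n (suc i) (s≤s z≤n) (ℕ.<ᵇ⇒< i n (subst T (sym lt) _))))

staircase-cong : ∀ {n h h′} → (∀ i j → h i j ≡ h′ i j) → Staircase n h → Staircase n h′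
staircase-cong eq st = record
  { bottom = λ j j≤ → trans (sym (eq _ j)) (bottom j j≤)
  ; weak   = λ i j i< j≤ → subst₂ _≤_ (eq _ j) (eq i j) (weak i j i< j≤)
  ; strict = λ i j i< j≤ → subst₂ _<_ (eq i j) (eq _ (suc j)) (strict i j i< j≤) }
  where open Staircase st

matching-staircase : ∀ {n M} → M ∈ perfectMatchings n → Staircase n (matchingArray n M)
matching-staircase {n} {M} M∈ = staircase-cong (λ i j → sym (matchingArray≡ n M i j)) (array-staircase (matching⇒pattern {n} {M} M∈))

∑-matchings : ∀ n f → ∑ (perfectMatchings n) (λ M → f (rowsOf n M)) ≡ ∑ (patterns n (odds n)) f
∑-matchings n f = trans (sym (∑-map (rowsOf n) (perfectMatchings n) f)) (sum-↭ (↭.map⁺ f (rowsOf-↭ n)))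

-- The numerator of `P`: `tableau n π` unfolds to `matchingArray n (matching n π)`. Taking edge
-- lists as arguments lets sums run over `perfectMatchings`.
transitions : ℕ → List Edge → List Edge → ℕ
transitions n M M′ = outcomeCount n (matchingArray n M) (matchingArray (suc n) M′)

∑-transitions-to : ∀ {n M′} → M′ ∈ perfectMatchings (suc n) → ∑ (perfectMatchings n) (λ M → transitions n M M′) ≡ total n
∑-transitions-to {n} {M′} M′∈ = trans (∑-cong (perfectMatchings n) λ {M} _ → count M)
  (trans (∑-matchings n (weight h n (odds n))) (weight-total n h st))
  where
  h = matchingArray (suc n) M′
  st = matching-staircase {suc n} {M′} M′∈
  count : ∀ M → transitions n M M′ ≡ weight h n (odds n) (rowsOf n M)
  count M = trans (outcomeCount≡∏ n g h (Staircase.bottom st))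
    (trans (∏-last n (λ i → rowWays h (g i) i))
    (trans (cong₂ _*_ (∏-cong n λ i i<n → rowWays-cong h i λ j _ → inner i j i<n)
                      (rowWays-cong h n λ j j≤n → trans (outer j) (sym (odds-nth n j j≤n))))
           (∏-rowWays≡weight h (positions n M) n (odds n))))
    where
    g = matchingArray n M
    inner : ∀ i j → i < n → g i j ≡ nth (positions n M (suc i)) j
    inner i j i<n rewrite <ᵇ-true i<n = refl
    outer : ∀ j → g n j ≡ 2 * j + 1
    outer j rewrite <ᵇ-irrefl n = refl

-- After exchanging the sums, each outcome contributes 1, because its output is a staircase tableau
-- and hence belongs to exactly one matching.
∑-transitions-from : ∀ {n M} → M ∈ perfectMatchings n → ∑ (perfectMatchings (suc n)) (transitions n M) ≡ length (outcomes n)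
∑-transitions-from {n} {M} M∈ = begin
  ∑ (perfectMatchings (suc n)) (transitions n M)
    ≡⟨ ∑-cong (perfectMatchings (suc n)) (λ {M′} _ → length-filter≡∑ (λ S → agree? (suc n) (F S) (matchingArray (suc n) M′)) (outcomes n)) ⟩
  ∑ (perfectMatchings (suc n)) (λ M′ → ∑ (outcomes n) (λ S → hit S (matchingArray (suc n) M′)))
    ≡⟨ ∑-swap (perfectMatchings (suc n)) (outcomes n) (λ M′ S → hit S (matchingArray (suc n) M′)) ⟩
  ∑ (outcomes n) (λ S → ∑ (perfectMatchings (suc n)) (λ M′ → hit S (matchingArray (suc n) M′)))
    ≡⟨ ∑-cong (outcomes n) (λ {S} _ → trans (∑-cong (perfectMatchings (suc n)) λ {M′} _ → hit-cong S M′)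
         (trans (∑-matchings (suc n) (λ xss → hit S (array (suc n) xss)))
                (FromStaircase.∑-agree (shuffle-staircase (matching-staircase {n} {M} M∈) (bits≤1 S))))) ⟩
  ∑ (outcomes n) (λ _ → 1)
    ≡⟨ trans (∑-const (outcomes n) 1) (ℕ.*-identityʳ _) ⟩
  length (outcomes n) ∎
  where
  open ≡-Reasoning
  F : List (ℕ × ℕ) → ℕ → ℕ → ℕ
  F S = shuffle n (matchingArray n M) (bits S)
  hit : List (ℕ × ℕ) → (ℕ → ℕ → ℕ) → ℕ
  hit S h = bit (does (agree? (suc n) (F S) h))
  hit-cong : ∀ S M′ → hit S (matchingArray (suc n) M′) ≡ hit S (array (suc n) (rowsOf (suc n) M′))
  hit-cong S M′ = cong bit (does-⇔
    (mk⇔ (All.map λ {(i , j)} eq → trans eq (matchingArray≡ (suc n) M′ i j))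
         (All.map λ {(i , j)} eq → trans eq (sym (matchingArray≡ (suc n) M′ i j))))
    (agree? (suc n) (F S) (matchingArray (suc n) M′)) (agree? (suc n) (F S) (array (suc n) (rowsOf (suc n) M′))))
  bits≤1 : ∀ S i j → bits S i j ≤ 1
  bits≤1 S i j with does (DecMembership._∈?_ (≡-dec ℕ._≟_ ℕ._≟_) (i , j) S)
  ... | true  = ℕ.≤-refl
  ... | false = z≤n

-- Both sides count the triples of an input, an outcome and the output it leads to.
∣HH∣*total : ∀ n → ∣HH∣ (suc n) * total n ≡ ∣HH∣ n * length (outcomes n)
∣HH∣*total n = begin
  ∣HH∣ (suc n) * total n
    ≡⟨ sym (trans (∑-cong (perfectMatchings (suc n)) λ {M′} M′∈ → ∑-transitions-to {n} {M′} M′∈) (∑-const (perfectMatchings (suc n)) (total n))) ⟩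
  ∑ (perfectMatchings (suc n)) (λ M′ → ∑ (perfectMatchings n) (λ M → transitions n M M′))
    ≡⟨ ∑-swap (perfectMatchings (suc n)) (perfectMatchings n) (λ M′ M → transitions n M M′) ⟩
  ∑ (perfectMatchings n) (λ M → ∑ (perfectMatchings (suc n)) (transitions n M))
    ≡⟨ trans (∑-cong (perfectMatchings n) λ {M} M∈ → ∑-transitions-from {n} {M} M∈) (∑-const (perfectMatchings n) _) ⟩
  ∣HH∣ n * length (outcomes n) ∎
  where open ≡-Reasoning

-- Coefficients

ratio-cong : ∀ a b c d → a * suc d ≡ c * suc b → ratio a (suc b) ≡ ratio c (suc d)
ratio-cong a b c d eq = ℚ.fromℚᵘ-cong {mkℚᵘ (+ a) b} {mkℚᵘ (+ c) d}
  (*≡* (trans (sym (ℤ.pos-* a (suc d))) (trans (cong +_ eq) (ℤ.pos-* c (suc b)))))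

ratio-* : ∀ a b c d → ratio a (suc b) ℚ.* ratio c (suc d) ≡ ratio (a * c) (suc b * suc d)
ratio-* a b c d = ℚ.toℚᵘ-injective (ℚᵘ.≃-trans (ℚ.toℚᵘ-homo-* (ratio a (suc b)) (ratio c (suc d)))
  (ℚᵘ.≃-trans (ℚᵘ.*-cong (ℚ.toℚᵘ-fromℚᵘ (mkℚᵘ (+ a) b)) (ℚ.toℚᵘ-fromℚᵘ (mkℚᵘ (+ c) d)))
  (ℚᵘ.≃-trans (ℚᵘ.≃-reflexive (cong (λ x → mkℚᵘ x (d + b * suc d)) (sym (ℤ.pos-* a c))))
    (ℚᵘ.≃-sym (ℚ.toℚᵘ-fromℚᵘ (mkℚᵘ (+ (a * c)) (d + b * suc d)))))))

ratio-+ : ∀ a c d → ratio a (suc d) ℚ.+ ratio c (suc d) ≡ ratio (a + c) (suc d)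
ratio-+ a c d = ℚ.toℚᵘ-injective (ℚᵘ.≃-trans (ℚ.toℚᵘ-homo-+ (ratio a (suc d)) (ratio c (suc d)))
  (ℚᵘ.≃-trans (ℚᵘ.+-cong (ℚ.toℚᵘ-fromℚᵘ (mkℚᵘ (+ a) d)) (ℚ.toℚᵘ-fromℚᵘ (mkℚᵘ (+ c) d)))
  (ℚᵘ.≃-trans (*≡* (eq (+ a) (+ c) (+ suc d)))
    (ℚᵘ.≃-sym (ℚ.toℚᵘ-fromℚᵘ (mkℚᵘ (+ (a + c)) d))))))
  where
  eq : ∀ A C D → (A ℤ.* D ℤ.+ C ℤ.* D) ℤ.* D ≡ (A ℤ.+ C) ℤ.* (D ℤ.* D)
  eq = ℤRing.solve-∀

total≢0 : ∀ n → ¬ total n ≡ 0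
total≢0 zero    ()
total≢0 (suc n) eq with ℕ.m*n≡0⇒m≡0∨n≡0 (2 ^ suc n) eq
... | inj₁ eq′ = contradiction (ℕ.m^n≡0⇒m≡0 2 (suc n) eq′) λ ()
... | inj₂ eq′ = total≢0 n eq′

module _ {c ℓ : Level} (K : CommutativeRing c ℓ) (ι : ℚ → CommutativeRing.Carrier K)
         (hom : IsRingHomomorphism +-*-rawRing (CommutativeRing.rawRing K) ι) where

  private module K = CommutativeRing K
  open IsRingHomomorphism hom
  open Sum K.+-commutativeMonoid using () renaming (sum to sumᴷ)

  sum-ratio : ∀ {A : Set} (xs : List A) (f : A → ℕ) a b →
              sumᴷ {length xs} (λ i → ι (ratio 1 (suc a)) K.* ι (ratio (f (lookup xs i)) (suc b))) K.≈
              ι (ratio (∑ xs f) (suc a * suc b))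
  sum-ratio []       f a b = K.trans (K.sym 0#-homo) (K.reflexive (cong ι (ratio-cong 0 0 0 (b + a * suc b) refl)))
  sum-ratio (x ∷ xs) f a b = begin
    ι (ratio 1 (suc a)) K.* ι (ratio (f x) (suc b)) K.+ _
      ≈⟨ K.+-cong (K.sym (*-homo _ _)) (sum-ratio xs f a b) ⟩
    ι (ratio 1 (suc a) ℚ.* ratio (f x) (suc b)) K.+ ι (ratio (∑ xs f) (suc a * suc b))
      ≈⟨ K.sym (+-homo _ _) ⟩
    ι (ratio 1 (suc a) ℚ.* ratio (f x) (suc b) ℚ.+ ratio (∑ xs f) (suc a * suc b))
      ≡⟨ cong ι (trans (cong (ℚ._+ ratio (∑ xs f) (suc a * suc b)) (trans (ratio-* 1 a (f x) b) (cong (λ m → ratio m (suc a * suc b)) (ℕ.*-identityˡ (f x)))))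
                       (ratio-+ (f x) (∑ xs f) (b + a * suc b))) ⟩
    ι (ratio (f x + ∑ xs f) (suc a * suc b)) ∎
    where open ≈-Reasoning K.setoid

  -- The sum is `t / (a b)`, and `c t = a b` makes it `1 / c`. As `c` and `t` are nonzero, so are
  -- `a` and `b`, which keeps the default value of `ratio` out.
  sum-uniform : ∀ {A : Set} (xs : List A) (f : A → ℕ) a b c t → ∑ xs f ≡ t → c * t ≡ a * b → ¬ c ≡ 0 → ¬ t ≡ 0 →
                sumᴷ {length xs} (λ i → ι (ratio 1 a) K.* ι (ratio (f (lookup xs i)) b)) K.≈ ι (ratio 1 c)
  sum-uniform xs f a       b       zero    t s≡ eq c≢0 t≢0 = contradiction refl c≢0
  sum-uniform xs f zero    b       (suc c) t s≡ eq c≢0 t≢0 = contradiction (ℕ.m+n≡0⇒m≡0 t eq) t≢0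
  sum-uniform xs f (suc a) zero    (suc c) t s≡ eq c≢0 t≢0 = contradiction (ℕ.m+n≡0⇒m≡0 t (trans eq (ℕ.*-zeroʳ a))) t≢0
  sum-uniform xs f (suc a) (suc b) (suc c) t s≡ eq c≢0 t≢0 = K.trans (sum-ratio xs f a b)
    (K.reflexive (cong ι (trans (cong (λ m → ratio m (suc a * suc b)) s≡)
      (ratio-cong t (b + a * suc b) 1 c (trans (ℕ.*-comm t (suc c)) (trans eq (sym (ℕ.*-identityˡ _))))))))

proposition4p6 : ∀ {c ℓ : Level} (K : CommutativeRing c ℓ)
  (ι : ℚ → CommutativeRing.Carrier K) →
  IsRingHomomorphism +-*-rawRing (CommutativeRing.rawRing K) ι →
  let open Linear K ι
      open CommutativeRing K using (_≈_)
  in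
  (n : ℕ) (π : HH (suc n)) → ψ n (μ n) π ≈ μ (suc n) π
proposition4p6 K ι hom n π = sum-uniform K ι hom (perfectMatchings n) (λ M → transitions n M (matching (suc n) π))
  (∣HH∣ n) (length (outcomes n)) (∣HH∣ (suc n)) (total n)
  -- The coordinate `π` itself shows that `HH (suc n)` is inhabited, so its cardinality is a
  -- legitimate denominator.
  (∑-transitions-to {n} {matching (suc n) π} (∈-lookup π)) (∣HH∣*total n) (nonempty π) (total≢0 n)
  where
  nonempty : ∀ {m} → Fin m → ¬ m ≡ 0
  nonempty Fin.zero ()
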